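{- Let $\mathcal G$ be a class of (finite, undirected) graphs. The following four statements are equivalent. (1) $\mathcal G$ has structurally bounded expansion, i.e., there exist a graph class $\mathcal G'$ with bounded expansion and a first-order transduction $\tau$ such that $\mathcal G \subseteq \tau(\mathcal G')$. (2) There exists a function $f:\mathbb N\to\mathbb N$ such that every graph in $\mathcal G$ has a lacon-decomposition $(L,\pi)$ with $\mathrm{col}_r(L,\pi) \le f(r)$ for all $r \in \mathbb N$. (3) There exist a signature $S$, a number $d$ and a graph class $\mathcal G'$ with bounded expansion such that every graph in $\mathcal G$ has a shrub-decomposition $(F,S)$ with one color and diameter at most $d$ and with $F \in \mathcal G'$. (4) There exist a number $d$ and a graph class $\mathcal G'$ with bounded expansion such that every graph in $\mathcal G$ has a parity-decomposition $P \in \mathcal G'$ of target-degree at most $d$.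
   Context: A linear order on the vertices of a graph is an injective map $\pi: V\to\mathbb N$. For a graph $G$, order $\pi$ and vertices $u,v$: $u$ is $r$-reachable from $v$ if $\pi(u)\le\pi(v)$ and there is a path of length (number of edges) at most $r$ from $v$ to $u$ all of whose vertices $w$ satisfy $w=u$ or $\pi(w)\ge\pi(v)$. $\mathrm{reach}_r(G,\pi,v)$ is the set of vertices $r$-reachable from $v$ and $\mathrm{col}_r(G,\pi)=\max_v|\mathrm{reach}_r(G,\pi,v)|$. A graph class has bounded expansion if there is a function $f$ such that every graph $G$ in the class has an order $\pi$ with $\mathrm{col}_r(G,\pi)\le f(r)$ for all $r$. Lacon-decomposition: a pair $(L,\pi)$ where $L$ is a bipartite graph with sides $T$ (target vertices) and $H$ (hidden vertices), each hidden vertex is labeled "0" or "1", $\pi$ is a linear order on $V(L)$ with $\pi(h)<\pi(t)$ for all $h\in H,t\in T$, and for all $t,t'\in T$ we have $N(t)\cap N(t')\neq\emptyset$; the $\pi$-largest vertex of $N(t)\cap N(t')$ is the dominant vertex of $t,t'$. It is a lacon-decomposition of a graph $G$ if $V(G)=T$ and for all $t\ne t'\in T$, $tt'\in E(G)$ iff the dominant vertex of $t,t'$ is labeled "1". Shrub-decomposition of $m$ colors and diameter $d$ of a graph $G$: a pair $(F,S)$ with $F$ an undirected graph and $S\subseteq\{1,\dots,m\}^2\times\{1,\dots,d\}$ such that any two vertices of $F$ have distance at most $d$ in $F$, the set of degree-one vertices of $F$ is exactly $V(G)$, each degree-one vertex of $F$ is assigned a color in $\{1,\dots,m\}$, $(i,j,l)\in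 S$ iff $(j,i,l)\in S$, and for all $u,v\in V(G)$ with colors $i,j$ and $F$-distance $l$, $uv\in E(G)$ iff $(i,j,l)\in S$. Parity-decomposition of target-degree $d$ of a graph $G$: a bipartite graph $P$ with sides $T,H$ in which every vertex of $T$ has degree at most $d$, $T=V(G)$, and for all $t\ne t'\in T$, $tt'\in E(G)$ iff $|N(t)\cap N(t')|$ is odd. First-order transductions: a basic transduction is a triple $\tau_0=(\chi,\nu,\varphi)$ of first-order formulas with $0,1,2$ free variables; $\tau_0(G)$ is undefined if $G\not\models\chi$, otherwise it is the graph with vertex set $\{v: G\models\nu(v)\}$ and edges $uv$ ($u\neq v$) with $G\models\varphi(u,v)\lor\varphi(v,u)$. A $p$-parameter expansion maps $G$ to the set of all graphs obtained by adding $p$ unary predicates (colors) to $G$. An $m$-copy operation maps $G$ to the graph with vertex set $V(G)\times\{1,\dots,m\}$, edges $(v,i)(w,i)$ for $vw\in E(G)$, a binary relation $\sim$ with $(u,i)\sim(v,j)$ iff $u=v$, and unary predicates $Q_i=V(G)\times\{i\}$. A transduction is $\tau=\tau_0\circ\gamma\circ\varepsilon$ with $\varepsilon$ a parameter expansion, $\gamma$ a copy operation, $\tau_0$ a basic transduction; $\tau(\mathcal G')=\bigcup_{G\in\mathcal G'}\tau(G)$. -}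

module Defs where

open import Data.Nat using (ℕ; zero; suc; _+_; _≤_; _<_; _%_)
open import Data.Bool using (Bool; true; false; _∧_; _∨_; not; if_then_else_)
open import Data.Fin using (Fin; splitAt) renaming (zero to fz; suc to fs)
open import Data.Fin.Properties using (_≟_)
open import Data.List using (List; []; _∷_; length; cartesianProduct; allFin)
open import Data.Bool.ListAction using (any; all)
open import Data.List.Relation.Unary.All using (All)
open import Data.List.Relation.Unary.Unique.Propositional using (Unique)
open import Data.Product using (Σ; ∃; _×_; _,_; proj₁; proj₂)
open import Data.Sum using (_⊎_; inj₁; inj₂)
open import Relation.Binary.PropositionalEquality using (_≡_; _≢_)
open import Relation.Nullary.Decidable using (⌊_⌋)
open import Function.Definitions using (Injective)
open import Function.Bundles using (_⇔_)

record Graph : Set where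
  field
    size  : ℕ
    adj   : Fin size → Fin size → Bool
    sym   : ∀ u v → adj u v ≡ adj v u
    irrefl : ∀ v → adj v v ≡ false
open Graph public

V : Graph → Set
V G = Fin (size G)

Class : Set₁
Class = Graph → Set

count : ∀ {n} → (Fin n → Bool) → ℕ
count {zero}  p = 0
count {suc n} p = (if p fz then 1 else 0) + count (λ i → p (fs i))

data Walk (G : Graph) : V G → V G → Set where
  here : ∀ {v} → Walk G v v
  step : ∀ {u w v} → adj G u w ≡ true → Walk G w v → Walk G u v

len : ∀ {G u v} → Walk G u v → ℕ
len here       = 0
len (step _ w) = suc (len w)

verts : ∀ {G u v} → Walk G u v → List (V G)
verts {u = u} here       = u ∷ []
verts {u = u} (step _ w) = u ∷ verts w

IsPath : ∀ {G u v} → Walk G u v → Set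
IsPath w = Unique (verts w)

Dist : (G : Graph) → V G → V G → ℕ → Set
Dist G x y l = (Σ (Walk G x y) λ w → len w ≡ l) × (∀ (w : Walk G x y) → l ≤ len w)

-- a linear order on V(G): an injective map V(G) → ℕ
IsOrder : (G : Graph) → (V G → ℕ) → Set
IsOrder G π = Injective _≡_ _≡_ π

Reach : (G : Graph) → (V G → ℕ) → ℕ → V G → V G → Set
Reach G π r v u =
  π u ≤ π v ×
  Σ (Walk G v u) λ p → IsPath p × len p ≤ r ×
    All (λ w → w ≡ u ⊎ π v ≤ π w) (verts p)

ColLE : (G : Graph) → (V G → ℕ) → ℕ → ℕ → Set
ColLE G π r k = ∀ (v : V G) (xs : List (V G)) → Unique xs →
  All (Reach G π r v) xs → length xs ≤ k

BoundedExpansion : Class → Set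
BoundedExpansion 𝒢 = Σ (ℕ → ℕ) λ f → ∀ (G : Graph) → 𝒢 G →
  Σ (V G → ℕ) λ π → IsOrder G π × (∀ r → ColLE G π r (f r))

data Formula (k : ℕ) : ℕ → Set where
  eqF   : ∀ {n} → Fin n → Fin n → Formula k n
  edgeF : ∀ {n} → Fin n → Fin n → Formula k n
  simF  : ∀ {n} → Fin n → Fin n → Formula k n
  predF : ∀ {n} → Fin k → Fin n → Formula k n
  negF  : ∀ {n} → Formula k n → Formula k n
  andF  : ∀ {n} → Formula k n → Formula k n → Formula k n
  orF   : ∀ {n} → Formula k n → Formula k n → Formula k n
  exF   : ∀ {n} → Formula k (suc n) → Formula k n
  allF  : ∀ {n} → Formula k (suc n) → Formula k n

-- finite structures: universe U enumerated by dom
record Structure (k : ℕ) : Set₁ where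
  field
    U    : Set
    dom  : List U
    eqU  : U → U → Bool
    E    : U → U → Bool
    Sim  : U → U → Bool
    P    : Fin k → U → Bool

extend : ∀ {A : Set} {n} → A → (Fin n → A) → Fin (suc n) → A
extend a ρ fz     = a
extend a ρ (fs i) = ρ i

eval : ∀ {k} (M : Structure k) {n} → Formula k n → (Fin n → Structure.U M) → Bool
eval M (eqF i j)   ρ = Structure.eqU M (ρ i) (ρ j)
eval M (edgeF i j) ρ = Structure.E M (ρ i) (ρ j)
eval M (simF i j)  ρ = Structure.Sim M (ρ i) (ρ j)
eval M (predF c i) ρ = Structure.P M c (ρ i)
eval M (negF φ)    ρ = not (eval M φ ρ)
eval M (andF φ ψ)  ρ = eval M φ ρ ∧ eval M ψ ρ
eval M (orF φ ψ)   ρ = eval M φ ρ ∨ eval M ψ ρ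
eval M (exF φ)     ρ = any (λ a → eval M φ (extend a ρ)) (Structure.dom M)
eval M (allF φ)    ρ = all (λ a → eval M φ (extend a ρ)) (Structure.dom M)

noVars : ∀ {A : Set} → Fin 0 → A
noVars ()

one : ∀ {A : Set} → A → Fin 1 → A
one a _ = a

two : ∀ {A : Set} → A → A → Fin 2 → A
two a b fz     = a
two a b (fs _) = b

-- Transductions  τ = τ₀ ∘ γ ∘ ε
-- ε : p-parameter expansion (p unary colors), γ : m-copy operation,
-- τ₀ = (χ, ν, φ) basic transduction over the signature with E, ~ and the
-- p + m unary predicates (the p colors, then Q_1..Q_m).

record Transduction : Set where
  field
    p   : ℕ
    m   : ℕ
    chi : Formula (p + m) 0
    nu  : Formula (p + m) 1
    phi : Formula (p + m) 2

_==ᶠ_ : ∀ {n} → Fin n → Fin n → Bool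
i ==ᶠ j = ⌊ i ≟ j ⌋

copyStructure : (p m : ℕ) (G : Graph) → (Fin p → V G → Bool) → Structure (p + m)
copyStructure p m G c = record
  { U   = V G × Fin m
  ; dom = cartesianProduct (allFin (size G)) (allFin m)
  ; eqU = λ x y → (proj₁ x ==ᶠ proj₁ y) ∧ (proj₂ x ==ᶠ proj₂ y)
  ; E   = λ x y → adj G (proj₁ x) (proj₁ y) ∧ (proj₂ x ==ᶠ proj₂ y)
  ; Sim = λ x y → proj₁ x ==ᶠ proj₁ y
  ; P   = λ q x → predOf (splitAt p q) x
  }
  where
  predOf : Fin p ⊎ Fin m → V G × Fin m → Bool
  predOf (inj₁ col) x = c col (proj₁ x)
  predOf (inj₂ i)   x = proj₂ x ==ᶠ i

IsBasicOutput : ∀ {k} (M : Structure k) → Formula k 0 → Formula k 1 → Formula k 2 → Graph → Set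
IsBasicOutput M χ ν φ H =
  eval M χ noVars ≡ true ×
  Σ (V H → Structure.U M) λ f →
    Injective _≡_ _≡_ f ×
    (∀ u → eval M ν (one (f u)) ≡ true) ×
    (∀ x → eval M ν (one x) ≡ true → ∃ λ u → f u ≡ x) ×
    (∀ u v → u ≢ v → adj H u v ≡ (eval M φ (two (f u) (f v)) ∨ eval M φ (two (f v) (f u))))

InTransduction : Transduction → Graph → Graph → Set
InTransduction τ G H = Σ (Fin p → V G → Bool) λ c →
    IsBasicOutput (copyStructure p m G c) chi nu phi H
  where open Transduction τ

InTransductionClass : Transduction → Class → Graph → Set
InTransductionClass τ 𝒢' H = Σ Graph λ G → 𝒢' G × InTransduction τ G H

StructurallyBoundedExpansion : Class → Set₁
StructurallyBoundedExpansion 𝒢 = Σ Class λ 𝒢' → BoundedExpansion 𝒢' ×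
  Σ Transduction λ τ → ∀ H → 𝒢 H → InTransductionClass τ 𝒢' H

data Side : Set where
  tgt hid : Side

record TargetEmbedding (G L : Graph) (side : V L → Side) : Set where
  field
    emb      : V G → V L
    emb-inj  : Injective _≡_ _≡_ emb
    emb-tgt  : ∀ u → side (emb u) ≡ tgt
    emb-onto : ∀ x → side x ≡ tgt → ∃ λ u → emb u ≡ x

IsBipartite : (L : Graph) → (V L → Side) → Set
IsBipartite L side = ∀ x y → adj L x y ≡ true → side x ≢ side y

Dominant : (L : Graph) → (V L → ℕ) → V L → V L → V L → Set
Dominant L π t t' h = adj L t h ≡ true × adj L t' h ≡ true ×
  (∀ h' → adj L t h' ≡ true → adj L t' h' ≡ true → π h' ≤ π h)

record Lacon (G : Graph) : Set where
  field
    L        : Graph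
    side     : V L → Side
    bip      : IsBipartite L side
    label    : V L → Bool          -- labels "1" = true, "0" = false (used on hidden vertices)
    π        : V L → ℕ
    π-order  : IsOrder L π
    π-hid<tgt : ∀ h t → side h ≡ hid → side t ≡ tgt → π h < π t
    common   : ∀ t t' → side t ≡ tgt → side t' ≡ tgt →
               ∃ λ h → adj L t h ≡ true × adj L t' h ≡ true
    target   : TargetEmbedding G L side
    edges    : ∀ u v → u ≢ v →
               (adj G u v ≡ true ⇔
                 (∃ λ h → Dominant L π (TargetEmbedding.emb target u)
                                       (TargetEmbedding.emb target v) h
                          × label h ≡ true))

Degree1 : (F : Graph) → V F → Set
Degree1 F x = ∃ λ y → adj F x y ≡ true × (∀ z → adj F x z ≡ true → z ≡ y)

-- S ⊆ {1..m}² × {1..d} represented by its characteristic function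
record Shrub (m d : ℕ) (S : Fin m → Fin m → ℕ → Bool) (G : Graph) : Set where
  field
    F         : Graph
    S-range   : ∀ i j l → S i j l ≡ true → 1 ≤ l × l ≤ d
    S-sym     : ∀ i j l → S i j l ≡ S j i l
    diam      : ∀ x y → Σ (Walk F x y) λ w → len w ≤ d
    emb       : V G → V F
    emb-inj   : Injective _≡_ _≡_ emb
    emb-leaf  : ∀ u → Degree1 F (emb u)
    leaf-emb  : ∀ x → Degree1 F x → ∃ λ u → emb u ≡ x
    color     : V G → Fin m
    edges     : ∀ u v l → Dist F (emb u) (emb v) l →
                (adj G u v ≡ true ⇔ S (color u) (color v) l ≡ true)

degree : (P : Graph) → V P → ℕ
degree P x = count (λ y → adj P x y)

commonCount : (P : Graph) → V P → V P → ℕ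
commonCount P x y = count (λ h → adj P x h ∧ adj P y h)

record Parity (d : ℕ) (G : Graph) : Set where
  field
    P      : Graph
    side   : V P → Side
    bip    : IsBipartite P side
    deg    : ∀ t → side t ≡ tgt → degree P t ≤ d
    target : TargetEmbedding G P side
    edges  : ∀ u v → u ≢ v →
             (adj G u v ≡ true ⇔
               commonCount P (TargetEmbedding.emb target u) (TargetEmbedding.emb target v) % 2 ≡ 1)

Cond1 : Class → Set₁
Cond1 𝒢 = StructurallyBoundedExpansion 𝒢

Cond2 : Class → Set
Cond2 𝒢 = Σ (ℕ → ℕ) λ f → ∀ G → 𝒢 G →
  Σ (Lacon G) λ D → ∀ r → ColLE (Lacon.L D) (Lacon.π D) r (f r)

Cond3 : Class → Set₁
Cond3 𝒢 = Σ (Fin 1 → Fin 1 → ℕ → Bool) λ S → Σ ℕ λ d → Σ Class λ 𝒢' →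
  BoundedExpansion 𝒢' × (∀ G → 𝒢 G → Σ (Shrub 1 d S G) λ D → 𝒢' (Shrub.F D))

Cond4 : Class → Set₁
Cond4 𝒢 = Σ ℕ λ d → Σ Class λ 𝒢' →
  BoundedExpansion 𝒢' × (∀ G → 𝒢 G → Σ (Parity d G) λ D → 𝒢' (Parity.P D))

{-# OPTIONS --safe #-}
module Submission where

-- Everything reduces to set systems t ↦ R t ⊆ Y over a linearly ordered ground set Y in which chains
-- y₀, y₁, … (consecutive elements lying in a common R t) reach only boundedly many smaller elements. If each
-- vertex of a graph is owned by some t or by some subset A of Y, and edges between owners respect A ⊆ R t,
-- then ordering the vertices by the largest element of the owning set keeps the colouring numbers bounded.
--
-- (1) ⇒ (2): let R t be the set of vertices weakly r-reachable from t. Deleting A = R t ∩ R t' puts t and t'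
-- at distance more than r, so by locality of first-order logic the adjacency of t and t' depends only on A
-- and on the types of t and t' over A, which range over a set of bounded size. Hidden vertices are triples
-- (A , α , β), joined to the t with A ⊆ R t whose type is α or β, and larger sets dominate smaller ones.
--
-- (2) ⇒ (3), (4): for R t = N(t) adjacency is a function of R t ∩ R t'. Möbius inversion over 𝔽₂ turns this
-- function into the parity of the number of selected subsets of R t ∩ R t'; joining t to each A ⊆ R t by paths
-- that get shorter as A grows turns it into the distance of t and t'.
--
-- (3), (4) ⇒ (1): bounded distances and bounded numbers of common neighbours are first-order definable.

open import Defs hiding (sym)
open import Data.Bool using (Bool; true; false; _∧_; _∨_; not; if_then_else_; _xor_)
open import Data.Bool.ListAction using (any; all)
open import Data.Bool.Properties using (∨-comm) renaming (_≟_ to _≟ᵇ_)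
open import Data.Fin using (Fin; toℕ; fromℕ<; combine; funToFin; finToFun; splitAt; _↑ˡ_; _↑ʳ_)
  renaming (zero to fz; suc to fs)
open import Data.Fin.Properties as Finₚ using (any?; all?; toℕ<n; toℕ-injective; pigeonhole)
  renaming (_≟_ to _≟ᶠ_)
open import Data.Fin.Subset using (Subset; _∩_; ∣_∣; _⊆_)
  renaming (_∈_ to _∈ˢ_; ⊥ to ∅)
open import Data.Fin.Subset.Properties
  using (_∈?_; _⊆?_; ⊆-antisym; p⊂q⇒∣p∣<∣q∣; p⊆q⇒∣p∣≤∣q∣; x∈p∩q⁺; x∈p∩q⁻; p∩q⊆p; p∩q⊆q; ∩-comm;
         Empty-unique; drop-∷-⊆; s⊆s; out⊆; ⊆-min)
open import Data.List
  using (List; []; _∷_; length; map; concatMap; filter; _++_; allFin; cartesianProduct; lookup)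
open import Data.List.Properties
  using (length-map; length-++; length-removeAt′; length-tabulate)
open import Data.List.Membership.Propositional using (_∈_; _∉_; lose)
open import Data.List.Membership.Propositional.Properties
  using (∈-map⁺; ∈-map⁻; ∈-++⁺ˡ; ∈-++⁺ʳ; ∈-concatMap⁺; ∈-filter⁺; ∈-filter⁻; ∈-allFin;
         ∈-cartesianProduct⁺; ∈-lookup)
open import Data.List.Relation.Unary.All as All using (All; []; _∷_)
open import Data.List.Relation.Unary.All.Properties using (all-filter)
open import Data.List.Relation.Unary.AllPairs using ([]; _∷_)
open import Data.List.Relation.Unary.Any using (here; there; index; _─_)
open import Data.List.Relation.Unary.Any.Properties using (lookup-index)
open import Data.List.Relation.Unary.Unique.Propositional using (Unique)
open import Data.List.Relation.Unary.Unique.Propositional.Properties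
  using (allFin⁺; map⁺; ++⁺; cartesianProduct⁺; filter⁺)
open import Data.Maybe using (Maybe; just; nothing)
open import Data.Nat
  using (ℕ; zero; suc; _+_; _*_; _∸_; _^_; _≤_; _<_; z≤n; s≤s; _⊔_; _⊓_; _%_; _≤?_; _<?_)
  renaming (_≟_ to _≟ⁿ_)
open import Data.Nat.Properties
open import Data.Product using (Σ; ∃-syntax; _×_; _,_; proj₁; proj₂)
open import Data.Sum using (_⊎_; inj₁; inj₂; [_,_]′)
open import Data.Vec using (Vec; []; _∷_; tabulate; replicate)
open import Data.Vec.Properties using (lookup∘tabulate; []=⇒lookup; lookup⇒[]=)
open import Function using (_∘_; id)
open import Function.Bundles using (_⇔_; mk⇔; Equivalence)
open import Function.Definitions using (Injective)
open import Relation.Binary.Definitions using (DecidableEquality; tri<; tri≈; tri>)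
open import Relation.Binary.PropositionalEquality
  using (_≡_; _≢_; refl; sym; trans; cong; cong₂; subst; subst₂; _≗_; module ≡-Reasoning)
open import Relation.Nullary using (¬_; Dec; yes; no; contradiction)
open import Relation.Nullary.Decidable using (⌊_⌋; _×-dec_; _⊎-dec_; _→-dec_; ¬?; map′)
import Data.Empty
import Data.List.Membership.DecPropositional
import Data.Maybe
import Data.Nat.Solver
import Data.Product.Properties
import Data.Sum.Properties
import Data.Unit

-- All bounds may depend only on `τ` and `f`, but the types themselves need not be canonical: two
-- pairs are compared only when their reachability sets have the same intersection `A`, hence inside
-- one structure with one set of deleted vertices. So a type may refer to particular elements of the
-- graph, as long as the number of types is uniform. This allows a direct proof of locality without
-- Gaifman normal forms, in which the existence of a far element of a given type is tested in fixed
-- balls of the graph at hand. The other obstacle is that a set `A` may lie in `R t` for arbitrarily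
-- many `t`, so degrees are unbounded and only the order keeps reachability small. A walk between
-- sets passes through targets, and the largest elements of consecutive sets share some `R t`. Walks
-- in each constructed graph thus project to chains in the ground set, and these are controlled by
-- the colouring numbers of the graph from which the system came. Hence one counting argument serves
-- the lacon, parity and shrub graphs alike.

⌊⌋⁻ : {P : Set} (d : Dec P) → ⌊ d ⌋ ≡ true → P
⌊⌋⁻ (yes p) _ = p

⌊⌋⁺ : {P : Set} (d : Dec P) → P → ⌊ d ⌋ ≡ true
⌊⌋⁺ (yes _) _ = refl
⌊⌋⁺ (no ¬p) p = contradiction p ¬p

⌊⌋-no : {P : Set} (d : Dec P) → ¬ P → ⌊ d ⌋ ≡ false
⌊⌋-no (yes p) ¬p = contradiction p ¬p
⌊⌋-no (no _)  _  = refl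

bool-ext : {a b : Bool} → (a ≡ true → b ≡ true) → (b ≡ true → a ≡ true) → a ≡ b
bool-ext {true}  {_}     f g = sym (f refl)
bool-ext {false} {true}  f g = g refl
bool-ext {false} {false} f g = refl

⌊⌋-cong : {P Q : Set} (d : Dec P) (e : Dec Q) → (P → Q) → (Q → P) → ⌊ d ⌋ ≡ ⌊ e ⌋
⌊⌋-cong d e f g = bool-ext (⌊⌋⁺ e ∘ f ∘ ⌊⌋⁻ d) (⌊⌋⁺ d ∘ g ∘ ⌊⌋⁻ e)

∧-true⁻ : ∀ {a b} → a ∧ b ≡ true → a ≡ true × b ≡ true
∧-true⁻ {true} {true} _ = refl , refl

∧-true⁺ : ∀ {a b} → a ≡ true → b ≡ true → a ∧ b ≡ true
∧-true⁺ refl refl = refl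

∨-true⁻ : ∀ {a b} → a ∨ b ≡ true → a ≡ true ⊎ b ≡ true
∨-true⁻ {true}  _ = inj₁ refl
∨-true⁻ {false} e = inj₂ e

∨-true⁺ʳ : ∀ {a b} → b ≡ true → a ∨ b ≡ true
∨-true⁺ʳ {true}  _ = refl
∨-true⁺ʳ {false} e = e

∨-true⁺ˡ : ∀ {a b} → a ≡ true → a ∨ b ≡ true
∨-true⁺ˡ refl = refl

not-true⁻ : ∀ {a} → not a ≡ true → a ≢ true
not-true⁻ {false} _ ()

not-true⁺ : ∀ {a} → a ≢ true → not a ≡ true
not-true⁺ {true}  h = contradiction refl h
not-true⁺ {false} _ = refl

any⁻ : {A : Set} (p : A → Bool) (xs : List A) → any p xs ≡ true → ∃[ x ] x ∈ xs × p x ≡ true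
any⁻ p (x ∷ xs) e with ∨-true⁻ {p x} e
... | inj₁ px = x , here refl , px
... | inj₂ h with any⁻ p xs h
...   | y , y∈ , py = y , there y∈ , py

any⁺ : {A : Set} (p : A → Bool) {xs : List A} {x : A} → x ∈ xs → p x ≡ true → any p xs ≡ true
any⁺ p (here refl) px rewrite px = refl
any⁺ p {y ∷ _} (there m) px = ∨-true⁺ʳ {p y} (any⁺ p m px)

all-any : {A : Set} (p : A → Bool) (xs : List A) → all p xs ≡ not (any (not ∘ p) xs)
all-any p [] = refl
all-any p (x ∷ xs) with p x
... | true  = all-any p xs
... | false = refl

-- Finite covers

remove-∈ : {A : Set} {x y : A} {ys : List A} (x∈ : x ∈ ys) → y ∈ ys → y ≢ x → y ∈ (ys ─ x∈)
remove-∈ (here refl) (here refl) y≢ = contradiction refl y≢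
remove-∈ (here refl) (there m)   _  = m
remove-∈ (there _)   (here refl) _  = here refl
remove-∈ (there x∈)  (there m)   y≢ = there (remove-∈ x∈ m y≢)

unique-⊆⇒length≤ : {A : Set} {xs ys : List A} → Unique xs → (∀ {x} → x ∈ xs → x ∈ ys) →
  length xs ≤ length ys
unique-⊆⇒length≤ {xs = []} _ _ = z≤n
unique-⊆⇒length≤ {xs = x ∷ xs} {ys} (x∉ ∷ u) sub = begin
  suc (length xs)          ≤⟨ s≤s (unique-⊆⇒length≤ u λ m →
                                remove-∈ x∈ (sub (there m)) λ { refl → All.lookup x∉ m refl }) ⟩
  suc (length (ys ─ x∈))   ≡⟨ sym (length-removeAt′ ys (index x∈)) ⟩
  length ys                ∎
  where
  open ≤-Reasoning
  x∈ = sub (here refl)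

-- The list may contain repetitions and strangers, so covers pass to unions, products and images
-- without deciding equality. `AtMost` is the form that `ColLE` demands.
Cover : {A : Set} → (A → Set) → ℕ → Set
Cover {A} P k = Σ (List A) λ ys → length ys ≤ k × (∀ x → P x → x ∈ ys)

AtMost : {A : Set} → (A → Set) → ℕ → Set
AtMost {A} P k = ∀ (xs : List A) → Unique xs → All P xs → length xs ≤ k

cover⇒atMost : {A : Set} {P : A → Set} {k : ℕ} → Cover P k → AtMost P k
cover⇒atMost (ys , l , c) xs u ps =
  ≤-trans (unique-⊆⇒length≤ u (λ m → c _ (All.lookup ps m))) l

atMost⇒cover : ∀ {n k} {P : Fin n → Set} → (∀ x → Dec (P x)) → AtMost P k → Cover P k
atMost⇒cover {n} P? h =
  filter P? (allFin n) ,
  h _ (filter⁺ P? (allFin⁺ n)) (all-filter P? (allFin n)) ,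
  λ x px → ∈-filter⁺ P? (∈-allFin x) px

cover-mono : {A : Set} {P Q : A → Set} {k : ℕ} → (∀ x → Q x → P x) → Cover P k → Cover Q k
cover-mono f (ys , l , c) = ys , l , λ x q → c x (f x q)

cover-≤ : {A : Set} {P : A → Set} {k l : ℕ} → k ≤ l → Cover P k → Cover P l
cover-≤ k≤l (ys , l , c) = ys , ≤-trans l k≤l , c

cover-⊎ : {A : Set} {P Q : A → Set} {k l : ℕ} → Cover P k → Cover Q l → Cover (λ x → P x ⊎ Q x) (k + l)
cover-⊎ (ys , l , c) (ys' , l' , c') =
  ys ++ ys' ,
  ≤-trans (≤-reflexive (length-++ ys)) (+-mono-≤ l l') ,
  λ x → λ { (inj₁ p) → ∈-++⁺ˡ (c x p) ; (inj₂ q) → ∈-++⁺ʳ ys (c' x q) }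

length-cartesianProduct : {A B : Set} (xs : List A) (ys : List B) →
  length (cartesianProduct xs ys) ≡ length xs * length ys
length-cartesianProduct []       ys = refl
length-cartesianProduct (x ∷ xs) ys =
  trans (length-++ (map (x ,_) ys)) (cong₂ _+_ (length-map _ ys) (length-cartesianProduct xs ys))

cover-× : {A B : Set} {P : A → Set} {Q : B → Set} {k l : ℕ} → Cover P k → Cover Q l →
  Cover {A × B} (λ x → P (proj₁ x) × Q (proj₂ x)) (k * l)
cover-× (ys , l , c) (ys' , l' , c') =
  cartesianProduct ys ys' ,
  ≤-trans (≤-reflexive (length-cartesianProduct ys ys')) (*-mono-≤ l l') ,
  λ { (x , y) (p , q) → ∈-cartesianProduct⁺ (c x p) (c' y q) }

cover-image : {A B : Set} {P : A → Set} {Q : B → Set} {k : ℕ} (f : A → B) →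
  (∀ y → Q y → ∃[ x ] P x × f x ≡ y) → Cover P k → Cover Q k
cover-image {Q = Q} f h (ys , l , c) =
  map f ys , ≤-trans (≤-reflexive (length-map f ys)) l , mem
  where
  mem : ∀ y → Q y → y ∈ map f ys
  mem y q with h y q
  ... | x , p , refl = ∈-map⁺ f (c x p)

cover-Fin : ∀ n → Cover {Fin n} (λ _ → Fin n) n
cover-Fin n = allFin n , ≤-reflexive (length-tabulate id) , λ x _ → ∈-allFin x

length-concatMap≤ : {A B : Set} (g : A → List B) (b : ℕ) → (∀ x → length (g x) ≤ b) →
  ∀ ys → length (concatMap g ys) ≤ length ys * b
length-concatMap≤ g b h []       = z≤n
length-concatMap≤ g b h (y ∷ ys) =
  ≤-trans (≤-reflexive (length-++ (g y))) (+-mono-≤ (h y) (length-concatMap≤ g b h ys))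

∈-concatMap : {A B : Set} (g : A → List B) {ys : List A} {y : A} {z : B} →
  y ∈ ys → z ∈ g y → z ∈ concatMap g ys
∈-concatMap g {ys} y∈ z∈ = ∈-concatMap⁺ g {xs = ys} (lose y∈ z∈)

cover-bind : {A B : Set} {P : A → Set} {Q : B → Set} {k l : ℕ} (S : A → B → Set) →
  Cover P k → (∀ x → Cover (S x) l) → (∀ y → Q y → ∃[ x ] P x × S x y) → Cover Q (k * l)
cover-bind {Q = Q} {l = l} S (ys , len , c) d h =
  concatMap (λ x → proj₁ (d x)) ys ,
  ≤-trans (length-concatMap≤ _ l (λ x → proj₁ (proj₂ (d x))) ys) (*-monoˡ-≤ l len) ,
  mem
  where
  mem : ∀ y → Q y → y ∈ concatMap (λ x → proj₁ (d x)) ys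
  mem y q with h y q
  ... | x , p , s = ∈-concatMap _ (c x p) (proj₂ (proj₂ (d x)) y s)

-- Subsets of Fin n

⟦_⟧ : ∀ {n} {P : Fin n → Set} → (∀ x → Dec (P x)) → Subset n
⟦ P? ⟧ = tabulate (λ x → ⌊ P? x ⌋)

∈⟦⟧⁺ : ∀ {n} {P : Fin n → Set} (P? : ∀ x → Dec (P x)) {x} → P x → x ∈ˢ ⟦ P? ⟧
∈⟦⟧⁺ P? {x} p = lookup⇒[]= x _ (trans (lookup∘tabulate _ x) (⌊⌋⁺ (P? x) p))

∈⟦⟧⁻ : ∀ {n} {P : Fin n → Set} (P? : ∀ x → Dec (P x)) {x} → x ∈ˢ ⟦ P? ⟧ → P x
∈⟦⟧⁻ P? {x} m = ⌊⌋⁻ (P? x) (trans (sym (lookup∘tabulate _ x)) ([]=⇒lookup m))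

_≟ˢ_ : ∀ {n} → DecidableEquality (Subset n)
_≟ˢ_ = Data.Vec.Properties.≡-dec _≟ᵇ_

elements : ∀ {n} → Subset n → List (Fin n)
elements {n} A = filter (_∈? A) (allFin n)

∈-elements⁺ : ∀ {n} {A : Subset n} {x} → x ∈ˢ A → x ∈ elements A
∈-elements⁺ {A = A} {x} m = ∈-filter⁺ (_∈? A) (∈-allFin x) m

∈-elements⁻ : ∀ {n} {A : Subset n} {x} → x ∈ elements A → x ∈ˢ A
∈-elements⁻ {n} {A} m = proj₂ (∈-filter⁻ (_∈? A) {xs = allFin n} m)

elements-unique : ∀ {n} (A : Subset n) → Unique (elements A)
elements-unique {n} A = filter⁺ (_∈? A) (allFin⁺ n)

shift : ∀ {n} → List (Fin (suc n)) → List (Fin n)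
shift []          = []
shift (fz   ∷ xs) = shift xs
shift (fs x ∷ xs) = x ∷ shift xs

shift-∈ : ∀ {n} {x} {xs : List (Fin (suc n))} → fs x ∈ xs → x ∈ shift xs
shift-∈ {xs = fz ∷ xs}   (there m)   = shift-∈ m
shift-∈ {xs = fs _ ∷ xs} (here refl) = here refl
shift-∈ {xs = fs _ ∷ xs} (there m)   = there (shift-∈ m)

length-shift≤ : ∀ {n} (xs : List (Fin (suc n))) → length (shift xs) ≤ length xs
length-shift≤ []          = z≤n
length-shift≤ (fz   ∷ xs) = m≤n⇒m≤1+n (length-shift≤ xs)
length-shift≤ (fs _ ∷ xs) = s≤s (length-shift≤ xs)

length-shift< : ∀ {n} {xs : List (Fin (suc n))} → fz ∈ xs → length (shift xs) < length xs
length-shift< {xs = fz ∷ xs}   m         = s≤s (length-shift≤ xs)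
length-shift< {xs = fs _ ∷ xs} (there m) = s≤s (length-shift< m)

∣∣≤length : ∀ {n} (A : Subset n) (ys : List (Fin n)) → (∀ x → x ∈ˢ A → x ∈ ys) → ∣ A ∣ ≤ length ys
∣∣≤length []          ys h = z≤n
∣∣≤length (true  ∷ A) ys h =
  ≤-trans (s≤s (∣∣≤length A (shift ys) λ x m → shift-∈ (h (fs x) (Data.Vec.there m))))
          (length-shift< (h fz Data.Vec.here))
∣∣≤length (false ∷ A) ys h =
  ≤-trans (∣∣≤length A (shift ys) λ x m → shift-∈ (h (fs x) (Data.Vec.there m)))
          (length-shift≤ ys)

cover⇒∣∣≤ : ∀ {n k} {A : Subset n} → Cover (_∈ˢ A) k → ∣ A ∣ ≤ k
cover⇒∣∣≤ {A = A} (ys , l , c) = ≤-trans (∣∣≤length A ys c) l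

length-elements≤ : ∀ {n} (A : Subset n) → length (elements A) ≤ ∣ A ∣
length-elements≤ A =
  ≤-trans (unique-⊆⇒length≤ (elements-unique A) (λ m → mem A (∈-elements⁻ m))) (size-els A)
  where
  els : ∀ {n} → Subset n → List (Fin n)
  els []          = []
  els (true  ∷ A) = fz ∷ map fs (els A)
  els (false ∷ A) = map fs (els A)
  mem : ∀ {n} (A : Subset n) {x} → x ∈ˢ A → x ∈ els A
  mem (true  ∷ A) Data.Vec.here      = here refl
  mem (true  ∷ A) (Data.Vec.there m) = there (∈-map⁺ fs (mem A m))
  mem (false ∷ A) (Data.Vec.there m) = ∈-map⁺ fs (mem A m)
  size-els : ∀ {n} (A : Subset n) → length (els A) ≤ ∣ A ∣
  size-els []          = z≤n
  size-els (true  ∷ A) = s≤s (≤-trans (≤-reflexive (length-map fs (els A))) (size-els A))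
  size-els (false ∷ A) = ≤-trans (≤-reflexive (length-map fs (els A))) (size-els A)

subsets : ∀ {n} → Subset n → List (Subset n)
subsets []          = [] ∷ []
subsets (true  ∷ B) = map (false ∷_) (subsets B) ++ map (true ∷_) (subsets B)
subsets (false ∷ B) = map (false ∷_) (subsets B)

∈-subsets : ∀ {n} {A B : Subset n} → A ⊆ B → A ∈ subsets B
∈-subsets {A = []} {[]} _ = here refl
∈-subsets {A = false ∷ A} {true  ∷ B} s = ∈-++⁺ˡ (∈-map⁺ (false ∷_) (∈-subsets (drop-∷-⊆ s)))
∈-subsets {A = true  ∷ A} {true  ∷ B} s =
  ∈-++⁺ʳ (map (false ∷_) (subsets B)) (∈-map⁺ (true ∷_) (∈-subsets (drop-∷-⊆ s)))
∈-subsets {A = false ∷ A} {false ∷ B} s = ∈-map⁺ (false ∷_) (∈-subsets (drop-∷-⊆ s))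
∈-subsets {A = true  ∷ A} {false ∷ B} s with s Data.Vec.here
... | ()

length-subsets : ∀ {n} (B : Subset n) → length (subsets B) ≡ 2 ^ ∣ B ∣
length-subsets []          = refl
length-subsets (true  ∷ B) = begin
  length (map (false ∷_) (subsets B) ++ map (true ∷_) (subsets B))
    ≡⟨ length-++ (map (false ∷_) (subsets B)) ⟩
  length (map (false ∷_) (subsets B)) + length (map (true ∷_) (subsets B))
    ≡⟨ cong₂ _+_ (trans (length-map _ (subsets B)) (length-subsets B))
                 (trans (length-map _ (subsets B)) (length-subsets B)) ⟩
  2 ^ ∣ B ∣ + 2 ^ ∣ B ∣
    ≡⟨ cong (2 ^ ∣ B ∣ +_) (sym (+-identityʳ _)) ⟩
  2 ^ suc ∣ B ∣ ∎
  where open ≡-Reasoning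
length-subsets (false ∷ B) = trans (length-map _ (subsets B)) (length-subsets B)

2^-mono : ∀ {a b} → a ≤ b → 2 ^ a ≤ 2 ^ b
2^-mono = ^-monoʳ-≤ 2

cover-⊆ : ∀ {n k} (B : Subset n) → ∣ B ∣ ≤ k → Cover (_⊆ B) (2 ^ k)
cover-⊆ B l = subsets B , ≤-trans (≤-reflexive (length-subsets B)) (2^-mono l) , λ A s → ∈-subsets s

cover-subsets : ∀ {n k} {P : Fin n → Set} → Cover P k → Cover (λ (A : Subset n) → ∀ {x} → x ∈ˢ A → P x) (2 ^ k)
cover-subsets {n} {k} {P} (ys , l , c) =
  cover-mono {P = _⊆ ⟦ in? ⟧} (λ A h {x} m → ∈⟦⟧⁺ in? (c x (h m)))
    (cover-⊆ ⟦ in? ⟧ (cover⇒∣∣≤ (ys , l , λ x → ∈⟦⟧⁻ in?)))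
  where
  in? : ∀ x → Dec (x ∈ ys)
  in? x = Data.List.Membership.DecPropositional._∈?_ _≟ᶠ_ x ys

powerset : ∀ n → List (Subset n)
powerset zero    = [] ∷ []
powerset (suc n) = map (false ∷_) (powerset n) ++ map (true ∷_) (powerset n)

∈-powerset : ∀ {n} (A : Subset n) → A ∈ powerset n
∈-powerset []          = here refl
∈-powerset (false ∷ A) = ∈-++⁺ˡ (∈-map⁺ (false ∷_) (∈-powerset A))
∈-powerset (true  ∷ A) = ∈-++⁺ʳ (map (false ∷_) (powerset _)) (∈-map⁺ (true ∷_) (∈-powerset A))

powerset-unique : ∀ n → Unique (powerset n)
powerset-unique zero    = [] ∷ []
powerset-unique (suc n) =
  ++⁺ (map⁺ (λ { refl → refl }) (powerset-unique n)) (map⁺ (λ { refl → refl }) (powerset-unique n)) disj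
  where
  disj : ∀ {A} → ¬ (A ∈ map (false ∷_) (powerset n) × A ∈ map (true ∷_) (powerset n))
  disj (p , q) with ∈-map⁻ (false ∷_) p | ∈-map⁻ (true ∷_) q
  ... | _ , _ , refl | _ , _ , ()

maxF : ∀ {n} → (Fin n → ℕ) → ℕ
maxF {zero}  f = 0
maxF {suc n} f = f fz ⊔ maxF (f ∘ fs)

≤-maxF : ∀ {n} (f : Fin n → ℕ) i → f i ≤ maxF f
≤-maxF f fz     = m≤m⊔n (f fz) _
≤-maxF f (fs i) = ≤-trans (≤-maxF (f ∘ fs) i) (m≤n⊔m (f fz) _)

maxF-lub : ∀ {n} (f : Fin n → ℕ) {b} → (∀ i → f i ≤ b) → maxF f ≤ b
maxF-lub {zero}  f h = z≤n
maxF-lub {suc n} f h = ⊔-lub (h fz) (maxF-lub (f ∘ fs) (h ∘ fs))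

maxF-attained : ∀ {n} (f : Fin n → ℕ) → 0 < maxF f → ∃[ i ] f i ≡ maxF f
maxF-attained {suc n} f pos with ⊔-sel (f fz) (maxF (f ∘ fs))
... | inj₁ e = fz , sym e
... | inj₂ e with maxF-attained (f ∘ fs) (subst (0 <_) e pos)
...   | i , h = fs i , trans h (sym e)

-- Graphs presented by a duplicate-free list of vertices

lookup-injective : {A : Set} {xs : List A} → Unique xs → ∀ {i j} → lookup xs i ≡ lookup xs j → i ≡ j
lookup-injective {xs = x ∷ xs} (_ ∷ u)  {fz}   {fz}   _ = refl
lookup-injective {xs = x ∷ xs} (x∉ ∷ u) {fz}   {fs j} e = contradiction e (All.lookup x∉ (∈-lookup j))
lookup-injective {xs = x ∷ xs} (x∉ ∷ u) {fs i} {fz}   e = contradiction (sym e) (All.lookup x∉ (∈-lookup i))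
lookup-injective {xs = x ∷ xs} (_ ∷ u)  {fs i} {fs j} e = cong fs (lookup-injective u e)

graphOn : {A : Set} (xs : List A) (e : A → A → Bool) →
  (∀ x y → e x y ≡ e y x) → (∀ x → e x x ≡ false) → Graph
graphOn xs e s i = record
  { size   = length xs
  ; adj    = λ u v → e (lookup xs u) (lookup xs v)
  ; sym    = λ u v → s _ _
  ; irrefl = λ v → i _
  }

vertex : {A : Set} {xs : List A} {x : A} → x ∈ xs → ∃[ v ] lookup xs v ≡ x
vertex m = index m , sym (lookup-index m)

-- Walks confined to a set of vertices

-- The index bounds the length instead of fixing it, and vertices may repeat, which makes
-- concatenation and reversal painless; `within⇒path` recovers genuine paths.
data Within (G : Graph) (S : V G → Set) : ℕ → V G → V G → Set where
  stop : ∀ {k x} → S x → Within G S k x x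
  move : ∀ {k x w y} → S x → adj G x w ≡ true → Within G S k w y → Within G S (suc k) x y

wcolBound : (ℕ → ℕ) → ℕ → ℕ
wcolBound f zero    = 1
wcolBound f (suc k) = 1 + f (suc k) * wcolBound f k

module _ {G : Graph} where

  within-start : ∀ {S k x y} → Within G S k x y → S x
  within-start (stop s)     = s
  within-start (move s _ _) = s

  within-weaken : ∀ {S R k l x y} → k ≤ l → (∀ {w} → S w → R w) → Within G S k x y → Within G R l x y
  within-weaken _         h (stop s)     = stop (h s)
  within-weaken (s≤s k≤l) h (move s e p) = move (h s) e (within-weaken k≤l h p)

  within-trans : ∀ {S k l x y z} → Within G S k x y → Within G S l y z → Within G S (k + l) x z
  within-trans {k = k} {l} (stop _) q = within-weaken (m≤n+m l k) id q
  within-trans (move s e p) q = move s e (within-trans p q)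

  within-sym : ∀ {S k x y} → Within G S k x y → Within G S k y x
  within-sym (stop s) = stop s
  within-sym {k = suc k} (move {x = x} {w} s e p) =
    within-weaken (≤-reflexive (+-comm k 1)) id
      (within-trans (within-sym p)
        (move (within-start p) (trans (Graph.sym G w x) e) (stop s)))

  within? : ∀ {S} → (∀ x → Dec (S x)) → ∀ k x y → Dec (Within G S k x y)
  within? S? k x y with S? x
  ... | no ¬s = no (¬s ∘ within-start)
  ... | yes s with x ≟ᶠ y
  ...   | yes refl = yes (stop s)
  within? S? zero x y | yes s | no x≢y = no λ { (stop _) → x≢y refl }
  within? S? (suc k) x y | yes s | no x≢y
    with any? (λ w → (adj G x w ≟ᵇ true) ×-dec within? S? k w y)
  ... | yes (w , e , p) = yes (move s e p)
  ... | no h = no λ { (stop _) → x≢y refl ; (move _ e p) → h (_ , e , p) }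

  walk⇒within : ∀ {S x y} (p : Walk G x y) → All S (verts p) → Within G S (len p) x y
  walk⇒within here       (s ∷ []) = stop s
  walk⇒within (step e p) (s ∷ ss) = move s e (walk⇒within p ss)

  Path : (V G → Set) → ℕ → V G → V G → Set
  Path S k x y = Σ (Walk G x y) λ p → IsPath p × len p ≤ k × All S (verts p)

  suffix : ∀ {S k x w y} (p : Walk G w y) → IsPath p → len p ≤ k → All S (verts p) →
    x ∈ verts p → Path S k x y
  suffix here       u       l a       (here refl) = here , u , l , a
  suffix (step e p) u       l a       (here refl) = step e p , u , l , a
  suffix (step e p) (_ ∷ u) l (_ ∷ a) (there m)   = suffix p u (≤-trans (n≤1+n _) l) a m

  within⇒path : ∀ {S k x y} → Within G S k x y → Path S k x y
  within⇒path (stop s) = here , ([] ∷ []) , z≤n , (s ∷ [])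
  within⇒path (move {x = x} s e p) with within⇒path p
  ... | q , u , l , a with Data.List.Membership.DecPropositional._∈?_ _≟ᶠ_ x (verts q)
  ...   | yes m = suffix q u (m≤n⇒m≤1+n l) a m
  ...   | no x∉ = step e q , All.tabulate (λ { m refl → x∉ m }) ∷ u , s≤s l , s ∷ a

  -- Weak and strong reachability

  module _ (π : V G → ℕ) where

    WReach : ℕ → V G → V G → Set
    WReach k x u = Within G (λ w → π u ≤ π w) k x u

    wreach? : ∀ k x u → Dec (WReach k x u)
    wreach? k x u = within? (λ w → π u ≤? π w) k x u

    within-minimum : ∀ {S k x y} → Within G S k x y →
      ∃[ u ] S u × WReach k x u × WReach k y u
    within-minimum p with go p
      where
      -- The third component keeps the whole walk above the current minimum: when a lower vertex is
      -- prepended, it becomes the minimum and reaches the other end along that walk.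
      go : ∀ {S k x y} → Within G S k x y →
        ∃[ u ] S u × WReach k x u × Within G (λ w → π u ≤ π w) k x y × Within G (λ w → π u ≤ π w) k u y
      go (stop s) = _ , s , stop ≤-refl , stop ≤-refl , stop ≤-refl
      go (move {x = x} s e p) with go p
      ... | u , su , toU , whole , fromU with π u ≤? π x
      ...   | yes u≤x = u , su , move u≤x e toU , move u≤x e whole , within-weaken (n≤1+n _) id fromU
      ...   | no  u≰x = x , s , stop ≤-refl , above , above
        where
        above = move ≤-refl e (within-weaken ≤-refl (≤-trans (<⇒≤ (≰⇒> u≰x))) whole)
    ... | u , su , toU , _ , fromU = u , su , toU , within-sym fromU

    SReach : ℕ → V G → V G → Set
    SReach k v u = π u ≤ π v × Within G (λ w → w ≡ u ⊎ π v ≤ π w) k v u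

    sreach? : ∀ k v u → Dec (SReach k v u)
    sreach? k v u = (π u ≤? π v) ×-dec within? (λ w → (w ≟ᶠ u) ⊎-dec (π v ≤? π w)) k v u

    sreach-cover : ∀ {r k} → ColLE G π r k → ∀ v → Cover (SReach r v) k
    sreach-cover {r} c v = atMost⇒cover (sreach? r v) λ xs u ps →
      c v xs u (All.map (λ { (l , p) → l , within⇒path p }) ps)

    -- The threshold `c` is separate from `π x` because it stays at the value of the original start
    -- while the recursion moves along the walk.
    first-below : ∀ {c k x u} → π u < c → c ≤ π x → WReach k x u →
      ∃[ y ] ∃[ l ] π y < c × l < k × Within G (λ w → w ≡ y ⊎ c ≤ π w) k x y × WReach l y u
    first-below u<c c≤x (stop _) = contradiction (<-≤-trans u<c c≤x) (<-irrefl refl)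
    first-below {c} u<c c≤x (move {w = w} _ e p) with c ≤? π w
    ... | no  c≰w = w , _ , ≰⇒> c≰w , ≤-refl , move (inj₂ c≤x) e (stop (inj₁ refl)) , p
    ... | yes c≤w with first-below u<c c≤w p
    ...   | y , l , y<c , l<k , q , r = y , l , y<c , m≤n⇒m≤1+n l<k , move (inj₂ c≤x) e q , r

    -- If `u` differs from `v`, it lies below `v`. The first vertex below `v` on the walk is
    -- strongly reachable from `v`, and `u` is weakly reachable from it in fewer steps. This is the
    -- usual bound on weak colouring numbers by strong ones.
    wreach-cover : ∀ {f} → IsOrder G π → (∀ r → ColLE G π r (f r)) →
      ∀ k v → Cover (WReach k v) (wcolBound f k)
    wreach-cover inj c zero v = v ∷ [] , ≤-refl , λ { _ (stop _) → here refl }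
    wreach-cover inj c (suc k) v =
      cover-mono split (cover-⊎ {P = _≡ v} (v ∷ [] , ≤-refl , λ { _ refl → here refl })
        (cover-bind (WReach k) (sreach-cover (c (suc k)) v) (wreach-cover inj c k) λ _ → id))
      where
      split : ∀ u → WReach (suc k) v u → u ≡ v ⊎ (∃[ y ] SReach (suc k) v y × WReach k y u)
      split u p with <-cmp (π u) (π v)
      ... | tri≈ _ e _ = inj₁ (inj e)
      ... | tri> _ _ v<u = contradiction (<-≤-trans v<u (within-start p)) (<-irrefl refl)
      ... | tri< u<v _ _ with first-below u<v ≤-refl p
      ...   | y , l , y<v , s≤s l≤k , q , r =
        inj₂ (y , (<⇒≤ y<v , q) , within-weaken l≤k id r)

-- Set systems with bounded reachability, and the graphs built over them

-- Strong reachability in the hypergraph with hyperedges `R t`: only the last element is exempt from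
-- the lower bound `c`.
data Chain {T : Set} {n} (R : T → Subset n) (π : Fin n → ℕ) (c : ℕ) : ℕ → Fin n → Fin n → Set where
  done : ∀ {k y} → Chain R π c k y y
  hop  : ∀ {k y y' u t} → c ≤ π y → y ∈ˢ R t → y' ∈ˢ R t → Chain R π c k y' u → Chain R π c (suc k) y u

record System {T : Set} {n} (R : T → Subset n) (π : Fin n → ℕ) (F : ℕ → ℕ) : Set where
  field
    π-injective : Injective _≡_ _≡_ π
    degree≤     : ∀ t → ∣ R t ∣ ≤ F 0
    chains      : ∀ k y → Cover (λ u → π u ≤ π y × Chain R π (π y) k y u) (F k)

module _ {n} (π : Fin n → ℕ) where

  -- The successor separates the empty set, of key 0, from a set whose largest element has `π`-value
  -- 0.
  weight : Subset n → Fin n → ℕ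
  weight A y = if ⌊ y ∈? A ⌋ then suc (π y) else 0

  key : Subset n → ℕ
  key A = maxF (weight A)

  weight-∈ : ∀ {A y} → y ∈ˢ A → weight A y ≡ suc (π y)
  weight-∈ {A} {y} m rewrite ⌊⌋⁺ (y ∈? A) m = refl

  weight-positive : ∀ {A y} → 0 < weight A y → y ∈ˢ A
  weight-positive {A} {y} pos with y ∈? A
  ... | yes m = m
  weight-positive () | no _

  ∈⇒<key : ∀ {A y} → y ∈ˢ A → π y < key A
  ∈⇒<key {A} {y} m = ≤-trans (≤-reflexive (sym (weight-∈ m))) (≤-maxF (weight A) y)

  key-attained : ∀ {A} → 0 < key A → ∃[ y ] y ∈ˢ A × key A ≡ suc (π y)
  key-attained {A} pos with maxF-attained (weight A) pos
  ... | y , e = y , m , trans (sym e) (weight-∈ m)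
    where m = weight-positive (subst (0 <_) (sym e) pos)

  key≡0⇒∅ : ∀ {A} → key A ≡ 0 → A ≡ ∅
  key≡0⇒∅ e = Empty-unique λ { (y , m) → contradiction (subst (π y <_) e (∈⇒<key m)) λ () }

  key-mono : ∀ {A B} → A ⊆ B → key A ≤ key B
  key-mono {A} {B} sub = maxF-lub (weight A) bounded
    where
    bounded : ∀ y → weight A y ≤ key B
    bounded y with y ∈? A
    ... | yes m = ∈⇒<key (sub m)
    ... | no  _ = z≤n

  key≤ : ∀ A → key A ≤ maxF (suc ∘ π)
  key≤ A = maxF-lub (weight A) bounded
    where
    bounded : ∀ y → weight A y ≤ maxF (suc ∘ π)
    bounded y with y ∈? A
    ... | yes _ = ≤-maxF (suc ∘ π) y
    ... | no  _ = z≤n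

  ownerKey : {T : Set} → T ⊎ Subset n → ℕ
  ownerKey (inj₁ _) = suc (maxF (suc ∘ π))
  ownerKey (inj₂ A) = key A

-- `stay` lets one target own a whole connected gadget, as the paths of a shrub-decomposition
-- require.
data Link {T : Set} {n} (R : T → Subset n) : T ⊎ Subset n → T ⊎ Subset n → Set where
  stay : ∀ {t} → Link R (inj₁ t) (inj₁ t)
  down : ∀ {t A} → A ⊆ R t → Link R (inj₁ t) (inj₂ A)
  up   : ∀ {t A} → A ⊆ R t → Link R (inj₂ A) (inj₁ t)

link-from-target : ∀ {T : Set} {n} {R : T → Subset n} {t o o'} → o ≡ inj₁ t → Link R o o' →
  o' ≡ inj₁ t ⊎ (∃[ A ] o' ≡ inj₂ A × A ⊆ R t)
link-from-target refl stay       = inj₁ refl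
link-from-target refl (down sub) = inj₂ (_ , refl , sub)

link-from-set : ∀ {T : Set} {n} {R : T → Subset n} {A o o'} → o ≡ inj₂ A → Link R o o' →
  ∃[ t ] o' ≡ inj₁ t × A ⊆ R t
link-from-set refl (up sub) = _ , refl , sub

record Over {T : Set} {n} (R : T → Subset n) (π : Fin n → ℕ) (P : Graph) (K : ℕ) : Set where
  field
    owner  : V P → T ⊎ Subset n
    links  : ∀ {x y} → adj P x y ≡ true → Link R (owner x) (owner y)
    fibres : ∀ o → Cover (λ x → owner x ≡ o) K
    σ      : V P → ℕ
    σ-key  : ∀ {x y} → σ x ≤ σ y → ownerKey π (owner x) ≤ ownerKey π (owner y)

-- From a vertex owned by a target `t`, one reaches only vertices owned by `t` or by one of at most
-- `2 ^ F 0` subsets of `R t`. From a vertex owned by a set, one reaches the vertex itself, those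
-- owned by the empty set, and those owned by a nonempty `U`: its largest element is one of `F r`
-- chain ends, and all its elements are among the `F 1` elements one hop below that.
overBound : (ℕ → ℕ) → ℕ → ℕ → ℕ
overBound F K r = (K + 2 ^ F 0 * K) + (1 + (K + F r * (2 ^ F 1 * K)))

last-edge : ∀ {G : Graph} {x w u : V G} → adj G x w ≡ true → Walk G w u → ∃[ z ] adj G z u ≡ true
last-edge e here       = _ , e
last-edge _ (step e p) = last-edge e p

module _ {T : Set} {n} {R : T → Subset n} {π : Fin n → ℕ} {F : ℕ → ℕ} (sys : System R π F)
         {P : Graph} {K : ℕ} (over : Over R π P K) where
  open System sys
  open Over over

  chain-weaken : ∀ {c k y u} → Chain R π c k y u → Chain R π c (suc k) y u
  chain-weaken done          = done
  chain-weaken (hop a b c d) = hop a b c (chain-weaken d)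

  target-key : ∀ A → ¬ suc (maxF (suc ∘ π)) ≤ key π A
  target-key A le = contradiction (≤-trans le (key≤ π A)) (<-irrefl refl)

  Above : ℕ → V P → V P → Set
  Above c u w = w ≡ u ⊎ c ≤ ownerKey π (owner w)

  -- The key of a set is below that of every target, so a walk that leaves the vertices owned by `t`
  -- has just arrived at `u`.
  from-target : ∀ {t x u} → owner x ≡ inj₁ t → (p : Walk P x u) →
    All (Above (suc (maxF (suc ∘ π))) u) (verts p) →
    owner u ≡ inj₁ t ⊎ (∃[ A ] owner u ≡ inj₂ A × A ⊆ R t)
  from-target ox here _ = inj₁ ox
  from-target {x = x} ox (step {w = w} e p) (_ ∷ a) with link-from-target ox (links e)
  ... | inj₁ ow = from-target ow p a
  ... | inj₂ (A , ow , sub) with p | a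
  ...   | here     | _ = inj₂ (A , ow , sub)
  ...   | step _ _ | inj₁ refl ∷ _ = inj₂ (A , ow , sub)
  ...   | step _ _ | inj₂ le ∷ _ =
    contradiction (subst (λ o → _ ≤ ownerKey π o) ow le) (target-key A)

  module _ {h : Fin n} {u : V P} {U : Subset n} {hU : Fin n}
           (oU : owner u ≡ inj₂ U) (kU : key π U ≡ suc (π hU)) where

    -- The chain consists of the largest elements of the sets on the walk. Stepping down from `t`
    -- into `A` is one hop from `y` to the top of `A`, as both lie in `R t`; stepping up costs no
    -- hop, so the chain is no longer than the walk. The bound on the keys says that the tops are at
    -- least `π h`.
    chain-from-target : ∀ {t x y} → owner x ≡ inj₁ t → y ∈ˢ R t → π h ≤ π y → (p : Walk P x u) →
      All (Above (suc (π h)) u) (verts p) → Chain R π (π h) (len p) y hU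
    chain-from-set : ∀ {A x hA} → owner x ≡ inj₂ A → hA ∈ˢ A → key π A ≡ suc (π hA) → (p : Walk P x u) →
      All (Above (suc (π h)) u) (verts p) → Chain R π (π h) (len p) hA hU

    chain-from-target ox _ _ here _ = contradiction (trans (sym ox) oU) λ ()
    chain-from-target {x = x} ox y∈ le (step {w = w} e p) (_ ∷ a) with link-from-target ox (links e)
    ... | inj₁ ow = chain-weaken (chain-from-target ow y∈ le p a)
    ... | inj₂ (A , ow , sub) with key-attained π (positive p a)
      where
      start : ∀ {w} (p : Walk P w u) → All (Above (suc (π h)) u) (verts p) → Above (suc (π h)) u w
      start here       (q ∷ _) = q
      start (step _ _) (q ∷ _) = q
      -- Only nonempty sets have a top: the final set is `U`, and any earlier one has key at least
      -- `suc (π h)`.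
      positive : (p : Walk P w u) → All (Above (suc (π h)) u) (verts p) → 0 < key π A
      positive p a with start p a
      ... | inj₂ q = ≤-trans (s≤s z≤n) (subst (λ o → _ ≤ ownerKey π o) ow q)
      ... | inj₁ refl with trans (sym ow) oU
      ...   | refl = subst (0 <_) (sym kU) (s≤s z≤n)
    ...   | hA , hA∈ , kA = hop le y∈ (sub hA∈) (chain-from-set ow hA∈ kA p a)

    same-top : ∀ {A hA} → owner u ≡ inj₂ A → key π A ≡ suc (π hA) → hA ≡ hU
    same-top oA kA with trans (sym oA) oU
    ... | refl = π-injective (suc-injective (trans (sym kA) kU))

    chain-from-set {hA = hA} ox hA∈ kA here _ rewrite same-top ox kA = done
    chain-from-set {hA = hA} ox hA∈ kA (step e p) (inj₁ refl ∷ _) rewrite same-top ox kA = done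
    chain-from-set {x = x} ox hA∈ kA (step {w = w} e p) (inj₂ le ∷ a) with link-from-set ox (links e)
    ... | t , ow , sub =
      chain-weaken (chain-from-target ow (sub hA∈)
        (≤-pred (subst (_ ≤_) (trans (cong (ownerKey π) ox) kA) le)) p a)

  chain-upTo : ∀ {c k l y u} → k ≤ l → Chain R π c k y u → Chain R π c l y u
  chain-upTo _       done          = done
  chain-upTo (s≤s l) (hop a b c d) = hop a b c (chain-upTo l d)

  reach-cover : ∀ r v → Cover (Reach P σ r v) (overBound F K r)
  reach-cover r v with owner v in ov
  ... | inj₁ t =
    cover-≤ (m≤m+n _ _)
      (cover-mono classify
        (cover-⊎ (fibres (inj₁ t))
          (cover-bind (λ A x → owner x ≡ inj₂ A) (cover-⊆ (R t) (degree≤ t)) (fibres ∘ inj₂) (λ _ → id))))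
    where
    classify : ∀ u → Reach P σ r v u → owner u ≡ inj₁ t ⊎ (∃[ A ] A ⊆ R t × owner u ≡ inj₂ A)
    classify u (_ , p , _ , _ , a)
      with from-target ov p (All.map (λ { (inj₁ e) → inj₁ e
                                        ; (inj₂ le) → inj₂ (≤-trans (≤-reflexive (cong (ownerKey π) (sym ov))) (σ-key le)) }) a)
    ... | inj₁ e = inj₁ e
    ... | inj₂ (A , e , sub) = inj₂ (A , sub , e)
  ... | inj₂ A with 0 <? key π A
  -- The start is owned by the empty set, and so is everything that does not exceed its key.
  ...   | no nonpos =
    cover-≤ (≤-trans (≤-trans (m≤m+n K _) (n≤1+n _)) (m≤n+m _ (K + 2 ^ F 0 * K)))
      (cover-mono empty (fibres (inj₂ ∅)))
    where
    empty : ∀ u → Reach P σ r v u → owner u ≡ inj₂ ∅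
    empty u (le , _) with owner u in ou | subst (ownerKey π (owner u) ≤_) (cong (ownerKey π) ov) (σ-key le)
    ... | inj₁ t | le' = contradiction le' (target-key A)
    ... | inj₂ U | le' = cong inj₂ (key≡0⇒∅ π (n≤0⇒n≡0 (≤-trans le' (≮⇒≥ nonpos))))
  ...   | yes pos with key-attained π pos
  ...     | h , h∈ , kA =
    cover-≤ (m≤n+m _ (K + 2 ^ F 0 * K))
      (cover-mono classify
        (cover-⊎ {P = _≡ v} (v ∷ [] , ≤-refl , λ { _ refl → here refl })
          (cover-⊎ (fibres (inj₂ ∅))
            (cover-bind OwnedBelow (chains r h)
              (λ hU → cover-bind {P = λ U → ∀ {y} → y ∈ˢ U → Below hU y} (λ U x → owner x ≡ inj₂ U)
                        (cover-subsets (chains 1 hU)) (fibres ∘ inj₂) (λ _ → id))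
              (λ _ → id)))))
    where
    Below : Fin n → Fin n → Set
    Below hU y = π y ≤ π hU × Chain R π (π hU) 1 hU y
    OwnedBelow : Fin n → V P → Set
    OwnedBelow hU x = ∃[ U ] (∀ {y} → y ∈ˢ U → Below hU y) × owner x ≡ inj₂ U
    classify : ∀ u → Reach P σ r v u →
      u ≡ v ⊎ (owner u ≡ inj₂ ∅ ⊎ (∃[ hU ] (π hU ≤ π h × Chain R π (π h) r h hU) × OwnedBelow hU u))
    classify u (_ , here , _) = inj₁ refl
    classify u (le , p@(step e q) , _ , l , a)
      with owner u in ou | subst (ownerKey π (owner u) ≤_) (cong (ownerKey π) ov) (σ-key le)
    ... | inj₁ t | le' = contradiction le' (target-key A)
    ... | inj₂ U | le' with 0 <? key π U
    ...   | no nonpos = inj₂ (inj₁ (cong inj₂ (key≡0⇒∅ π (n≤0⇒n≡0 (≮⇒≥ nonpos)))))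
    -- The trivial walk has been split off, so `u` has a neighbour. Its owner is a target whose set
    -- contains `U`, which puts all of `U` one hop from the top `hU`.
    ...   | yes posU with key-attained π posU | last-edge e q
    ...     | hU , hU∈ , kU | z , ez =
      inj₂ (inj₂ (hU , (≤-pred (subst₂ _≤_ kU kA le') ,
                        chain-upTo l (chain-from-set ou kU ov h∈ kA p
                          (All.map (λ { (inj₁ e) → inj₁ e
                                      ; (inj₂ le) → inj₂ (subst (_≤ _) (trans (cong (ownerKey π) ov) kA) (σ-key le)) }) a))) ,
                  (U , below (owner z) (subst (Link R _) ou (links ez)) , refl)))
      where
      below : ∀ o → Link R o (inj₂ U) → ∀ {y} → y ∈ˢ U → Below hU y
      below _ (down sub) {y} y∈ =
        ≤-pred (subst (π y <_) kU (∈⇒<key π y∈)) , hop ≤-refl (sub hU∈) (sub y∈) done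

  over-col : ∀ r → ColLE P σ r (overBound F K r)
  over-col r v xs u a = cover⇒atMost (reach-cover r v) xs u a

-- Locality of first-order logic

rank : ∀ {k n} → Formula k n → ℕ
rank (eqF _ _)   = 0
rank (edgeF _ _) = 0
rank (simF _ _)  = 0
rank (predF _ _) = 0
rank (negF φ)    = rank φ
rank (andF φ ψ)  = rank φ ⊔ rank ψ
rank (orF φ ψ)   = rank φ ⊔ rank ψ
rank (exF φ)     = suc (rank φ)
rank (allF φ)    = suc (rank φ)

-- The factor 6 comes from `far-from-b`, where a route of length r + 2r + 2r + r between two
-- clusters has to be excluded.
radius : ℕ → ℕ
radius zero    = 1
radius (suc q) = 6 * radius q

radius≥1 : ∀ q → 1 ≤ radius q
radius≥1 zero    = ≤-refl
radius≥1 (suc q) = ≤-trans (radius≥1 q) (m≤n*m (radius q) 6)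

atomCount : ℕ → ℕ → ℕ
atomCount u n = ((2 ^ n) ^ n) ^ 3 * (2 ^ u) ^ n

-- The factors follow `tp`: the atoms, the type with the new variable left blank, a near bit for
-- each type, and a far bit for each type and each of `suc n` balls. The structure does not enter,
-- so the count is uniform over all graphs.
typeCount : ℕ → ℕ → ℕ → ℕ
typeCount u zero    n = atomCount u n
typeCount u (suc q) n =
  atomCount u n * (typeCount u q (suc n) * (2 ^ typeCount u q (suc n) * (2 ^ suc n) ^ typeCount u q (suc n)))

bit : Bool → Fin 2
bit false = fz
bit true  = fs fz

bit-injective : ∀ {a b} → bit a ≡ bit b → a ≡ b
bit-injective {false} {false} _ = refl
bit-injective {true}  {true}  _ = refl

funToFin-injective : ∀ {m n} (f g : Fin m → Fin n) → funToFin f ≡ funToFin g → f ≗ g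
funToFin-injective f g e i =
  trans (sym (Finₚ.finToFun-funToFin f i)) (trans (cong (λ c → finToFun c i) e) (Finₚ.finToFun-funToFin g i))

search : {A : Set} → (A → Bool) → List A → Maybe A
search p []       = nothing
search p (x ∷ xs) = if p x then just x else search p xs

search-just : {A : Set} (p : A → Bool) (xs : List A) {x : A} → search p xs ≡ just x → x ∈ xs × p x ≡ true
search-just p (y ∷ xs) e with p y in py
search-just p (y ∷ xs) refl | true = here refl , py
... | false with search-just p xs e
...   | m , px = there m , px

search-nothing : {A : Set} (p : A → Bool) (xs : List A) → search p xs ≡ nothing →
  ∀ {x} → x ∈ xs → p x ≢ true
search-nothing p (y ∷ xs) e m px with p y in py
search-nothing p (y ∷ xs) e (here refl) px | false = contradiction (trans (sym py) px) λ ()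
search-nothing p (y ∷ xs) e (there m)   px | false = search-nothing p xs e m px

rel : ∀ {k} (M : Structure k) → Fin 3 → Structure.U M → Structure.U M → Bool
rel M fz           = Structure.eqU M
rel M (fs fz)      = Structure.E M
rel M (fs (fs fz)) = Structure.Sim M

-- D r x y reads "x and y are at distance at most r". Reflexivity is not required: below, deleted vertices
-- are far from everything, including themselves.
record Metric {k} (M : Structure k) (u : ℕ) : Set₁ where
  open Structure M
  field
    D       : ℕ → U → U → Set
    D?      : ∀ r x y → Dec (D r x y)
    D-sym   : ∀ {r x y} → D r x y → D r y x
    D-trans : ∀ {r s x y z} → D r x y → D s y z → D (r + s) x z
    D-mono  : ∀ {r s x y} → r ≤ s → D r x y → D s x y
    κ       : U → Fin u → Bool
    unary   : ∀ c {x x'} → κ x ≗ κ x' → P c x ≡ P c x'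
    binary  : ∀ s {x y x' y'} → ¬ D 1 x y → ¬ D 1 x' y' → κ x ≗ κ x' → κ y ≗ κ y' →
              rel M s x y ≡ rel M s x' y'

fresh : ∀ {n} (g : Fin n → ℕ) → ∃[ j ] ∀ i → g i ≢ j
fresh g = suc (maxF g) , λ i e → contradiction (subst (_≤ maxF g) e (≤-maxF g i)) (<-irrefl refl)

-- Types of partial assignments

module Types {k} {M : Structure k} {u} (X : Metric M u) where
  open Structure M
  open Metric X

  -- Entries are optional because a type describes one cluster of variables at a time; variables of
  -- other clusters are `nothing`.
  Near : ℕ → ∀ {n} → Vec (Maybe U) n → U → Set
  Near r []            z = Data.Empty.⊥
  Near r (nothing ∷ ρ) z = Near r ρ z
  Near r (just a ∷ ρ)  z = D r a z ⊎ Near r ρ z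

  near? : ∀ r {n} (ρ : Vec (Maybe U) n) z → Dec (Near r ρ z)
  near? r []            z = no λ ()
  near? r (nothing ∷ ρ) z = near? r ρ z
  near? r (just a ∷ ρ)  z = D? r a z ⊎-dec near? r ρ z

  near-lookup : ∀ {r n} (ρ : Vec (Maybe U) n) {z} → Near r ρ z →
    ∃[ i ] ∃[ c ] Data.Vec.lookup ρ i ≡ just c × D r c z
  near-lookup (just a ∷ ρ)  (inj₁ d) = fz , a , refl , d
  near-lookup (just a ∷ ρ)  (inj₂ h) with near-lookup ρ h
  ... | i , c , e , d = fs i , c , e , d
  near-lookup (nothing ∷ ρ) h with near-lookup ρ h
  ... | i , c , e , d = fs i , c , e , d

  scatter : (U → Bool) → ℕ → ∀ m → Vec (Maybe U) m
  scatter p r zero    = []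
  scatter p r (suc m) = search (λ z → p z ∧ not ⌊ near? r (scatter p r m) z ⌋) dom ∷ scatter p r m

  record Scattered (p : U → Bool) (r : ℕ) {m} (ρ : Vec (Maybe U) m) : Set where
    field
      centre : Fin m → U
      in-dom : ∀ s → centre s ∈ dom
      good   : ∀ s → p (centre s) ≡ true
      apart  : ∀ {s t} → s Data.Fin.< t → ¬ D r (centre s) (centre t)
      listed : ∀ s {z} → D r (centre s) z → Near r ρ z

  -- A greedy search either produces m scattered elements or gets stuck, and then its balls cover everything.
  Covering : (U → Bool) → ℕ → ∀ {m} → Vec (Maybe U) m → Set
  Covering p r ρ = ∀ {z} → z ∈ dom → p z ≡ true → Near r ρ z

  scatter-spec : ∀ p r m → Covering p r (scatter p r m) ⊎ Scattered p r (scatter p r m)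
  scatter-spec p r zero = inj₂ record
    { centre = λ () ; in-dom = λ () ; good = λ () ; apart = λ { {()} } ; listed = λ () }
  scatter-spec p r (suc m) = grow (search _ dom) refl (scatter-spec p r m)
    where
    ρ = scatter p r m
    grow : ∀ x → search (λ z → p z ∧ not ⌊ near? r ρ z ⌋) dom ≡ x →
      Covering p r ρ ⊎ Scattered p r ρ → Covering p r (x ∷ ρ) ⊎ Scattered p r (x ∷ ρ)
    grow nothing found _ = inj₁ covered
      where
      covered : Covering p r ρ
      covered {z} z∈ pz with near? r ρ z in d
      ... | yes h = h
      ... | no h = contradiction (∧-true⁺ pz (not-true⁺ (h ∘ ⌊⌋⁻ (near? r ρ z))))
                     (search-nothing _ dom found z∈)
    grow (just c) found (inj₁ cov) = inj₁ λ z∈ pz → inj₂ (cov z∈ pz)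
    grow (just c) found (inj₂ sc) with search-just _ dom found
    ... | c∈ , h with ∧-true⁻ {p c} h
    ...   | pc , far = inj₂ record
      { centre = λ { fz → c ; (fs s) → centre s }
      ; in-dom = λ { fz → c∈ ; (fs s) → in-dom s }
      ; good   = λ { fz → pc ; (fs s) → good s }
      ; apart  = λ { {fz} {fs t} _ d → not-true⁻ far (⌊⌋⁺ (near? r ρ c) (listed t (D-sym d)))
                   ; {fs s} {fs t} (s≤s l) d → apart l d }
      ; listed = λ { fz d → inj₁ d ; (fs s) d → inj₂ (listed s d) }
      }
      where open Scattered sc

  rel? : Fin 3 → Maybe U → Maybe U → Bool
  rel? s (just x) (just y) = rel M s x y
  rel? s _        _        = false

  κ? : Maybe U → Fin u → Bool
  κ? (just x) c = κ x c
  κ? nothing  c = false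

  relCode : ∀ {n} → Vec (Maybe U) n → Fin 3 → Fin n → Fin n → Bool
  relCode ρ s i j = rel? s (Data.Vec.lookup ρ i) (Data.Vec.lookup ρ j)

  κCode : ∀ {n} → Vec (Maybe U) n → Fin n → Fin u → Bool
  κCode ρ i c = κ? (Data.Vec.lookup ρ i) c

  table : ∀ {m} → (Fin m → Bool) → Fin (2 ^ m)
  table f = funToFin (bit ∘ f)

  table-injective : ∀ {m} (f g : Fin m → Bool) → table f ≡ table g → f ≗ g
  table-injective f g e i = bit-injective (funToFin-injective (bit ∘ f) (bit ∘ g) e i)

  table₂ : ∀ {m n} → (Fin m → Fin n → Bool) → Fin ((2 ^ n) ^ m)
  table₂ f = funToFin (table ∘ f)

  table₂-injective : ∀ {m n} (f g : Fin m → Fin n → Bool) → table₂ f ≡ table₂ g → ∀ i → f i ≗ g i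
  table₂-injective f g e i = table-injective (f i) (g i) (funToFin-injective (table ∘ f) (table ∘ g) e i)

  atoms : ∀ {n} → Vec (Maybe U) n → Fin (atomCount u n)
  atoms ρ = combine (funToFin (table₂ ∘ relCode ρ)) (table₂ (κCode ρ))

  ball : ℕ → Maybe U → U → Bool
  ball r nothing  z = false
  ball r (just c) z = ⌊ D? r c z ⌋

  -- The type of a partial assignment. An extension of the assignment by a near element is recorded by its
  -- own type; the existence of a far element of type γ is tested separately in each ball of a fixed maximal
  -- scattered set of elements of type γ.
  tp : ∀ q {n} → Vec (Maybe U) n → Fin (typeCount u q n)
  hasType : ∀ q n → Fin (typeCount u q (suc n)) → U → Bool
  centres : ∀ q n → Fin (typeCount u q (suc n)) → Vec (Maybe U) (suc n)
  nearBit : ∀ q {n} → Vec (Maybe U) n → Fin (typeCount u q (suc n)) → Bool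
  farBit  : ∀ q {n} → Vec (Maybe U) n → Fin (typeCount u q (suc n)) → Fin (suc n) → Bool

  tp zero    ρ = atoms ρ
  tp (suc q) ρ = combine (atoms ρ) (combine (tp q (nothing ∷ ρ))
    (combine (table (nearBit q ρ)) (table₂ (farBit q ρ))))

  hasType q n γ z = ⌊ tp q (just z ∷ replicate n nothing) ≟ᶠ γ ⌋
  centres q n γ = scatter (hasType q n γ) (2 * radius q) (suc n)
  nearBit q ρ τ = any (λ z → ⌊ near? (radius q) ρ z ⌋ ∧ ⌊ tp q (just z ∷ ρ) ≟ᶠ τ ⌋) dom
  farBit q {n} ρ γ i =
    any (λ z → hasType q n γ z ∧ (ball (2 * radius q) (Data.Vec.lookup (centres q n γ) i) z
               ∧ not ⌊ near? (radius q) ρ z ⌋)) dom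

  record _≈[_]_ {n} (ρ : Vec (Maybe U) n) (q : ℕ) (ρ' : Vec (Maybe U) n) : Set where
    constructor sameType
    field tp≡ : tp q ρ ≡ tp q ρ'
  open _≈[_]_

  module _ {q n} {ρ ρ' : Vec (Maybe U) n} (e : ρ ≈[ suc q ] ρ') where
    private
      parts   = Finₚ.combine-injective (atoms ρ) _ (atoms ρ') _ (tp≡ e)
      parts'  = Finₚ.combine-injective (tp q (nothing ∷ ρ)) _ (tp q (nothing ∷ ρ')) _ (proj₂ parts)
      parts'' = Finₚ.combine-injective (table (nearBit q ρ)) (table₂ (farBit q ρ))
                  (table (nearBit q ρ')) (table₂ (farBit q ρ')) (proj₂ parts')

    tp-skip : (nothing ∷ ρ) ≈[ q ] (nothing ∷ ρ')
    tp-skip = sameType (proj₁ parts')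

    tp-near : nearBit q ρ ≗ nearBit q ρ'
    tp-near = table-injective (nearBit q ρ) (nearBit q ρ') (proj₁ parts'')

    tp-far : ∀ γ → farBit q ρ γ ≗ farBit q ρ' γ
    tp-far = table₂-injective (farBit q ρ) (farBit q ρ') (proj₂ parts'')

  tp-atoms : ∀ {q n} {ρ ρ' : Vec (Maybe U) n} → ρ ≈[ q ] ρ' → atoms ρ ≡ atoms ρ'
  tp-atoms {zero}  e = tp≡ e
  tp-atoms {suc q} {ρ = ρ} {ρ'} e = proj₁ (Finₚ.combine-injective (atoms ρ) _ (atoms ρ') _ (tp≡ e))

  module _ {q n} {ρ ρ' : Vec (Maybe U) n} (e : ρ ≈[ q ] ρ') where
    private
      parts = Finₚ.combine-injective
        (funToFin (table₂ ∘ relCode ρ)) (table₂ (κCode ρ)) (funToFin (table₂ ∘ relCode ρ')) (table₂ (κCode ρ'))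
        (tp-atoms e)

    tp-rel : ∀ s i → relCode ρ s i ≗ relCode ρ' s i
    tp-rel s = table₂-injective (relCode ρ s) (relCode ρ' s)
      (funToFin-injective (table₂ ∘ relCode ρ) (table₂ ∘ relCode ρ') (proj₁ parts) s)

    tp-κ : ∀ i → κCode ρ i ≗ κCode ρ' i
    tp-κ = table₂-injective (κCode ρ) (κCode ρ') (proj₂ parts)

  slot : ∀ {j j' : ℕ} → Dec (j ≡ j') → U → Maybe U
  slot (yes _) z = just z
  slot (no _)  _ = nothing

  cluster : ∀ {n} → (Fin n → ℕ) → (Fin n → U) → ℕ → Vec (Maybe U) n
  cluster g a j = tabulate (λ i → slot (g i ≟ⁿ j) (a i))

  near-cluster⁺ : ∀ {r n} (g : Fin n → ℕ) (a : Fin n → U) {j z} i → g i ≡ j → D r (a i) z →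
    Near r (cluster g a j) z
  near-cluster⁺ {r} {suc n} g a {j} {z} fz e d with g fz ≟ⁿ j
  ... | yes _ = inj₁ d
  ... | no ne = contradiction e ne
  near-cluster⁺ g a {j} (fs i) e d with g fz ≟ⁿ j
  ... | yes _ = inj₂ (near-cluster⁺ (g ∘ fs) (a ∘ fs) i e d)
  ... | no  _ = near-cluster⁺ (g ∘ fs) (a ∘ fs) i e d

  near-cluster⁻ : ∀ {r n} (g : Fin n → ℕ) (a : Fin n → U) {j z} → Near r (cluster g a j) z →
    ∃[ i ] g i ≡ j × D r (a i) z
  near-cluster⁻ {n = suc n} g a {j} h with g fz ≟ⁿ j
  near-cluster⁻ {n = suc n} g a (inj₁ d) | yes e = fz , e , d
  near-cluster⁻ {n = suc n} g a (inj₂ h) | yes _ with near-cluster⁻ (g ∘ fs) (a ∘ fs) h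
  ... | i , e , d = fs i , e , d
  near-cluster⁻ {n = suc n} g a h | no _ with near-cluster⁻ (g ∘ fs) (a ∘ fs) h
  ... | i , e , d = fs i , e , d

  cluster-fresh : ∀ {n} (g : Fin n → ℕ) (a : Fin n → U) {j} → (∀ i → g i ≢ j) →
    cluster g a j ≡ replicate n nothing
  cluster-fresh {zero}  g a h = refl
  cluster-fresh {suc n} g a {j} h with g fz ≟ⁿ j
  ... | yes e = contradiction e (h fz)
  ... | no  _ = cong (nothing ∷_) (cluster-fresh (g ∘ fs) (a ∘ fs) (h ∘ fs))

  lookup-cluster : ∀ {n} (g : Fin n → ℕ) (a : Fin n → U) i →
    Data.Vec.lookup (cluster g a (g i)) i ≡ just (a i)
  lookup-cluster g a i with g i ≟ⁿ g i | lookup∘tabulate (λ i' → slot (g i' ≟ⁿ g i) (a i')) i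
  ... | yes _ | e = e
  ... | no ne | _ = contradiction refl ne

  Separated : ℕ → ∀ {n} → (Fin n → ℕ) → (Fin n → U) → Set
  Separated r g a = ∀ i i' → g i ≢ g i' → ¬ D r (a i) (a i')

  SameTypes : ℕ → ∀ {n} → (Fin n → ℕ) → (Fin n → U) → (Fin n → U) → Set
  SameTypes q g a b = ∀ j → cluster g a j ≈[ q ] cluster g b j

  separated-extend : ∀ {r s n} {g : Fin n → ℕ} {a : Fin n → U} {j z} → r ≤ s → Separated s g a →
    (∀ i → g i ≢ j → ¬ D r (a i) z) → Separated r (extend j g) (extend z a)
  separated-extend le sep far fz     fz      ne _ = contradiction refl ne
  separated-extend le sep far fz     (fs i') ne d = far i' (ne ∘ sym) (D-sym d)
  separated-extend le sep far (fs i) fz      ne d = far i ne d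
  separated-extend le sep far (fs i) (fs i') ne d = sep i i' ne (D-mono le d)

  sameTypes-extend : ∀ q {n} {g : Fin n → ℕ} {a b : Fin n → U} {j z z'} → SameTypes (suc q) g a b →
    (just z ∷ cluster g a j) ≈[ q ] (just z' ∷ cluster g b j) →
    SameTypes q (extend j g) (extend z a) (extend z' b)
  sameTypes-extend q {j = j} same e j' with j ≟ⁿ j'
  ... | yes refl = e
  ... | no  _    = tp-skip (same j')

  six : ∀ r → r + (2 * r + (2 * r + r)) ≡ 6 * r
  six = solve 1 (λ r → r :+ (con 2 :* r :+ (con 2 :* r :+ r)) := con 6 :* r) refl
    where open Data.Nat.Solver.+-*-Solver

  radius-grows : ∀ q → radius q ≤ radius (suc q)
  radius-grows q = m≤n*m (radius q) 6

  module _ {q n} {g : Fin n → ℕ} {a b : Fin n → U} (same : SameTypes (suc q) g a b)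
           (sepB : Separated (radius (suc q)) g b) where

    private r = radius q

    transfer-near : ∀ {z} i → z ∈ dom → D r (a i) z →
      ∃[ z' ] z' ∈ dom × (∃[ i' ] g i' ≡ g i × D r (b i') z') ×
              (just z ∷ cluster g a (g i)) ≈[ q ] (just z' ∷ cluster g b (g i))
    transfer-near {z} i z∈ d = decode (any⁻ _ dom (trans (sym (tp-near (same (g i)) τ))
      (any⁺ _ z∈ (∧-true⁺ (⌊⌋⁺ (near? r (cluster g a (g i)) z) (near-cluster⁺ g a i refl d)) (⌊⌋⁺ (τ ≟ᶠ τ) refl)))))
      where
      τ = tp q (just z ∷ cluster g a (g i))
      decode : (∃[ z' ] z' ∈ dom × ⌊ near? r (cluster g b (g i)) z' ⌋ ∧
                 ⌊ tp q (just z' ∷ cluster g b (g i)) ≟ᶠ τ ⌋ ≡ true) →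
        ∃[ z' ] z' ∈ dom × (∃[ i' ] g i' ≡ g i × D r (b i') z') ×
        (just z ∷ cluster g a (g i)) ≈[ q ] (just z' ∷ cluster g b (g i))
      decode (z' , z'∈ , h) =
        z' , z'∈ , near-cluster⁻ g b (⌊⌋⁻ (near? r (cluster g b (g i)) z') (proj₁ (∧-true⁻ h))) ,
        sameType (sym (⌊⌋⁻ (_ ≟ᶠ τ) (proj₂ (∧-true⁻ {⌊ near? r (cluster g b (g i)) z' ⌋} h))))

    -- If `suc n` elements of type `γ` are pairwise more than `2 * r` apart, each of the `n`
    -- elements of `b` is within `r` of at most one of them, so one is far from all of `b`.
    -- Otherwise the balls of radius `2 * r` around the centres contain every element of type `γ`,
    -- and their far bits locate a substitute; the balls are the same for both assignments.
    transfer-far : ∀ {z} → z ∈ dom → (∀ i → ¬ D r (a i) z) →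
      ∃[ z' ] z' ∈ dom × (∀ i → ¬ D r (b i) z') ×
              (just z ∷ replicate n nothing) ≈[ q ] (just z' ∷ replicate n nothing)
    transfer-far {z} z∈ far = [ if-covering , if-scattered ]′ (scatter-spec (hasType q n γ) (2 * r) (suc n))
      where
      γ = tp q (just z ∷ replicate n nothing)

      Goal : Set
      Goal = ∃[ z' ] z' ∈ dom × (∀ i → ¬ D r (b i) z') ×
        (just z ∷ replicate n nothing) ≈[ q ] (just z' ∷ replicate n nothing)

      if-scattered : Scattered (hasType q n γ) (2 * r) (centres q n γ) → Goal
      if-scattered sc = choose (all? hit?)
        where
        open Scattered sc
        hit? : ∀ s → Dec (∃[ i ] D r (b i) (centre s))
        hit? s = any? (λ i → D? r (b i) (centre s))
        collide : (∀ s → ∃[ i ] D r (b i) (centre s)) → Goal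
        collide h with pigeonhole ≤-refl (proj₁ ∘ h)
        ... | s , t , s<t , e = contradiction
          (D-mono (≤-reflexive (cong (r +_) (sym (+-identityʳ r))))
            (D-trans (D-sym (proj₂ (h s))) (subst (λ i → D r (b i) (centre t)) (sym e) (proj₂ (h t)))))
          (apart s<t)
        missed : (∃[ s ] ¬ (∃[ i ] D r (b i) (centre s))) → Goal
        missed (s , hs) = centre s , in-dom s , (λ i d → hs (i , d)) , sameType (sym (⌊⌋⁻ (_ ≟ᶠ γ) (good s)))
        choose : Dec (∀ s → ∃[ i ] D r (b i) (centre s)) → Goal
        choose (yes h) = collide h
        choose (no h)  = missed (Finₚ.¬∀⟶∃¬ _ _ hit? h)

      if-covering : Covering (hasType q n γ) (2 * r) (centres q n γ) → Goal
      -- If `z` is far from `b`, it is its own substitute. Otherwise it is near some `b i₁`, and the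
      -- far bit to transfer is that of the cluster of `i₁`, with `z` as the witness on the side of
      -- `a`.
      if-covering cov = try (any? (λ i → D? r (b i) z))
        where
        module _ {i₁} (d₁ : D r (b i₁) z) {s c} (lc : Data.Vec.lookup (centres q n γ) s ≡ just c)
                 (dc : D (2 * r) c z) where
          in-ball : ∀ y → D (2 * r) c y → ball (2 * r) (Data.Vec.lookup (centres q n γ) s) y ≡ true
          in-ball y d = subst (λ m → ball (2 * r) m y ≡ true) (sym lc) (⌊⌋⁺ (D? _ c y) d)

          not-near : ⌊ near? r (cluster g a (g i₁)) z ⌋ ≢ true
          not-near e with near-cluster⁻ g a (⌊⌋⁻ (near? r (cluster g a (g i₁)) z) e)
          ... | i , _ , d = far i d

          moved : farBit q (cluster g b (g i₁)) γ s ≡ true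
          moved = trans (sym (tp-far (same (g i₁)) γ s)) (any⁺ _ z∈
            (∧-true⁺ (⌊⌋⁺ (γ ≟ᶠ γ) refl) (∧-true⁺ (in-ball z dc) (not-true⁺ not-near))))

          far-from-b : ∀ {z'} → D (2 * r) c z' → ¬ Near r (cluster g b (g i₁)) z' → ∀ i → ¬ D r (b i) z'
          far-from-b dc' nn i d with g i₁ ≟ⁿ g i
          ... | yes e = nn (near-cluster⁺ g b i (sym e) d)
          -- An element `b i` of another cluster near `z'` would be joined to `b i₁` through `z`,
          -- `c` and `z'` within `6 * r`.
          ... | no ne = sepB i₁ i ne (D-mono (≤-reflexive (six r))
                          (D-trans d₁ (D-trans (D-sym dc) (D-trans dc' (D-sym d)))))

          decode : (∃[ z' ] z' ∈ dom × hasType q n γ z' ∧ (ball (2 * r) (Data.Vec.lookup (centres q n γ) s) z'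
                     ∧ not ⌊ near? r (cluster g b (g i₁)) z' ⌋) ≡ true) → Goal
          decode (z' , z'∈ , h) =
            z' , z'∈ ,
            far-from-b (⌊⌋⁻ (D? _ c z') (subst (λ m → ball (2 * r) m z' ≡ true) lc (proj₁ h₂)))
                       (λ nz' → not-true⁻ (proj₂ h₂) (⌊⌋⁺ (near? r (cluster g b (g i₁)) z') nz')) ,
            sameType (sym (⌊⌋⁻ (_ ≟ᶠ γ) (proj₁ h₁)))
            where
            h₁ = ∧-true⁻ {hasType q n γ z'} h
            h₂ = ∧-true⁻ {ball (2 * r) (Data.Vec.lookup (centres q n γ) s) z'} (proj₂ h₁)

        try : Dec (∃[ i ] D r (b i) z) → Goal
        try (no h) = z , z∈ , (λ i d → h (i , d)) , sameType refl
        try (yes (i₁ , d₁)) with near-lookup (centres q n γ) (cov z∈ (⌊⌋⁺ (γ ≟ᶠ γ) refl))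
        ... | s , c , lc , dc = decode d₁ {s} lc dc (any⁻ _ dom (moved d₁ {s} lc dc))

  -- A witness near some `a i` joins the cluster of `i`; a far witness opens a new cluster. Either
  -- way the extended assignments remain separated at the smaller radius.
  ex-transfer : ∀ q {n} (Y : (Fin (suc n) → U) → Bool) →
    (∀ g a b → Separated (radius q) g a → Separated (radius q) g b → SameTypes q g a b → Y a ≡ Y b) →
    ∀ g a b → Separated (radius (suc q)) g a → Separated (radius (suc q)) g b → SameTypes (suc q) g a b →
    any (λ z → Y (extend z a)) dom ≡ true → any (λ z → Y (extend z b)) dom ≡ true
  ex-transfer q {n} Y ih g a b sepA sepB same h = extendBy (any⁻ _ dom h)
    where
    r = radius q

    Goal : Set
    Goal = any (λ z → Y (extend z b)) dom ≡ true

    conclude : ∀ {z z'} j → Y (extend z a) ≡ true → z' ∈ dom →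
      (∀ i → g i ≢ j → ¬ D r (a i) z) → (∀ i → g i ≢ j → ¬ D r (b i) z') →
      (just z ∷ cluster g a j) ≈[ q ] (just z' ∷ cluster g b j) → Goal
    conclude j Yz z'∈ farA farB e = any⁺ _ z'∈ (trans (sym (ih (extend j g) _ _
      (separated-extend (radius-grows q) sepA farA)
      (separated-extend (radius-grows q) sepB farB)
      (sameTypes-extend q same e))) Yz)

    others-far : ∀ (x : Fin n → U) {i₀ j y} → Separated (radius (suc q)) g x → g i₀ ≡ j →
      D r (x i₀) y → ∀ i → g i ≢ j → ¬ D r (x i) y
    others-far x sep e d i ne d' = sep _ i (λ e' → ne (trans (sym e') e))
      (D-mono (≤-trans (≤-reflexive (cong (r +_) (sym (+-identityʳ r))))
                       (*-monoˡ-≤ r {2} {6} (s≤s (s≤s z≤n))))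
        (D-trans d (D-sym d')))

    near-case : ∀ {z} i → D r (a i) z → Y (extend z a) ≡ true →
      (∃[ z' ] z' ∈ dom × (∃[ i' ] g i' ≡ g i × D r (b i') z') ×
               (just z ∷ cluster g a (g i)) ≈[ q ] (just z' ∷ cluster g b (g i))) → Goal
    near-case i d Yz (z' , z'∈ , (i' , gi' , d') , e) =
      conclude (g i) Yz z'∈ (others-far a sepA refl d) (others-far b sepB gi' d') e

    far-case : ∀ {z} → (∀ i → ¬ D r (a i) z) → Y (extend z a) ≡ true →
      (∃[ z' ] z' ∈ dom × (∀ i → ¬ D r (b i) z') ×
               (just z ∷ replicate n nothing) ≈[ q ] (just z' ∷ replicate n nothing)) →
      (∃[ j ] ∀ i → g i ≢ j) → Goal
    far-case {z} far Yz (z' , z'∈ , far' , e) (j , new) =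
      conclude j Yz z'∈ (λ i _ → far i) (λ i _ → far' i)
        (subst₂ (λ ρ ρ' → (just z ∷ ρ) ≈[ q ] (just z' ∷ ρ'))
          (sym (cluster-fresh g a new)) (sym (cluster-fresh g b new)) e)

    extendBy : (∃[ z ] z ∈ dom × Y (extend z a) ≡ true) → Goal
    extendBy (z , z∈ , Yz) = split (any? (λ i → D? r (a i) z))
      where
      split : Dec (∃[ i ] D r (a i) z) → Goal
      split (yes (i , d)) = near-case i d Yz (transfer-near same sepB i z∈ d)
      split (no far) = far-case (λ i d → far (i , d)) Yz (transfer-far same sepB z∈ λ i d → far (i , d)) (fresh g)

  locality : ∀ {n} (φ : Formula k n) q → rank φ ≤ q → ∀ g a b →
    Separated (radius q) g a → Separated (radius q) g b → SameTypes q g a b → eval M φ a ≡ eval M φ b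
  -- Taking `f` to be the identity or negation serves both quantifiers, with `allF` read as a
  -- negated existential.
  locality-ex : ∀ {n} (φ : Formula k (suc n)) q → rank φ < q → ∀ g a b →
    Separated (radius q) g a → Separated (radius q) g b → SameTypes q g a b →
    ∀ (f : Bool → Bool) → any (λ z → f (eval M φ (extend z a))) dom ≡ any (λ z → f (eval M φ (extend z b))) dom

  locality-rel : ∀ {n} s (i j : Fin n) q g a b →
    Separated (radius q) g a → Separated (radius q) g b → SameTypes q g a b →
    rel M s (a i) (a j) ≡ rel M s (b i) (b j)
  locality-rel s i j q g a b sepA sepB same with g i ≟ⁿ g j
  ... | no ne = binary s (far a sepA) (far b sepB) (bits i) (bits j)
    where
    far : ∀ x → Separated (radius q) g x → ¬ D 1 (x i) (x j)
    far x sep d = sep i j ne (D-mono (radius≥1 q) d)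
    bits : ∀ i → κ (a i) ≗ κ (b i)
    bits i c = subst₂ (λ x y → κ? x c ≡ κ? y c) (lookup-cluster g a i) (lookup-cluster g b i)
                 (tp-κ (same (g i)) i c)
  ... | yes e = subst₂ _≡_ (both a) (both b) (tp-rel (same (g i)) s i j)
    where
    both : ∀ x → rel? s (Data.Vec.lookup (cluster g x (g i)) i) (Data.Vec.lookup (cluster g x (g i)) j)
               ≡ rel M s (x i) (x j)
    both x = cong₂ (rel? s) (lookup-cluster g x i)
      (subst (λ c → Data.Vec.lookup (cluster g x c) j ≡ just (x j)) (sym e) (lookup-cluster g x j))

  locality (eqF i j)   q _ g a b s s' t = locality-rel fz i j q g a b s s' t
  locality (edgeF i j) q _ g a b s s' t = locality-rel (fs fz) i j q g a b s s' t
  locality (simF i j)  q _ g a b s s' t = locality-rel (fs (fs fz)) i j q g a b s s' t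
  locality (predF c i) q _ g a b s s' t = unary c λ d →
    subst₂ (λ x y → κ? x d ≡ κ? y d) (lookup-cluster g a i) (lookup-cluster g b i) (tp-κ (t (g i)) i d)
  locality (negF φ)    q l g a b s s' t = cong not (locality φ q l g a b s s' t)
  locality (andF φ ψ)  q l g a b s s' t =
    cong₂ _∧_ (locality φ q (m⊔n≤o⇒m≤o _ _ l) g a b s s' t) (locality ψ q (m⊔n≤o⇒n≤o (rank φ) _ l) g a b s s' t)
  locality (orF φ ψ)   q l g a b s s' t =
    cong₂ _∨_ (locality φ q (m⊔n≤o⇒m≤o _ _ l) g a b s s' t) (locality ψ q (m⊔n≤o⇒n≤o (rank φ) _ l) g a b s s' t)
  locality (exF φ)     q l g a b s s' t = locality-ex φ q l g a b s s' t id
  locality (allF φ)    q l g a b s s' t = trans (all-any _ dom)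
    (trans (cong not (locality-ex φ q l g a b s s' t not)) (sym (all-any _ dom)))

  locality-ex φ (suc q) (s≤s l) g a b s s' t f = bool-ext
    (ex-transfer q (f ∘ eval M φ) ih g a b s s' t)
    (ex-transfer q (f ∘ eval M φ) ih g b a s' s (λ j → sameType (sym (tp≡ (t j)))))
    where
    ih : ∀ g a b → Separated (radius q) g a → Separated (radius q) g b → SameTypes q g a b →
      f (eval M φ a) ≡ f (eval M φ b)
    ih g a b s s' t = cong f (locality φ q l g a b s s' t)

-- Enumerations and lexicographic orders

record Enumeration (A : Set) : Set where
  field
    list     : List A
    unique   : Unique list
    complete : ∀ x → x ∈ list
    equal?   : DecidableEquality A

module _ where
  open Enumeration

  enumFin : ∀ n → Enumeration (Fin n)
  enumFin n = record { list = allFin n ; unique = allFin⁺ n ; complete = ∈-allFin ; equal? = _≟ᶠ_ }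

  enumSubset : ∀ n → Enumeration (Subset n)
  enumSubset n = record { list = powerset n ; unique = powerset-unique n ; complete = ∈-powerset ; equal? = _≟ˢ_ }

  enum× : {A B : Set} → Enumeration A → Enumeration B → Enumeration (A × B)
  enum× a b = record
    { list     = cartesianProduct (list a) (list b)
    ; unique   = cartesianProduct⁺ (unique a) (unique b)
    ; complete = λ { (x , y) → ∈-cartesianProduct⁺ (complete a x) (complete b y) }
    ; equal?   = Data.Product.Properties.≡-dec (equal? a) (equal? b)
    }

  enum⊎ : {A B : Set} → Enumeration A → Enumeration B → Enumeration (A ⊎ B)
  enum⊎ a b = record
    { list     = map inj₁ (list a) ++ map inj₂ (list b)
    ; unique   = ++⁺ (map⁺ (λ { refl → refl }) (unique a)) (map⁺ (λ { refl → refl }) (unique b)) disjoint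
    ; complete = λ { (inj₁ x) → ∈-++⁺ˡ (∈-map⁺ inj₁ (complete a x))
                   ; (inj₂ y) → ∈-++⁺ʳ (map inj₁ (list a)) (∈-map⁺ inj₂ (complete b y)) }
    ; equal?   = Data.Sum.Properties.≡-dec (equal? a) (equal? b)
    }
    where
    disjoint : ∀ {x} → ¬ (x ∈ map inj₁ (list a) × x ∈ map inj₂ (list b))
    disjoint (p , q) with ∈-map⁻ inj₁ p | ∈-map⁻ inj₂ q
    ... | _ , _ , refl | _ , _ , ()

cover-lookup : {A : Set} {xs : List A} → Unique xs → {Q : A → Set} → (∀ x → Dec (Q x)) → ∀ {k} →
  Cover Q k → Cover (λ v → Q (lookup xs v)) k
cover-lookup {xs = xs} u Q? c = atMost⇒cover (Q? ∘ lookup xs) λ vs uvs qs →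
  ≤-trans (≤-reflexive (sym (length-map (lookup xs) vs)))
    (cover⇒atMost c (map (lookup xs) vs) (map⁺ (lookup-injective u) uvs)
      (Data.List.Relation.Unary.All.Properties.map⁺ qs))

lex⇒≤ : ∀ {S a b i j} → j < S → a * S + i ≤ b * S + j → a ≤ b
lex⇒≤ {S} {a} {b} {i} {j} j<S le with a ≤? b
... | yes a≤b = a≤b
... | no  a≰b = contradiction (begin-strict
  b * S + j  <⟨ +-monoʳ-< (b * S) j<S ⟩
  b * S + S  ≡⟨ +-comm (b * S) S ⟩
  suc b * S  ≤⟨ *-monoˡ-≤ S (≰⇒> a≰b) ⟩
  a * S      ≤⟨ m≤m+n (a * S) i ⟩
  a * S + i  ≤⟨ le ⟩
  b * S + j  ∎) (<-irrefl refl)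
  where open ≤-Reasoning

lex-digit : ∀ {S a b i j} → a ≡ b → a * S + i ≤ b * S + j → i ≤ j
lex-digit {S} {a} refl le = +-cancelˡ-≤ (a * S) _ _ le

lex-injective : ∀ {S a b i j} → i < S → j < S → a * S + i ≡ b * S + j → i ≡ j
lex-injective {S} {a} {b} {i} {j} i<S j<S e = +-cancelˡ-≡ (a * S) _ _ (trans e (cong (λ c → c * S + j) (sym a≡b)))
  where
  a≡b : a ≡ b
  a≡b = ≤-antisym (lex⇒≤ j<S (≤-reflexive e)) (lex⇒≤ i<S (≤-reflexive (sym e)))

-- The vertex index breaks ties, which makes any rank function injective and respects its strict
-- inequalities.
byRank : ∀ {n} → (Fin n → ℕ) → Fin n → ℕ
byRank {n} rk v = rk v * n + toℕ v

byRank-injective : ∀ {n} (rk : Fin n → ℕ) → Injective _≡_ _≡_ (byRank rk)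
byRank-injective rk {x} {y} e = toℕ-injective (lex-injective {a = rk x} {rk y} (toℕ<n x) (toℕ<n y) e)

byRank-≤ : ∀ {n} (rk : Fin n → ℕ) {x y} → byRank rk x ≤ byRank rk y → rk x ≤ rk y
byRank-≤ rk {x} {y} = lex⇒≤ {a = rk x} {rk y} {toℕ x} (toℕ<n y)

byRank-< : ∀ {n} (rk : Fin n → ℕ) {x y} → rk x < rk y → byRank rk x < byRank rk y
byRank-< rk lt = ≰⇒> λ le → contradiction (<-≤-trans lt (byRank-≤ rk le)) (<-irrefl refl)

⊆⇒≡ : ∀ {n} {A B : Subset n} → A ⊆ B → ∣ B ∣ ≤ ∣ A ∣ → A ≡ B
⊆⇒≡ {A = A} {B} sub le = ⊆-antisym sub converse
  where
  converse : B ⊆ A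
  converse {x} x∈B with x ∈? A
  ... | yes x∈A = x∈A
  ... | no  x∉A = contradiction (<-≤-trans (p⊂q⇒∣p∣<∣q∣ (sub , x , x∈B , x∉A)) le) (<-irrefl refl)

argmax : ∀ {n} (π : Fin n → ℕ) {P : Fin n → Set} (P? : ∀ x → Dec (P x)) {x : Fin n} → P x →
  ∃[ h ] P h × (∀ y → P y → π y ≤ π h)
argmax π P? px with key-attained π (≤-trans (s≤s z≤n) (∈⇒<key π (∈⟦⟧⁺ P? px)))
... | h , h∈ , e = h , ∈⟦⟧⁻ P? h∈ , λ y py → ≤-pred (subst (π y <_) e (∈⇒<key π (∈⟦⟧⁺ P? py)))

-- From transductions to lacon-decompositions

-- Addresses list entries by `Fin K` whatever the length, so that the number of colours depends on
-- the bound `K` alone.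
pad : {A : Set} → List A → ∀ {K} → Fin K → Maybe A
pad []       _      = nothing
pad (x ∷ xs) fz     = just x
pad (x ∷ xs) (fs i) = pad xs i

pad-∈ : {A : Set} {x : A} {xs : List A} {K : ℕ} → x ∈ xs → length xs ≤ K → ∃[ s ] pad xs {K} s ≡ just x
pad-∈ (here refl) (s≤s l) = fz , refl
pad-∈ (there m)   (s≤s l) with pad-∈ m l
... | s , e = fs s , e

join : ∀ {a b} → (Fin a → Bool) → (Fin b → Bool) → Fin (a + b) → Bool
join {a} f g i = [ f , g ]′ (splitAt a i)

join-injectiveˡ : ∀ {a b} {f f' : Fin a → Bool} {g g' : Fin b → Bool} → join f g ≗ join f' g' → f ≗ f'
join-injectiveˡ {a} {b} {f} {f'} {g} {g'} e i =
  subst (λ s → [ f , g ]′ s ≡ [ f' , g' ]′ s) (Finₚ.splitAt-↑ˡ a i b) (e (i ↑ˡ b))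

join-injectiveʳ : ∀ {a b} {f f' : Fin a → Bool} {g g' : Fin b → Bool} → join f g ≗ join f' g' → g ≗ g'
join-injectiveʳ {a} {b} {f} {f'} {g} {g'} e i =
  subst (λ s → [ f , g ]′ s ≡ [ f' , g' ]′ s) (Finₚ.splitAt-↑ʳ a b i) (e (a ↑ʳ i))

equalBit : ∀ {k} → Fin k → Fin k → ℕ
equalBit α β = if ⌊ α ≟ᶠ β ⌋ then 1 else 0

equalBit<2 : ∀ {k} (α β : Fin k) → equalBit α β < 2
equalBit<2 α β with α ≟ᶠ β
... | yes _ = ≤-refl
... | no  _ = s≤s z≤n

equalBit-≤ : ∀ {k} {α β γ δ : Fin k} → equalBit γ δ ≤ equalBit α β → γ ≡ δ → α ≡ β
equalBit-≤ {α = α} {β} {γ} {δ} le e with α ≟ᶠ β | γ ≟ᶠ δ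
... | yes e' | _     = e'
... | no _   | no ne = contradiction e ne
equalBit-≤ () e | no _ | yes _

-- Deleting the vertices in L from G leaves a metric on the copies of G once every element is coloured by
-- its equalities and adjacencies with L.
module Deletion {p m K : ℕ} {G : Graph} (c : Fin p → V G → Bool) (L : List (V G)) (len-L : length L ≤ K) where

  M = copyStructure p m G c
  open Structure M

  eqBits : U → Fin K → Bool
  eqBits x s = Data.Maybe.maybe (λ a → ⌊ proj₁ x ≟ᶠ a ⌋) false (pad L s)

  adjBits : U → Fin K → Bool
  adjBits x s = Data.Maybe.maybe (λ a → adj G a (proj₁ x)) false (pad L s)

  bits : U → Fin ((p + m) + (K + K)) → Bool
  bits x = join (λ d → P d x) (join (eqBits x) (adjBits x))

  -- The copy index is disregarded, so far elements related by `Sim` can only be copies of one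
  -- deleted vertex.
  Dist≤ : ℕ → U → U → Set
  Dist≤ r x y = Within G (_∉ L) r (proj₁ x) (proj₁ y)

  in? : ∀ x → Dec (x ∈ L)
  in? x = Data.List.Membership.DecPropositional._∈?_ _≟ᶠ_ x L

  module _ {x x' : U} (e : bits x ≗ bits x') where

    same-pred : ∀ d → P d x ≡ P d x'
    same-pred = join-injectiveˡ e

    -- The predicates include the `m` copy marks, so the colour of an element reveals its copy.
    same-copy : proj₂ x ≡ proj₂ x'
    same-copy = sym (⌊⌋⁻ (proj₂ x' ≟ᶠ proj₂ x)
      (trans (sym (copyBit x')) (trans (sym (same-pred (p ↑ʳ proj₂ x))) (trans (copyBit x) (⌊⌋⁺ (_ ≟ᶠ _) refl)))))
      where
      copyBit : ∀ y → P (p ↑ʳ proj₂ x) y ≡ (proj₂ y ==ᶠ proj₂ x)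
      copyBit y rewrite Finₚ.splitAt-↑ʳ p m (proj₂ x) = refl

    same-deleted : proj₁ x ∈ L → proj₁ x ≡ proj₁ x'
    same-deleted x∈ with pad-∈ x∈ len-L
    ... | s , ps = sym (⌊⌋⁻ (proj₁ x' ≟ᶠ proj₁ x)
      (subst (λ a → Data.Maybe.maybe (λ a → ⌊ proj₁ x' ≟ᶠ a ⌋) false a ≡ true) ps
        (trans (sym (join-injectiveˡ (join-injectiveʳ {f = λ d → P d x} {f' = λ d → P d x'} e) s))
          (subst (λ a → Data.Maybe.maybe (λ a → ⌊ proj₁ x ≟ᶠ a ⌋) false a ≡ true) (sym ps)
            (⌊⌋⁺ (proj₁ x ≟ᶠ proj₁ x) refl)))))

    same-adj : ∀ {a} → a ∈ L → adj G a (proj₁ x) ≡ adj G a (proj₁ x')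
    same-adj a∈ with pad-∈ a∈ len-L
    ... | s , ps = subst
      (λ a → Data.Maybe.maybe (λ a → adj G a (proj₁ x)) false a
           ≡ Data.Maybe.maybe (λ a → adj G a (proj₁ x')) false a) ps
      (join-injectiveʳ {f = eqBits x} {f' = eqBits x'}
        (join-injectiveʳ {f = λ d → P d x} {f' = λ d → P d x'} e) s)

  module _ {x y x' y' : U} (far : ¬ Dist≤ 1 x y) (ex : bits x ≗ bits x') (ey : bits y ≗ bits y') where

    copies : (proj₂ x ==ᶠ proj₂ y) ≡ (proj₂ x' ==ᶠ proj₂ y')
    copies = cong₂ _==ᶠ_ (same-copy {x} {x'} ex) (same-copy {y} {y'} ey)

    equal-deleted : proj₁ x ≡ proj₁ y → proj₁ x' ≡ proj₁ y'
    equal-deleted x≡y with in? (proj₁ x)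
    ... | yes x∈ = trans (sym (same-deleted {x} {x'} ex x∈))
                     (trans x≡y (same-deleted {y} {y'} ey (subst (_∈ L) x≡y x∈)))
    ... | no x∉ = contradiction (subst (Within G (_∉ L) 1 (proj₁ x)) x≡y (stop x∉)) far

    adj-deleted : adj G (proj₁ x) (proj₁ y) ≡ true → adj G (proj₁ x') (proj₁ y') ≡ true
    adj-deleted xy with in? (proj₁ x) | in? (proj₁ y)
    ... | yes x∈ | _ = trans (cong (λ a → adj G a (proj₁ y')) (sym (same-deleted {x} {x'} ex x∈)))
                         (trans (sym (same-adj {y} {y'} ey x∈)) xy)
    ... | no _ | yes y∈ = trans (Graph.sym G _ _)
      (trans (cong (λ a → adj G a (proj₁ x')) (sym (same-deleted {y} {y'} ey y∈)))
        (trans (sym (same-adj {x} {x'} ex y∈)) (trans (Graph.sym G _ _) xy)))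
    ... | no x∉ | no y∉ = contradiction (move x∉ xy (stop y∉)) far

  far-rel : ∀ s {x y x' y'} → ¬ Dist≤ 1 x y → ¬ Dist≤ 1 x' y' → bits x ≗ bits x' → bits y ≗ bits y' →
    rel M s x y ≡ rel M s x' y'
  far-rel s {x} {y} {x'} {y'} f f' ex ey = atom s
    where
    ex' : bits x' ≗ bits x
    ex' i = sym (ex i)
    ey' : bits y' ≗ bits y
    ey' i = sym (ey i)
    vertices : (proj₁ x ==ᶠ proj₁ y) ≡ (proj₁ x' ==ᶠ proj₁ y')
    vertices = ⌊⌋-cong (_ ≟ᶠ _) (_ ≟ᶠ _) (equal-deleted {x} {y} f ex ey) (equal-deleted {x'} {y'} f' ex' ey')
    atom : ∀ s → rel M s x y ≡ rel M s x' y'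
    atom fz           = cong₂ _∧_ vertices (copies {x} {y} f ex ey)
    atom (fs fz)      = cong₂ _∧_ (bool-ext (adj-deleted {x} {y} f ex ey) (adj-deleted {x'} {y'} f' ex' ey'))
                          (copies {x} {y} f ex ey)
    atom (fs (fs fz)) = vertices

  metric : Metric M ((p + m) + (K + K))
  metric = record
    { D       = Dist≤
    ; D?      = λ r x y → within? (¬? ∘ in?) r (proj₁ x) (proj₁ y)
    ; D-sym   = within-sym
    ; D-trans = within-trans
    ; D-mono  = λ l → within-weaken l id
    ; κ       = bits
    ; unary   = λ d {x} {x'} e → same-pred {x} {x'} e d
    ; binary  = λ s {x} {y} {x'} {y'} → far-rel s {x} {y} {x'} {y'}
    }

-- The lacon-decomposition of a transduced graph

module FromTransduction (τ : Transduction) (f : ℕ → ℕ) where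
  open Transduction τ

  q r K N NN : ℕ
  q  = rank phi
  r  = radius q
  K  = wcolBound f r
  N  = typeCount ((p + m) + (K + K)) q 2
  NN = N * N

  -- A hop goes at most `r` steps to the vertex of some `t` and at most `r` steps on from it. The
  -- summand `K` accounts for the sizes of the sets `R t`.
  F : ℕ → ℕ
  F k = K + wcolBound f (k * (r + r))

  module _ {G H : Graph} (π : V G → ℕ) (π-inj : IsOrder G π) (col : ∀ r → ColLE G π r (f r))
           (c : Fin p → V G → Bool) (out : IsBasicOutput (copyStructure p m G c) chi nu phi H) where

    n = size G
    M = copyStructure p m G c
    place = proj₁ (proj₂ out)

    edge-phi : ∀ u v → u ≢ v →
      adj H u v ≡ eval M phi (two (place u) (place v)) ∨ eval M phi (two (place v) (place u))
    edge-phi = proj₂ (proj₂ (proj₂ (proj₂ (proj₂ out))))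

    R? : ∀ t y → Dec (WReach {G} π r (proj₁ (place t)) y)
    R? t y = wreach? {G} π r (proj₁ (place t)) y

    R : V H → Subset n
    R t = ⟦ R? t ⟧

    ∣R∣≤K : ∀ t → ∣ R t ∣ ≤ K
    ∣R∣≤K t = cover⇒∣∣≤ (cover-mono (λ y → ∈⟦⟧⁻ (R? t)) (wreach-cover {G} π π-inj col r (proj₁ (place t))))

    -- By the choice of `R t`, the walk through the vertex of `t` stays above `y` on one side and
    -- above `y'` on the other, and neither of these is below `u`.
    chain⇒wreach : ∀ {c k y u} → π u ≤ c → Chain R π c k y u → WReach {G} π (k * (r + r)) y u
    chain⇒wreach u≤c done = stop ≤-refl
    chain⇒wreach u≤c (hop {t = t} c≤y y∈ y'∈ ch) = within-trans (within-trans
        (within-weaken ≤-refl (≤-trans (≤-trans u≤c c≤y)) (within-sym (∈⟦⟧⁻ (R? t) y∈)))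
        (within-weaken ≤-refl (≤-trans (within-start rest)) (∈⟦⟧⁻ (R? t) y'∈)))
      rest
      where rest = chain⇒wreach u≤c ch

    system : System R π F
    system = record
      { π-injective = π-inj
      ; degree≤     = λ t → ≤-trans (∣R∣≤K t) (m≤m+n K _)
      ; chains      = λ k y → cover-≤ (m≤n+m _ K)
          (cover-mono (λ u → λ { (le , ch) → chain⇒wreach le ch })
            (wreach-cover {G} π π-inj col (k * (r + r)) y))
      }

    -- Types are defined over every subset, including those with more than `K` elements. Truncation
    -- makes this possible, and it removes nothing when `A` is of the form `R t ∩ R t'`.
    deleted : Subset n → List (V G)
    deleted A = Data.List.take K (elements A)

    deleted≤ : ∀ A → length (deleted A) ≤ K
    deleted≤ A = ≤-trans (≤-reflexive (Data.List.Properties.length-take K (elements A))) (m⊓n≤m K _)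

    ∈-deleted : ∀ {A x} → ∣ A ∣ ≤ K → x ∈ˢ A → x ∈ deleted A
    ∈-deleted {A} le m = subst (_ ∈_)
      (sym (Data.List.Properties.take-all K (elements A) (≤-trans (length-elements≤ A) le))) (∈-elements⁺ m)

    metric : ∀ A → Metric M ((p + m) + (K + K))
    metric A = Deletion.metric {p} {m} {K} {G} c (deleted A) (deleted≤ A)

    -- Both argument positions are recorded: `phi` need not be symmetric, while an edge asks for
    -- either orientation.
    ty₁ ty₂ : Subset n → V H → Fin N
    ty₁ A t = Types.tp (metric A) q (just (place t) ∷ nothing ∷ [])
    ty₂ A t = Types.tp (metric A) q (nothing ∷ just (place t) ∷ [])

    -- A short walk avoiding R t ∩ R t' would reach its minimum from both ends.
    separated : ∀ {A t t'} → R t ∩ R t' ≡ A → ¬ Metric.D (metric A) r (place t) (place t')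
    separated {A} {t} {t'} e w with within-minimum {G} π w
    ... | u , u∉ , reach , reach' = u∉ (∈-deleted
      (≤-trans (p⊆q⇒∣p∣≤∣q∣ (subst (_⊆ R t) e (p∩q⊆p (R t) (R t')))) (∣R∣≤K t))
      (subst (u ∈ˢ_) e (x∈p∩q⁺ (∈⟦⟧⁺ (R? t) reach , ∈⟦⟧⁺ (R? t') reach'))))

    -- After deletion of `A` the two arguments are separated, so each forms its own cluster and
    -- locality reduces the pair to two types of single elements.
    phi-determined : ∀ {A s s' t t'} → R s ∩ R s' ≡ A → R t ∩ R t' ≡ A →
      ty₁ A s ≡ ty₁ A t → ty₂ A s' ≡ ty₂ A t' →
      eval M phi (two (place s) (place s')) ≡ eval M phi (two (place t) (place t'))
    phi-determined {A} {s} {s'} {t} {t'} es et e₁ e₂ =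
      locality phi q ≤-refl (two 0 1) (two (place s) (place s')) (two (place t) (place t'))
        (sep es) (sep et) same
      where
      open Types (metric A)
      sep : ∀ {s s'} → R s ∩ R s' ≡ A → Separated r (two 0 1) (two (place s) (place s'))
      sep {s} {s'} e fz      fz      ne = contradiction refl ne
      sep {s} {s'} e fz      (fs fz) ne = separated {A} {s} {s'} e
      sep {s} {s'} e (fs fz) fz      ne = separated {A} {s} {s'} e ∘ within-sym
      sep {s} {s'} e (fs fz) (fs fz) ne = contradiction refl ne
      same : SameTypes q (two 0 1) (two (place s) (place s')) (two (place t) (place t'))
      same 0             = sameType e₁
      same 1             = sameType e₂
      same (suc (suc j)) = sameType refl

    ty : Subset n → V H → Fin NN
    ty A t = combine (ty₁ A t) (ty₂ A t)

    edge-determined : ∀ {A s s' t t'} → s ≢ s' → t ≢ t' → R s ∩ R s' ≡ A → R t ∩ R t' ≡ A →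
      ty A s ≡ ty A t → ty A s' ≡ ty A t' → adj H s s' ≡ adj H t t'
    edge-determined {A} {s} {s'} {t} {t'} s≢ t≢ es et e e' =
      trans (edge-phi s s' s≢) (trans (cong₂ _∨_
          (phi-determined es et (proj₁ parts) (proj₂ parts'))
          (phi-determined (trans (∩-comm (R s') (R s)) es) (trans (∩-comm (R t') (R t)) et)
            (proj₁ parts') (proj₂ parts)))
        (sym (edge-phi t t' t≢)))
      where
      parts  = Finₚ.combine-injective (ty₁ A s) (ty₂ A s) (ty₁ A t) (ty₂ A t) e
      parts' = Finₚ.combine-injective (ty₁ A s') (ty₂ A s') (ty₁ A t') (ty₂ A t') e'

    Hidden : Set
    Hidden = Subset n × Fin NN × Fin NN

    enum : Enumeration (V H ⊎ Hidden)
    enum = enum⊎ (enumFin (size H)) (enum× (enumSubset n) (enum× (enumFin NN) (enumFin NN)))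
    open Enumeration enum using (list; unique; complete)

    Attached : V H → Hidden → Set
    Attached t (A , α , β) = A ⊆ R t × (ty A t ≡ α ⊎ ty A t ≡ β)

    attached? : ∀ t h → Dec (Attached t h)
    attached? t (A , α , β) = (A ⊆? R t) ×-dec ((ty A t ≟ᶠ α) ⊎-dec (ty A t ≟ᶠ β))

    incident : V H ⊎ Hidden → V H ⊎ Hidden → Bool
    incident (inj₁ t) (inj₂ h) = ⌊ attached? t h ⌋
    incident (inj₂ h) (inj₁ t) = ⌊ attached? t h ⌋
    incident (inj₁ _) (inj₁ _) = false
    incident (inj₂ _) (inj₂ _) = false

    incident-sym : ∀ x y → incident x y ≡ incident y x
    incident-sym (inj₁ _) (inj₁ _) = refl
    incident-sym (inj₁ _) (inj₂ _) = refl
    incident-sym (inj₂ _) (inj₁ _) = refl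
    incident-sym (inj₂ _) (inj₂ _) = refl

    incident-irrefl : ∀ x → incident x x ≡ false
    incident-irrefl (inj₁ _) = refl
    incident-irrefl (inj₂ _) = refl

    L : Graph
    L = graphOn list incident incident-sym incident-irrefl

    at : V L → V H ⊎ Hidden
    at = lookup list

    -- Three digits. The key comes first for the sake of `σ-key`. The size lets `R u ∩ R v` beat its
    -- proper subsets with the same top. The last bit prefers equal types: if `u` and `v` both have
    -- type `α`, they are attached to `(A , α , β)` for every `β`, but the label wanted is that of
    -- `(A , α , α)`.
    hiddenRank : Hidden → ℕ
    hiddenRank (A , α , β) = (key π A * suc n + ∣ A ∣) * 2 + equalBit α β

    ∣∣<suc : (A : Subset n) → ∣ A ∣ < suc n
    ∣∣<suc A = s≤s (Data.Fin.Subset.Properties.∣p∣≤n A)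

    hiddenRank-≤ : ∀ {A α β B γ δ} → hiddenRank (A , α , β) ≤ hiddenRank (B , γ , δ) →
      key π A * suc n + ∣ A ∣ ≤ key π B * suc n + ∣ B ∣
    hiddenRank-≤ {A} {α} {β} {B} {γ} {δ} =
      lex⇒≤ {a = key π A * suc n + ∣ A ∣} {key π B * suc n + ∣ B ∣}
            {equalBit α β} (equalBit<2 γ δ)

    hiddenRank-key : ∀ {A α β B γ δ} → hiddenRank (A , α , β) ≤ hiddenRank (B , γ , δ) → key π A ≤ key π B
    hiddenRank-key {A} {B = B} le = lex⇒≤ {a = key π A} {key π B} {∣ A ∣} (∣∣<suc B) (hiddenRank-≤ le)

    top : ℕ
    top = (maxF (suc ∘ π) * suc n + n) * 2 + 1

    hiddenRank≤top : ∀ h → hiddenRank h ≤ top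
    hiddenRank≤top (A , α , β) = +-mono-≤
      (*-monoˡ-≤ 2 (+-mono-≤ (*-monoˡ-≤ (suc n) (key≤ π A)) (Data.Fin.Subset.Properties.∣p∣≤n A)))
      (≤-pred (equalBit<2 α β))

    rankOf : V H ⊎ Hidden → ℕ
    rankOf (inj₁ _) = suc top
    rankOf (inj₂ h) = hiddenRank h

    owner : V H ⊎ Hidden → V H ⊎ Subset n
    owner (inj₁ t)       = inj₁ t
    owner (inj₂ (A , _)) = inj₂ A

    rank-owner : ∀ x y → rankOf x ≤ rankOf y → ownerKey π (owner x) ≤ ownerKey π (owner y)
    rank-owner (inj₁ _) (inj₁ _)       _  = ≤-refl
    rank-owner (inj₁ _) (inj₂ h)       le = contradiction (≤-trans le (hiddenRank≤top h)) (<-irrefl refl)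
    rank-owner (inj₂ (A , _)) (inj₁ _) _  = m≤n⇒m≤1+n (key≤ π A)
    rank-owner (inj₂ _) (inj₂ _)       le = hiddenRank-key le

    incident-link : ∀ x y → incident x y ≡ true → Link R (owner x) (owner y)
    incident-link (inj₁ t) (inj₂ h) e = down (proj₁ (⌊⌋⁻ (attached? t h) e))
    incident-link (inj₂ h) (inj₁ t) e = up (proj₁ (⌊⌋⁻ (attached? t h) e))

    fibre : ∀ o → Cover (λ x → owner x ≡ o) (1 + NN * NN)
    fibre (inj₁ t) = cover-≤ (s≤s z≤n)
      (inj₁ t ∷ [] , ≤-refl , λ { (inj₁ _) refl → here refl })
    fibre (inj₂ A) = cover-≤ (n≤1+n _) (cover-image (λ { (α , β) → inj₂ (A , α , β) })
      (λ { (inj₂ (_ , α , β)) refl → (α , β) , (α , β) , refl })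
      (cover-× {P = λ _ → Fin NN} {Q = λ _ → Fin NN} (cover-Fin NN) (cover-Fin NN)))

    over : Over R π L (1 + NN * NN)
    over = record
      { owner  = owner ∘ at
      ; links  = λ {x} {y} → incident-link (at x) (at y)
      ; fibres = λ o → cover-lookup unique
          (λ x → Data.Sum.Properties.≡-dec _≟ᶠ_ _≟ˢ_ (owner x) o) (fibre o)
      ; σ      = byRank (rankOf ∘ at)
      ; σ-key  = λ {x} {y} le → rank-owner (at x) (at y) (byRank-≤ (rankOf ∘ at) le)
      }

    WitnessPair : Hidden → V H → V H → Set
    WitnessPair (A , α , β) t t' = R t ∩ R t' ≡ A × ty A t ≡ α × ty A t' ≡ β × adj H t t' ≡ true

    witnessPair? : ∀ h t t' → Dec (WitnessPair h t t')
    witnessPair? (A , α , β) t t' =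
      ((R t ∩ R t') ≟ˢ A) ×-dec (ty A t ≟ᶠ α) ×-dec (ty A t' ≟ᶠ β) ×-dec (adj H t t' ≟ᵇ true)

    Witness : Hidden → Set
    Witness h = ∃[ t ] ∃[ t' ] WitnessPair h t t'

    witness? : ∀ h → Dec (Witness h)
    witness? h = any? (λ t → any? (witnessPair? h t))

    -- A single sample decides the label: if one pair with this intersection and these types is
    -- adjacent, then by `edge-determined` so is every other such pair of distinct vertices.
    labelOf : V H ⊎ Hidden → Bool
    labelOf (inj₁ _) = false
    labelOf (inj₂ h) = ⌊ witness? h ⌋

    sideOf : V H ⊎ Hidden → Side
    sideOf (inj₁ _) = tgt
    sideOf (inj₂ _) = hid

    witness-swap : ∀ {A α β} → Witness (A , α , β) → Witness (A , β , α)
    witness-swap (t , t' , e , e₁ , e₂ , a) =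
      t' , t , trans (∩-comm (R t') (R t)) e , e₂ , e₁ , trans (Graph.sym H t' t) a

    adj⇒≢ : ∀ {u v} → adj H u v ≡ true → u ≢ v
    adj⇒≢ {u} a refl = contradiction (trans (sym a) (Graph.irrefl H u)) λ ()

    module _ {u v : V H} (u≢v : u ≢ v) where
      C = R u ∩ R v

      witness⇔edge : (Witness (C , ty C u , ty C v) → adj H u v ≡ true) ×
                     (adj H u v ≡ true → Witness (C , ty C u , ty C v))
      witness⇔edge =
        (λ { (t , t' , e , e₁ , e₂ , a) →
             trans (edge-determined u≢v (adj⇒≢ a) refl e (sym e₁) (sym e₂)) a }) ,
        (λ a → u , v , refl , refl , refl , a)

      -- The hidden vertex (C , ty u , ty v) is a common neighbour, so the dominant one also has first
      -- component C, and its two types must be those of u and v.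
      dominant-types : ∀ h → Attached u h → Attached v h →
        hiddenRank (C , ty C u , ty C v) ≤ hiddenRank h →
        ∃[ α ] ∃[ β ] h ≡ (C , α , β) × ((α ≡ ty C u × β ≡ ty C v) ⊎ (α ≡ ty C v × β ≡ ty C u))
      dominant-types (A , α , β) (A⊆u , tu) (A⊆v , tv) le = conclude α β A≡C le tu tv
        where
        A⊆C : A ⊆ C
        A⊆C x∈ = x∈p∩q⁺ (A⊆u x∈ , A⊆v x∈)
        A≡C : A ≡ C
        A≡C = ⊆⇒≡ A⊆C (lex-digit {a = key π C} {key π A}
          (≤-antisym (hiddenRank-key {C} {ty C u} {ty C v} {A} {α} {β} le) (key-mono π A⊆C))
          (hiddenRank-≤ {C} {ty C u} {ty C v} {A} {α} {β} le))
        types : ∀ {α β} → equalBit (ty C u) (ty C v) ≤ equalBit α β →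
          (ty C u ≡ α ⊎ ty C u ≡ β) → (ty C v ≡ α ⊎ ty C v ≡ β) →
          (α ≡ ty C u × β ≡ ty C v) ⊎ (α ≡ ty C v × β ≡ ty C u)
        types _  (inj₁ a) (inj₂ b) = inj₁ (sym a , sym b)
        types _  (inj₂ a) (inj₁ b) = inj₂ (sym b , sym a)
        -- Both types match the same slot and hence coincide, so the pair `(C , ty C u , ty C v)`
        -- has last bit 1 and forces `α ≡ β`.
        types le (inj₁ a) (inj₁ b) = inj₁ (sym a , trans (sym (equalBit-≤ le (trans a (sym b)))) (sym b))
        types le (inj₂ a) (inj₂ b) = inj₁ (trans (equalBit-≤ le (trans a (sym b))) (sym a) , sym b)
        conclude : ∀ {A} α β → A ≡ C → hiddenRank (C , ty C u , ty C v) ≤ hiddenRank (A , α , β) →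
          (ty A u ≡ α ⊎ ty A u ≡ β) → (ty A v ≡ α ⊎ ty A v ≡ β) →
          ∃[ α' ] ∃[ β' ] (A , α , β) ≡ (C , α' , β') ×
                          ((α' ≡ ty C u × β' ≡ ty C v) ⊎ (α' ≡ ty C v × β' ≡ ty C u))
        conclude α β refl le tu tv =
          α , β , refl , types (lex-digit {a = key π C * suc n + ∣ C ∣} refl le) tu tv

      dominant-label : ∀ h → Attached u h → Attached v h →
        hiddenRank (C , ty C u , ty C v) ≤ hiddenRank h → labelOf (inj₂ h) ≡ adj H u v
      dominant-label h au av le = from h (dominant-types h au av le)
        where
        label-of-pair : labelOf (inj₂ (C , ty C u , ty C v)) ≡ adj H u v
        label-of-pair = bool-ext (proj₁ witness⇔edge ∘ ⌊⌋⁻ (witness? (C , ty C u , ty C v)))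
                                 (⌊⌋⁺ (witness? (C , ty C u , ty C v)) ∘ proj₂ witness⇔edge)
        label-swap : ∀ A α β → labelOf (inj₂ (A , α , β)) ≡ labelOf (inj₂ (A , β , α))
        label-swap A α β = ⌊⌋-cong (witness? (A , α , β)) (witness? (A , β , α)) witness-swap witness-swap
        from : ∀ h → (∃[ α ] ∃[ β ] h ≡ (C , α , β) ×
                       ((α ≡ ty C u × β ≡ ty C v) ⊎ (α ≡ ty C v × β ≡ ty C u))) → labelOf (inj₂ h) ≡ adj H u v
        from h (α , β , e , inj₁ (e₁ , e₂)) =
          trans (cong (labelOf ∘ inj₂) (trans e (cong₂ (λ x y → C , x , y) e₁ e₂))) label-of-pair
        from h (α , β , e , inj₂ (e₁ , e₂)) =
          trans (cong (labelOf ∘ inj₂) (trans e (cong₂ (λ x y → C , x , y) e₁ e₂)))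
            (trans (label-swap C (ty C v) (ty C u)) label-of-pair)

    vertexOf : ∀ x → ∃[ v ] at v ≡ x
    vertexOf x = vertex (complete x)

    embed : V H → V L
    embed t = proj₁ (vertexOf (inj₁ t))

    at-embed : ∀ t → at (embed t) ≡ inj₁ t
    at-embed t = proj₂ (vertexOf (inj₁ t))

    neighbour⁺ : ∀ {t h v} → at v ≡ inj₂ h → Attached t h → adj L (embed t) v ≡ true
    neighbour⁺ {t} {h} ev a = subst₂ (λ x y → incident x y ≡ true) (sym (at-embed t)) (sym ev)
      (⌊⌋⁺ (attached? t h) a)

    neighbour⁻ : ∀ {t v} → adj L (embed t) v ≡ true → ∃[ h ] at v ≡ inj₂ h × Attached t h
    neighbour⁻ {t} {v} e = hidden (at v) refl (subst (λ x → incident x (at v) ≡ true) (at-embed t) e)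
      where
      hidden : ∀ x → at v ≡ x → incident (inj₁ t) x ≡ true → ∃[ h ] at v ≡ inj₂ h × Attached t h
      hidden (inj₂ h) ev e = h , ev , ⌊⌋⁻ (attached? t h) e

    pairOf : V H → V H → Hidden
    pairOf u v = R u ∩ R v , ty (R u ∩ R v) u , ty (R u ∩ R v) v

    meet : ∀ u v → ∃[ h ] adj L (embed u) h ≡ true × adj L (embed v) h ≡ true × at h ≡ inj₂ (pairOf u v)
    meet u v = h , neighbour⁺ {u} {pairOf u v} e (p∩q⊆p (R u) (R v) , inj₁ refl) ,
                   neighbour⁺ {v} {pairOf u v} e (p∩q⊆q (R u) (R v) , inj₂ refl) , e
      where
      h = proj₁ (vertexOf (inj₂ (pairOf u v)))
      e = proj₂ (vertexOf (inj₂ (pairOf u v)))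

    order : V L → ℕ
    order = byRank (rankOf ∘ at)

    Common : V H → V H → V L → Set
    Common u v h = adj L (embed u) h ≡ true × adj L (embed v) h ≡ true

    common? : ∀ u v h → Dec (Common u v h)
    common? u v h = (adj L (embed u) h ≟ᵇ true) ×-dec (adj L (embed v) h ≟ᵇ true)

    dominant-exists : ∀ u v → ∃[ h ] Dominant L order (embed u) (embed v) h
    dominant-exists u v =
      let h₀ , a , b , _ = meet u v
          h , ab , max = argmax order (common? u v) (a , b)
      in h , proj₁ ab , proj₂ ab , λ h' a' b' → max h' (a' , b')

    dominant-labelled : ∀ {u v h} → u ≢ v → Dominant L order (embed u) (embed v) h →
      labelOf (at h) ≡ adj H u v
    dominant-labelled {u} {v} {h} u≢v (a , b , max) =
      trans (cong labelOf ex) (dominant-label u≢v x att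
        (subst (Attached v) (inj₂-injective (trans (sym ey) ex)) att')
        (subst₂ (λ y z → rankOf y ≤ rankOf z) e₀ ex (byRank-≤ (rankOf ∘ at) (max h₀ a₀ b₀))))
      where
      h₀   = proj₁ (meet u v)
      a₀   = proj₁ (proj₂ (meet u v))
      b₀   = proj₁ (proj₂ (proj₂ (meet u v)))
      e₀   = proj₂ (proj₂ (proj₂ (meet u v)))
      x    = proj₁ (neighbour⁻ {u} {h} a)
      ex   = proj₁ (proj₂ (neighbour⁻ {u} {h} a))
      att  = proj₂ (proj₂ (neighbour⁻ {u} {h} a))
      ey   = proj₁ (proj₂ (neighbour⁻ {v} {h} b))
      att' = proj₂ (proj₂ (neighbour⁻ {v} {h} b))
      inj₂-injective : ∀ {y z} → inj₂ {A = V H} y ≡ inj₂ z → y ≡ z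
      inj₂-injective refl = refl

    target-vertex : ∀ x → sideOf (at x) ≡ tgt → ∃[ t ] embed t ≡ x
    target-vertex x s = find-target (at x) refl s
      where
      find-target : ∀ y → at x ≡ y → sideOf y ≡ tgt → ∃[ t ] embed t ≡ x
      find-target (inj₁ t) e _ = t , lookup-injective unique (trans (at-embed t) (sym e))

    embed-injective : Injective _≡_ _≡_ embed
    embed-injective {u} {v} e = inj₁-injective (trans (sym (at-embed u)) (trans (cong at e) (at-embed v)))
      where
      inj₁-injective : ∀ {t t'} → inj₁ {B = Hidden} t ≡ inj₁ t' → t ≡ t'
      inj₁-injective refl = refl

    edge⇔dominant : ∀ u v → u ≢ v →
      (adj H u v ≡ true ⇔ (∃[ h ] Dominant L order (embed u) (embed v) h × labelOf (at h) ≡ true))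
    edge⇔dominant u v u≢v = mk⇔ to from
      where
      to : adj H u v ≡ true → ∃[ h ] Dominant L order (embed u) (embed v) h × labelOf (at h) ≡ true
      to a = proj₁ (dominant-exists u v) , proj₂ (dominant-exists u v) ,
             trans (dominant-labelled u≢v (proj₂ (dominant-exists u v))) a
      from : (∃[ h ] Dominant L order (embed u) (embed v) h × labelOf (at h) ≡ true) → adj H u v ≡ true
      from (h , d , l) = trans (sym (dominant-labelled {u} {v} {h} u≢v d)) l

    incident-bipartite : ∀ x y → incident x y ≡ true → sideOf x ≢ sideOf y
    incident-bipartite (inj₁ _) (inj₂ _) _ ()
    incident-bipartite (inj₂ _) (inj₁ _) _ ()

    hid<tgt : ∀ x y → sideOf x ≡ hid → sideOf y ≡ tgt → rankOf x < rankOf y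
    hid<tgt (inj₂ h) (inj₁ _) _ _ = s≤s (hiddenRank≤top h)

    targets-meet : ∀ x y → sideOf (at x) ≡ tgt → sideOf (at y) ≡ tgt →
      ∃[ h ] adj L x h ≡ true × adj L y h ≡ true
    targets-meet x y sx sy =
      proj₁ uv ,
      subst (λ z → adj L z (proj₁ uv) ≡ true) (proj₂ (target-vertex x sx)) (proj₁ (proj₂ uv)) ,
      subst (λ z → adj L z (proj₁ uv) ≡ true) (proj₂ (target-vertex y sy)) (proj₁ (proj₂ (proj₂ uv)))
      where uv = meet (proj₁ (target-vertex x sx)) (proj₁ (target-vertex y sy))

    targets : TargetEmbedding H L (sideOf ∘ at)
    targets = record
      { emb      = embed
      ; emb-inj  = embed-injective
      ; emb-tgt  = λ u → cong sideOf (at-embed u)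
      ; emb-onto = target-vertex
      }

    lacon : Lacon H
    lacon = record
      { L         = L
      ; side      = sideOf ∘ at
      ; bip       = λ x y → incident-bipartite (at x) (at y)
      ; label     = labelOf ∘ at
      ; π         = order
      ; π-order   = byRank-injective (rankOf ∘ at)
      ; π-hid<tgt = λ h t sh st → byRank-< (rankOf ∘ at) {h} {t} (hid<tgt (at h) (at t) sh st)
      ; common    = targets-meet
      ; target    = targets
      ; edges     = edge⇔dominant
      }

    lacon-col : ∀ s → ColLE L order s (overBound F (1 + NN * NN) s)
    lacon-col = over-col system over

cond1⇒cond2 : ∀ 𝒢 → Cond1 𝒢 → Cond2 𝒢
cond1⇒cond2 𝒢 (𝒢' , (f , be) , τ , incl) = (λ s → overBound F (1 + NN * NN) s) , decompose
  where
  open FromTransduction τ f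
  decompose : ∀ H → 𝒢 H → Σ (Lacon H) λ D → ∀ r → ColLE (Lacon.L D) (Lacon.π D) r (overBound F (1 + NN * NN) r)
  decompose H H∈ with incl H H∈
  ... | G , G∈ , c , out with be G G∈
  ...   | π , inj , col = lacon π inj col c out , lacon-col π inj col c out

-- From lacon-decompositions to set systems

record NormalForm (G : Graph) (F : ℕ → ℕ) : Set where
  field
    n      : ℕ
    R      : V G → Subset n
    π      : Fin n → ℕ
    system : System R π F
    label  : Subset n → Bool
    edge   : ∀ u v → u ≢ v → adj G u v ≡ label (R u ∩ R v)

module FromLacon {G : Graph} (D : Lacon G) (f : ℕ → ℕ)
                 (col : ∀ r → ColLE (Lacon.L D) (Lacon.π D) r (f r)) where
  open Lacon D renaming (label to isOne)
  open TargetEmbedding target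

  -- Neighbours of a target precede it and so are 1-reachable from it, which gives `f 1`. A hop
  -- takes two edges through a target, and targets lie above all hidden vertices, so `k` hops
  -- witness strong reachability within `k + k`.
  F : ℕ → ℕ
  F k = f 1 + f (k + k)

  neighbour? : ∀ t h → Dec (adj L (emb t) h ≡ true)
  neighbour? t h = adj L (emb t) h ≟ᵇ true

  N : V G → Subset (size L)
  N t = ⟦ neighbour? t ⟧

  neighbour-below : ∀ {t h} → adj L (emb t) h ≡ true → π h < π (emb t)
  neighbour-below {t} {h} a = π-hid<tgt h (emb t) (hidden (side h) refl) (emb-tgt t)
    where
    hidden : ∀ s → side h ≡ s → side h ≡ hid
    hidden hid e = e
    hidden tgt e = contradiction (trans (emb-tgt t) (sym e)) (bip (emb t) h a)

  chain⇒within : ∀ {c k y u} → Chain N π c k y u → Within L (λ w → w ≡ u ⊎ c ≤ π w) (k + k) y u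
  chain⇒within done = stop (inj₁ refl)
  chain⇒within {c} {suc k} {y} {u} (hop {y' = y'} {t = t} c≤y y∈ y'∈ ch) =
    subst (λ l → Within L (λ w → w ≡ u ⊎ c ≤ π w) (suc l) y u) (sym (+-suc k k))
      (move (inj₂ c≤y) (trans (Graph.sym L y (emb t)) yt)
        (move (inj₂ (≤-trans c≤y (<⇒≤ (neighbour-below {t} yt)))) (∈⟦⟧⁻ (neighbour? t) y'∈) (chain⇒within ch)))
    where yt = ∈⟦⟧⁻ (neighbour? t) y∈

  system : System N π F
  system = record
    { π-injective = π-order
    ; degree≤     = λ t → ≤-trans
        (cover⇒∣∣≤ (cover-mono (λ h h∈ → let a = ∈⟦⟧⁻ (neighbour? t) h∈ in
            <⇒≤ (neighbour-below {t} a) , move (inj₂ ≤-refl) a (stop (inj₁ refl)))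
          (sreach-cover {L} π (col 1) (emb t))))
        (m≤m+n (f 1) _)
    ; chains      = λ k y → cover-≤ (m≤n+m _ (f 1))
        (cover-mono (λ u → λ { (le , ch) → le , chain⇒within ch }) (sreach-cover {L} π (col (k + k)) y))
    }

  DominantIn : Subset (size L) → V L → Set
  DominantIn C h = h ∈ˢ C × isOne h ≡ true × (∀ h' → h' ∈ˢ C → π h' ≤ π h)

  dominantIn? : ∀ C h → Dec (DominantIn C h)
  dominantIn? C h = (h ∈? C) ×-dec (isOne h ≟ᵇ true) ×-dec all? (λ h' → (h' ∈? C) →-dec (π h' ≤? π h))

  labelOf : Subset (size L) → Bool
  labelOf C = ⌊ any? (dominantIn? C) ⌋

  edge : ∀ u v → u ≢ v → adj G u v ≡ labelOf (N u ∩ N v)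
  edge u v u≢v = bool-ext
    (⌊⌋⁺ (any? (dominantIn? C)) ∘ to ∘ Equivalence.to (edges u v u≢v))
    (Equivalence.from (edges u v u≢v) ∘ from ∘ ⌊⌋⁻ (any? (dominantIn? C)))
    where
    C = N u ∩ N v
    both⁺ : ∀ {h} → adj L (emb u) h ≡ true → adj L (emb v) h ≡ true → h ∈ˢ C
    both⁺ a b = x∈p∩q⁺ (∈⟦⟧⁺ (neighbour? u) a , ∈⟦⟧⁺ (neighbour? v) b)
    both⁻ : ∀ {h} → h ∈ˢ C → adj L (emb u) h ≡ true × adj L (emb v) h ≡ true
    both⁻ m = ∈⟦⟧⁻ (neighbour? u) (proj₁ (x∈p∩q⁻ (N u) (N v) m)) ,
              ∈⟦⟧⁻ (neighbour? v) (proj₂ (x∈p∩q⁻ (N u) (N v) m))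
    to : (∃[ h ] Dominant L π (emb u) (emb v) h × isOne h ≡ true) → ∃[ h ] DominantIn C h
    to (h , (a , b , max) , l) =
      h , both⁺ a b , l , λ h' m → max h' (proj₁ (both⁻ m)) (proj₂ (both⁻ m))
    from : (∃[ h ] DominantIn C h) → ∃[ h ] Dominant L π (emb u) (emb v) h × isOne h ≡ true
    from (h , m , l , max) =
      h , (proj₁ (both⁻ m) , proj₂ (both⁻ m) , λ h' a b → max h' (both⁺ a b)) , l

  normalForm : NormalForm G F
  normalForm = record
    { n = size L ; R = N ; π = π ; system = system ; label = labelOf ; edge = edge }

cond2⇒normalForm : ∀ 𝒢 → Cond2 𝒢 → Σ (ℕ → ℕ) λ F → ∀ G → 𝒢 G → NormalForm G F
cond2⇒normalForm 𝒢 (f , dec) =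
  (λ k → f 1 + f (k + k)) , λ G G∈ → FromLacon.normalForm (proj₁ (dec G G∈)) f (proj₂ (dec G G∈))

-- The largest class with the given bounds; as the class required in (3) and (4) it leaves only the
-- bounds to be checked.
ColBounded : (ℕ → ℕ) → Class
ColBounded b G = Σ (V G → ℕ) λ π → IsOrder G π × (∀ r → ColLE G π r (b r))

colBounded-expansion : ∀ b → BoundedExpansion (ColBounded b)
colBounded-expansion b = b , λ _ bounded → bounded

-- From set systems to parity-decompositions

parity : {A : Set} → (A → Bool) → List A → Bool
parity p []       = false
parity p (x ∷ xs) = p x xor parity p xs

xor-assoc : ∀ a b c → (a xor b) xor c ≡ a xor (b xor c)
xor-assoc false b c = refl
xor-assoc true  false c = refl
xor-assoc true  true  c = sym (Data.Bool.Properties.not-involutive c)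

xor-cancel : ∀ a b → a xor (a xor b) ≡ b
xor-cancel false b = refl
xor-cancel true  b = Data.Bool.Properties.not-involutive b

parity-++ : {A : Set} (p : A → Bool) (xs ys : List A) → parity p (xs ++ ys) ≡ parity p xs xor parity p ys
parity-++ p []       ys = refl
parity-++ p (x ∷ xs) ys =
  trans (cong (p x xor_) (parity-++ p xs ys)) (sym (xor-assoc (p x) (parity p xs) (parity p ys)))

parity-map : {A B : Set} (p : B → Bool) (g : A → B) (xs : List A) → parity p (map g xs) ≡ parity (p ∘ g) xs
parity-map p g []       = refl
parity-map p g (x ∷ xs) = cong (p (g x) xor_) (parity-map p g xs)

parity-cong : {A : Set} {p q : A → Bool} → p ≗ q → ∀ xs → parity p xs ≡ parity q xs
parity-cong e []       = refl
parity-cong e (x ∷ xs) = cong₂ _xor_ (e x) (parity-cong e xs)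

parity-false : {A : Set} (xs : List A) → parity (λ _ → false) xs ≡ false
parity-false []       = refl
parity-false (x ∷ xs) = parity-false xs

-- The sum in 𝔽₂ of `l B` over all `B ⊆ A`, evaluated one coordinate at a time; the signs of the
-- usual Möbius function vanish.
möbius : ∀ {n} → (Subset n → Bool) → Subset n → Bool
möbius l []          = l []
möbius l (false ∷ A) = möbius (λ B → l (false ∷ B)) A
möbius l (true  ∷ A) = möbius (λ B → l (false ∷ B) xor l (true ∷ B)) A

⊆?-same : ∀ {n} b (A C : Subset n) → ⌊ (b ∷ A) ⊆? (b ∷ C) ⌋ ≡ ⌊ A ⊆? C ⌋
⊆?-same b A C = ⌊⌋-cong ((b ∷ A) ⊆? (b ∷ C)) (A ⊆? C) (λ s {x} → drop-∷-⊆ s {x}) (λ s {x} → s⊆s s {x})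

⊆?-out : ∀ {n} (A C : Subset n) → ⌊ (false ∷ A) ⊆? (true ∷ C) ⌋ ≡ ⌊ A ⊆? C ⌋
⊆?-out A C = ⌊⌋-cong ((false ∷ A) ⊆? (true ∷ C)) (A ⊆? C) (λ s {x} → drop-∷-⊆ s {x}) (λ s {x} → out⊆ s {x})

⊆?-in : ∀ {n} (A C : Subset n) → ⌊ (true ∷ A) ⊆? (false ∷ C) ⌋ ≡ false
⊆?-in A C = ⌊⌋-no ((true ∷ A) ⊆? (false ∷ C)) λ s → absurd (s Data.Vec.here)
  where
  absurd : ∀ {n} {C : Subset n} → ¬ (Fin.zero ∈ˢ (false ∷ C))
  absurd ()

-- Split on the first coordinate. If `C` lacks it, only sets without it count. If `C` has it, the
-- two halves contribute `l (false ∷ C)` and `l (false ∷ C) xor l (true ∷ C)`, which add up to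
-- `l (true ∷ C)`.
möbius-inversion : ∀ {n} (l : Subset n → Bool) (C : Subset n) →
  parity (λ A → möbius l A ∧ ⌊ A ⊆? C ⌋) (powerset n) ≡ l C
möbius-inversion {zero}  l []      with l []
... | true  = refl
... | false = refl
möbius-inversion {suc n} l (c ∷ C) = trans (parity-++ p (map (false ∷_) (powerset n)) (map (true ∷_) (powerset n)))
  (trans (cong₂ _xor_ (parity-map p (false ∷_) (powerset n)) (parity-map p (true ∷_) (powerset n))) (halves c))
  where
  p : Subset (suc n) → Bool
  p A = möbius l A ∧ ⌊ A ⊆? (c ∷ C) ⌋
  half : ∀ c → Bool → Bool
  half c b = parity (λ A → möbius l (b ∷ A) ∧ ⌊ (b ∷ A) ⊆? (c ∷ C) ⌋) (powerset n)
  halves : ∀ c → half c false xor half c true ≡ l (c ∷ C)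
  halves false = trans (cong₂ _xor_
    (trans (parity-cong (λ A → cong (möbius l (false ∷ A) ∧_) (⊆?-same false A C)) (powerset n))
           (möbius-inversion (λ B → l (false ∷ B)) C))
    (trans (parity-cong (λ A → trans (cong (möbius l (true ∷ A) ∧_) (⊆?-in A C))
                                     (Data.Bool.Properties.∧-zeroʳ (möbius l (true ∷ A)))) (powerset n))
           (parity-false (powerset n))))
    (Data.Bool.Properties.xor-identityʳ (l (false ∷ C)))
  halves true = trans (cong₂ _xor_
    (trans (parity-cong (λ A → cong (möbius l (false ∷ A) ∧_) (⊆?-out A C)) (powerset n))
           (möbius-inversion (λ B → l (false ∷ B)) C))
    (trans (parity-cong (λ A → cong (möbius l (true ∷ A) ∧_) (⊆?-same true A C)) (powerset n))
           (möbius-inversion (λ B → l (false ∷ B) xor l (true ∷ B)) C)))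
    (xor-cancel (l (false ∷ C)) (l (true ∷ C)))

odd : ℕ → Bool
odd zero    = false
odd (suc n) = not (odd n)

odd⇔%2 : ∀ n → odd n ≡ true ⇔ n % 2 ≡ 1
odd⇔%2 n = mk⇔ (to n) (from n)
  where
  to : ∀ n → odd n ≡ true → n % 2 ≡ 1
  to (suc zero)    _ = refl
  to (suc (suc n)) e = to n (trans (sym (Data.Bool.Properties.not-involutive (odd n))) e)
  from : ∀ n → n % 2 ≡ 1 → odd n ≡ true
  from (suc zero)    _ = refl
  from (suc (suc n)) e = trans (Data.Bool.Properties.not-involutive (odd n)) (from n e)

odd-count : {A : Set} (p : A → Bool) (xs : List A) → odd (count (p ∘ lookup xs)) ≡ parity p xs
odd-count p []       = refl
odd-count p (x ∷ xs) with p x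
... | true  = cong not (odd-count p xs)
... | false = odd-count p xs

count≡∣∣ : ∀ {n} (p : Fin n → Bool) → count p ≡ ∣ tabulate p ∣
count≡∣∣ {zero}  p = refl
count≡∣∣ {suc n} p with p fz
... | true  = cong suc (count≡∣∣ (p ∘ fs))
... | false = count≡∣∣ (p ∘ fs)

cover⇒count≤ : ∀ {n k} (p : Fin n → Bool) → Cover (λ i → p i ≡ true) k → count p ≤ k
cover⇒count≤ p c = ≤-trans (≤-reflexive (count≡∣∣ p))
  (cover⇒∣∣≤ {A = tabulate p} (cover-mono (λ i m → trans (sym (lookup∘tabulate p i)) ([]=⇒lookup m)) c))

module ToParity {G : Graph} {F : ℕ → ℕ} (nf : NormalForm G F) where
  open NormalForm nf

  g : Subset n → Bool
  g = möbius label

  enum : Enumeration (V G ⊎ Subset n)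
  enum = enum⊎ (enumFin (size G)) (enumSubset n)
  open Enumeration enum using (list; unique; complete)

  incident : V G ⊎ Subset n → V G ⊎ Subset n → Bool
  incident (inj₁ t) (inj₂ A) = g A ∧ ⌊ A ⊆? R t ⌋
  incident (inj₂ A) (inj₁ t) = g A ∧ ⌊ A ⊆? R t ⌋
  incident (inj₁ _) (inj₁ _) = false
  incident (inj₂ _) (inj₂ _) = false

  incident-sym : ∀ x y → incident x y ≡ incident y x
  incident-sym (inj₁ _) (inj₁ _) = refl
  incident-sym (inj₁ _) (inj₂ _) = refl
  incident-sym (inj₂ _) (inj₁ _) = refl
  incident-sym (inj₂ _) (inj₂ _) = refl

  incident-irrefl : ∀ x → incident x x ≡ false
  incident-irrefl (inj₁ _) = refl
  incident-irrefl (inj₂ _) = refl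

  P : Graph
  P = graphOn list incident incident-sym incident-irrefl

  at : V P → V G ⊎ Subset n
  at = lookup list

  incident-link : ∀ x y → incident x y ≡ true → Link R x y
  incident-link (inj₁ t) (inj₂ A) e = down (⌊⌋⁻ (A ⊆? R t) (proj₂ (∧-true⁻ {g A} e)))
  incident-link (inj₂ A) (inj₁ t) e = up (⌊⌋⁻ (A ⊆? R t) (proj₂ (∧-true⁻ {g A} e)))

  rankOf : V P → ℕ
  rankOf = ownerKey π ∘ at

  over : Over R π P 1
  over = record
    { owner  = at
    ; links  = λ {x} {y} → incident-link (at x) (at y)
    ; fibres = λ o → cover-lookup unique (λ x → Enumeration.equal? enum x o)
        (o ∷ [] , ≤-refl , λ { _ refl → here refl })
    ; σ      = byRank rankOf
    ; σ-key  = byRank-≤ rankOf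
    }

  vertexOf : ∀ x → ∃[ v ] at v ≡ x
  vertexOf x = vertex (complete x)

  embed : V G → V P
  embed t = proj₁ (vertexOf (inj₁ t))

  at-embed : ∀ t → at (embed t) ≡ inj₁ t
  at-embed t = proj₂ (vertexOf (inj₁ t))

  sideOf : V G ⊎ Subset n → Side
  sideOf (inj₁ _) = tgt
  sideOf (inj₂ _) = hid

  incident-bipartite : ∀ x y → incident x y ≡ true → sideOf x ≢ sideOf y
  incident-bipartite (inj₁ _) (inj₂ _) _ ()
  incident-bipartite (inj₂ _) (inj₁ _) _ ()

  target-degree : ∀ x → sideOf (at x) ≡ tgt → degree P x ≤ 2 ^ F 0
  target-degree x s = bound (at x) s
    where
    bound : ∀ y → sideOf y ≡ tgt → count (λ v → incident y (at v)) ≤ 2 ^ F 0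
    bound (inj₁ t) _ = cover⇒count≤ _ (cover-lookup unique (λ z → incident (inj₁ t) z ≟ᵇ true)
      (cover-image inj₂ (λ { (inj₁ _) () ; (inj₂ A) e → A , (λ {x} → ⌊⌋⁻ (A ⊆? R t) (proj₂ (∧-true⁻ {g A} e)) {x}) , refl })
        (cover-⊆ (R t) (System.degree≤ system t))))

  common : V G → V G → V G ⊎ Subset n → Bool
  common u v x = incident (inj₁ u) x ∧ incident (inj₁ v) x

  common-parity : ∀ u v → parity (common u v) list ≡ label (R u ∩ R v)
  common-parity u v = trans (parity-++ (common u v) (map inj₁ (allFin (size G))) (map inj₂ (powerset n)))
    (trans (cong₂ _xor_
      (trans (parity-map (common u v) inj₁ (allFin (size G))) (parity-false (allFin (size G))))
      (trans (parity-map (common u v) inj₂ (powerset n)) (parity-cong hidden (powerset n))))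
    (möbius-inversion label (R u ∩ R v)))
    where
    hidden : ∀ A → common u v (inj₂ A) ≡ g A ∧ ⌊ A ⊆? (R u ∩ R v) ⌋
    hidden A with g A
    ... | false = refl
    ... | true  = bool-ext
      (λ e → ⌊⌋⁺ (A ⊆? (R u ∩ R v)) λ m →
        x∈p∩q⁺ (⌊⌋⁻ (A ⊆? R u) (proj₁ (∧-true⁻ e)) m , ⌊⌋⁻ (A ⊆? R v) (proj₂ (∧-true⁻ {⌊ A ⊆? R u ⌋} e)) m))
      (λ e → ∧-true⁺
        (⌊⌋⁺ (A ⊆? R u) λ m → proj₁ (x∈p∩q⁻ (R u) (R v) (⌊⌋⁻ (A ⊆? (R u ∩ R v)) e m)))
        (⌊⌋⁺ (A ⊆? R v) λ m → proj₂ (x∈p∩q⁻ (R u) (R v) (⌊⌋⁻ (A ⊆? (R u ∩ R v)) e m))))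

  odd-common : ∀ u v → odd (commonCount P (embed u) (embed v)) ≡ label (R u ∩ R v)
  odd-common u v = trans
    (cong₂ (λ x y → odd (count (λ w → incident x (at w) ∧ incident y (at w)))) (at-embed u) (at-embed v))
    (trans (odd-count (common u v) list) (common-parity u v))

  target-vertex : ∀ x → sideOf (at x) ≡ tgt → ∃[ t ] embed t ≡ x
  target-vertex x s = find-target (at x) refl s
    where
    find-target : ∀ y → at x ≡ y → sideOf y ≡ tgt → ∃[ t ] embed t ≡ x
    find-target (inj₁ t) e _ = t , lookup-injective unique (trans (at-embed t) (sym e))

  embed-injective : Injective _≡_ _≡_ embed
  embed-injective {u} {v} e = inj₁-injective (trans (sym (at-embed u)) (trans (cong at e) (at-embed v)))
    where
    inj₁-injective : ∀ {t t'} → inj₁ {B = Subset n} t ≡ inj₁ t' → t ≡ t'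
    inj₁-injective refl = refl

  edge⇔odd : ∀ u v → u ≢ v → (adj G u v ≡ true ⇔ commonCount P (embed u) (embed v) % 2 ≡ 1)
  edge⇔odd u v u≢v = mk⇔
    (λ a → Equivalence.to (odd⇔%2 (commonCount P (embed u) (embed v))) (trans (odd-common u v) (trans (sym (edge u v u≢v)) a)))
    (λ o → trans (edge u v u≢v) (trans (sym (odd-common u v)) (Equivalence.from (odd⇔%2 (commonCount P (embed u) (embed v))) o)))

  parityDecomposition : Parity (2 ^ F 0) G
  parityDecomposition = record
    { P      = P
    ; side   = sideOf ∘ at
    ; bip    = λ x y → incident-bipartite (at x) (at y)
    ; deg    = target-degree
    ; target = record
      { emb      = embed
      ; emb-inj  = embed-injective
      ; emb-tgt  = λ u → cong sideOf (at-embed u)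
      ; emb-onto = target-vertex
      }
    ; edges  = edge⇔odd
    }

  bounded : ColBounded (overBound F 1) P
  bounded = byRank rankOf , byRank-injective rankOf , over-col system over

cond2⇒cond4 : ∀ 𝒢 → Cond2 𝒢 → Cond4 𝒢
cond2⇒cond4 𝒢 c₂ =
  2 ^ F 0 , ColBounded (overBound F 1) , colBounded-expansion (overBound F 1) ,
  λ G G∈ → ToParity.parityDecomposition (nf G G∈) , ToParity.bounded (nf G G∈)
  where
  F  = proj₁ (cond2⇒normalForm 𝒢 c₂)
  nf = proj₂ (cond2⇒normalForm 𝒢 c₂)

-- From set systems to shrub-decompositions

enumBool : Enumeration Bool
enumBool = record
  { list     = false ∷ true ∷ []
  ; unique   = ((λ ()) ∷ []) ∷ ([] ∷ [])
  ; complete = λ { false → here refl ; true → there (here refl) }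
  ; equal?   = _≟ᵇ_
  }

multipleOf4 : ℕ → Bool
multipleOf4 0 = true
multipleOf4 1 = false
multipleOf4 2 = false
multipleOf4 3 = false
multipleOf4 (suc (suc (suc (suc l)))) = multipleOf4 l

multipleOf4-+ : ∀ a b → multipleOf4 (a * 4 + b) ≡ multipleOf4 b
multipleOf4-+ zero    b = refl
multipleOf4-+ (suc a) b = multipleOf4-+ a b

indicator : Bool → ℕ
indicator b = if b then 1 else 0

indicator≤1 : ∀ b → indicator b ≤ 1
indicator≤1 true  = ≤-refl
indicator≤1 false = z≤n

multipleOf4-indicator : ∀ b → multipleOf4 (2 * indicator (not b)) ≡ b
multipleOf4-indicator true  = refl
multipleOf4-indicator false = refl

module Spans (K : ℕ) where
  open Data.Nat.Solver.+-*-Solver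

  -- `2 * base` exceeds `maxSpan`, so a detour over a third star, which uses four paths, is longer
  -- than any direct route of two.
  base maxSpan cap : ℕ
  base    = 2 * K + 2
  maxSpan = base + (2 * K + 1)
  cap     = 6 * K + 6

  -- Each further element lowers the span by 2, which leaves the last bit free for the label: the
  -- leaves end up at distance `2 * spanOf a b + 4`, a multiple of 4 exactly when `b` is true.
  spanOf : ℕ → Bool → ℕ
  spanOf a b = base + (2 * (K ∸ a) + indicator (not b))

  base≤spanOf : ∀ a b → base ≤ spanOf a b
  base≤spanOf a b = m≤m+n base _

  spanOf≤max : ∀ a b → spanOf a b ≤ maxSpan
  spanOf≤max a b = +-monoʳ-≤ base (+-mono-≤ (*-monoʳ-≤ 2 (m∸n≤m K a)) (indicator≤1 (not b)))

  spanOf-< : ∀ {a c} b b' → a < c → c ≤ K → spanOf c b' ≤ spanOf a b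
  spanOf-< {a} {c} b b' a<c c≤K = +-monoʳ-≤ base (begin
    2 * (K ∸ c) + indicator (not b')  ≤⟨ +-monoʳ-≤ (2 * (K ∸ c)) (≤-trans (indicator≤1 (not b')) (s≤s (z≤n {1}))) ⟩
    2 * (K ∸ c) + 2                   ≡⟨ solve 1 (λ x → con 2 :* x :+ con 2 := con 2 :* (con 1 :+ x)) refl (K ∸ c) ⟩
    2 * suc (K ∸ c)                   ≤⟨ *-monoʳ-≤ 2 (∸-monoʳ-< a<c c≤K) ⟩
    2 * (K ∸ a)                       ≤⟨ m≤m+n (2 * (K ∸ a)) _ ⟩
    2 * (K ∸ a) + indicator (not b)   ∎)
    where open ≤-Reasoning

  distance-label : ∀ a b → multipleOf4 (2 * spanOf a b + 4) ≡ b
  distance-label a b = trans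
    (cong multipleOf4 (solve 3 (λ k x z →
        con 2 :* ((con 2 :* k :+ con 2) :+ (con 2 :* x :+ z)) :+ con 4 := (k :+ x :+ con 2) :* con 4 :+ con 2 :* z)
      refl K (K ∸ a) (indicator (not b))))
    (trans (multipleOf4-+ (K + (K ∸ a) + 2) _) (multipleOf4-indicator b))

  -- cap is large enough that leaving the neighbourhood of the source is never a short cut, and small
  -- enough to be reachable from every other star.
  cap-high : ∀ {c a} → c ≤ maxSpan → base ≤ a → 2 * c + 3 ≤ suc (cap + a)
  cap-high {c} {a} c≤ ≤a = begin
    2 * c + 3                ≤⟨ +-monoˡ-≤ 3 (*-monoʳ-≤ 2 c≤) ⟩
    2 * maxSpan + 3          ≡⟨ solve 1 (λ k → con 2 :* ((con 2 :* k :+ con 2) :+ (con 2 :* k :+ con 1)) :+ con 3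
                                  := con 1 :+ ((con 6 :* k :+ con 6) :+ (con 2 :* k :+ con 2))) refl K ⟩
    suc (cap + base)         ≤⟨ s≤s (+-monoʳ-≤ cap ≤a) ⟩
    suc (cap + a)            ∎
    where open ≤-Reasoning

  cap-low : ∀ {c a} → base ≤ c → base ≤ a → cap ≤ suc (2 * c + 3 + a)
  cap-low {c} {a} ≤c ≤a = begin
    cap                        ≤⟨ m≤m+n cap 4 ⟩
    cap + 4                    ≡⟨ solve 1 (λ k → (con 6 :* k :+ con 6) :+ con 4
                                    := con 1 :+ ((con 2 :* (con 2 :* k :+ con 2) :+ con 3) :+ (con 2 :* k :+ con 2)))
                                    refl K ⟩
    suc (2 * base + 3 + base)  ≤⟨ s≤s (+-mono-≤ (+-monoˡ-≤ 3 (*-monoʳ-≤ 2 ≤c)) ≤a) ⟩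
    suc (2 * c + 3 + a)        ∎
    where open ≤-Reasoning

  double : ∀ a → 2 * a + 3 ≡ suc (a + 2 + a)
  double = solve 1 (λ a → con 2 :* a :+ con 3 := con 1 :+ (a :+ con 2 :+ a)) refl

  reachBound : ℕ
  reachBound = suc maxSpan + suc maxSpan

  diameter : ℕ
  diameter = reachBound + reachBound

  signature : ℕ → Bool
  signature l = ⌊ 1 ≤? l ⌋ ∧ (⌊ l ≤? diameter ⌋ ∧ multipleOf4 l)

  signature-spanOf : ∀ a b → signature (2 * spanOf a b + 4) ≡ b
  signature-spanOf a b = trans
    (cong₂ (λ x y → x ∧ (y ∧ multipleOf4 (2 * spanOf a b + 4)))
      (⌊⌋⁺ (1 ≤? 2 * spanOf a b + 4) (≤-trans (s≤s z≤n) (m≤n+m 4 (2 * spanOf a b))))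
      (⌊⌋⁺ (2 * spanOf a b + 4 ≤? diameter) in-range))
    (distance-label a b)
    where
    in-range : 2 * spanOf a b + 4 ≤ diameter
    in-range = ≤-trans (+-monoˡ-≤ 4 (*-monoʳ-≤ 2 (spanOf≤max a b))) (≤-trans
      (≤-reflexive (solve 1 (λ m → con 2 :* m :+ con 4 := ((con 1 :+ m) :+ (con 1 :+ m)) :+ con 2) refl maxSpan))
      (+-monoʳ-≤ reachBound (s≤s (≤-trans (s≤s z≤n) (m≤n+m (suc maxSpan) maxSpan)))))

decideBy : {P Q : Set} → Dec P → (P → Q) → (Q → P) → Dec Q
decideBy d f g = map′ f g d

pattern leaf t       = inj₁ (inj₁ t)
pattern star t       = inj₁ (inj₂ t)
pattern link t A i b = inj₂ (inj₁ (t , A , i , b))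
pattern centre A     = inj₂ (inj₂ A)

-- Every target t has a leaf and a star vertex, and every set A ⊆ R t is joined to the star of t by two
-- parallel paths of span A inner vertices. The span decreases with the size of A, so a shortest path
-- between two leaves runs through the centre of R t ∩ R t'; doubling the paths keeps all vertices but
-- the leaves from having degree one.
module ToShrub {G : Graph} {F : ℕ → ℕ} (nf : NormalForm G F) where
  open NormalForm nf
  open System system using (degree≤)

  K : ℕ
  K = F 0

  open Spans K

  span : Subset n → ℕ
  span A = spanOf ∣ A ∣ (label A)

  span-mono : ∀ {A C} → A ⊆ C → ∣ C ∣ ≤ K → span C ≤ span A
  span-mono {A} {C} sub le with ∣ C ∣ ≤? ∣ A ∣
  ... | yes C≤A = ≤-reflexive (cong span (sym (⊆⇒≡ sub C≤A)))
  ... | no  C≰A = spanOf-< (label A) (label C) (≰⇒> C≰A) le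

  X : Set
  X = (V G ⊎ V G) ⊎ ((V G × Subset n × Fin maxSpan × Bool) ⊎ Subset n)

  enum : Enumeration X
  enum = enum⊎ (enum⊎ (enumFin (size G)) (enumFin (size G)))
    (enum⊎ (enum× (enumFin (size G)) (enum× (enumSubset n) (enum× (enumFin maxSpan) enumBool))) (enumSubset n))

  -- A centre seen by no target would be isolated and is left out. The centre of `∅` is always kept,
  -- as the hub to which every vertex is connected.
  Valid : X → Set
  Valid (leaf _)       = Data.Unit.⊤
  Valid (star _)       = Data.Unit.⊤
  Valid (link t A i _) = A ⊆ R t × toℕ i < span A
  Valid (centre A)     = A ≡ ∅ ⊎ (∃[ t ] A ⊆ R t)

  valid? : ∀ x → Dec (Valid x)
  valid? (leaf _)       = yes _
  valid? (star _)       = yes _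
  valid? (link t A i _) = (A ⊆? R t) ×-dec (toℕ i <? span A)
  valid? (centre A)     = (A ≟ˢ ∅) ⊎-dec any? (λ t → A ⊆? R t)

  data Edge : X → X → Set where
    tip   : ∀ {t} → Edge (leaf t) (star t)
    first : ∀ {t A i b} → A ⊆ R t → toℕ i ≡ 0 → Edge (star t) (link t A i b)
    next  : ∀ {t A i i' b} → suc (toℕ i) ≡ toℕ i' → Edge (link t A i b) (link t A i' b)
    last  : ∀ {t A i b} → A ⊆ R t → suc (toℕ i) ≡ span A → Edge (link t A i b) (centre A)

  edge? : ∀ x y → Dec (Edge x y)
  edge? (leaf t) (star t') = decideBy (t ≟ᶠ t') (λ { refl → tip }) (λ { tip → refl })
  edge? (star t) (link t' A i b) = decideBy
    ((t ≟ᶠ t') ×-dec (A ⊆? R t) ×-dec (toℕ i ≟ⁿ 0))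
    (λ { (refl , sub , e) → first sub e }) (λ { (first sub e) → refl , sub , e })
  edge? (link t A i b) (link t' A' i' b') = decideBy
    ((t ≟ᶠ t') ×-dec (A ≟ˢ A') ×-dec (b ≟ᵇ b') ×-dec (suc (toℕ i) ≟ⁿ toℕ i'))
    (λ { (refl , refl , refl , e) → next e }) (λ { (next e) → refl , refl , refl , e })
  edge? (link t A i b) (centre A') = decideBy
    ((A ≟ˢ A') ×-dec (A ⊆? R t) ×-dec (suc (toℕ i) ≟ⁿ span A))
    (λ { (refl , sub , e) → last sub e }) (λ { (last sub e) → refl , sub , e })
  edge? (leaf _) (leaf _)         = no λ ()
  edge? (leaf _) (inj₂ _)         = no λ { () }
  edge? (star _) (inj₁ _)         = no λ { () }
  edge? (star _) (centre _)       = no λ ()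
  edge? (link _ _ _ _) (inj₁ _)   = no λ { () }
  edge? (centre _) _              = no λ { () }

  incident : X → X → Bool
  incident x y = ⌊ edge? x y ⌋ ∨ ⌊ edge? y x ⌋

  incident⁻ : ∀ {x y} → incident x y ≡ true → Edge x y ⊎ Edge y x
  incident⁻ {x} {y} e = Data.Sum.map (⌊⌋⁻ (edge? x y)) (⌊⌋⁻ (edge? y x)) (∨-true⁻ e)

  forward : ∀ {x y} → Edge x y → incident x y ≡ true
  forward {x} {y} e = ∨-true⁺ˡ (⌊⌋⁺ (edge? x y) e)

  backward : ∀ {x y} → Edge x y → incident y x ≡ true
  backward {x} {y} e = ∨-true⁺ʳ {⌊ edge? y x ⌋} (⌊⌋⁺ (edge? x y) e)

  edge-irrefl : ∀ {x} → ¬ Edge x x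
  edge-irrefl (next e) = contradiction (≤-reflexive e) (<-irrefl refl)

  incident-irrefl : ∀ x → incident x x ≡ false
  incident-irrefl x = cong₂ _∨_ no-loop no-loop
    where no-loop = ⌊⌋-no (edge? x x) edge-irrefl

  list : List X
  list = filter valid? (Enumeration.list enum)

  unique : Unique list
  unique = filter⁺ valid? (Enumeration.unique enum)

  T : Graph
  T = graphOn list incident (λ x y → ∨-comm ⌊ edge? x y ⌋ ⌊ edge? y x ⌋) incident-irrefl

  at : V T → X
  at = lookup list

  at-valid : ∀ v → Valid (at v)
  at-valid v = proj₂ (∈-filter⁻ valid? {xs = Enumeration.list enum} (∈-lookup v))

  vertexOf : ∀ x → Valid x → ∃[ v ] at v ≡ x
  vertexOf x p = vertex (∈-filter⁺ valid? (Enumeration.complete enum x) p)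

  at-injective : ∀ {u v} → at u ≡ at v → u ≡ v
  at-injective = lookup-injective unique

  -- The inner vertices of a path are charged to the target: a set may lie in arbitrarily many
  -- `R t`, so charging them to the set would give unbounded fibres.
  owner : X → V G ⊎ Subset n
  owner (leaf t)       = inj₁ t
  owner (star t)       = inj₁ t
  owner (link t _ _ _) = inj₁ t
  owner (centre A)     = inj₂ A

  edge-link : ∀ {x y} → Edge x y → Link R (owner x) (owner y) × Link R (owner y) (owner x)
  edge-link tip          = stay , stay
  edge-link (first _ _)  = stay , stay
  edge-link (next _)     = stay , stay
  edge-link (last sub _) = down sub , up sub

  incident-link : ∀ {x y} → incident x y ≡ true → Link R (owner x) (owner y)
  incident-link {x} {y} e = [ proj₁ ∘ edge-link , proj₂ ∘ edge-link ]′ (incident⁻ {x} {y} e)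

  fibreSize : ℕ
  fibreSize = 2 + 2 ^ K * (maxSpan * 2)

  fibre : ∀ o → Cover (λ x → owner x ≡ o × Valid x) fibreSize
  fibre (inj₁ t) = cover-mono split
    (cover-⊎ {P = λ x → x ≡ leaf t ⊎ x ≡ star t}
      (leaf t ∷ star t ∷ [] , ≤-refl , λ { _ (inj₁ refl) → here refl ; _ (inj₂ refl) → there (here refl) })
      (cover-image {Q = OnLink} (λ { (A , i , b) → link t A i b })
        (λ { _ (A , i , b , sub , refl) → (A , i , b) , ((λ {x} → sub {x}) , i , b) , refl })
        (cover-× (cover-⊆ (R t) (degree≤ t))
          (cover-× {P = λ _ → Fin maxSpan} {Q = λ _ → Bool} (cover-Fin maxSpan)
            (false ∷ true ∷ [] , ≤-refl , λ { false _ → here refl ; true _ → there (here refl) })))))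
    where
    OnLink : X → Set
    OnLink x = ∃[ A ] ∃[ i ] ∃[ b ] A ⊆ R t × x ≡ link t A i b
    split : ∀ x → owner x ≡ inj₁ t × Valid x → (x ≡ leaf t ⊎ x ≡ star t) ⊎ OnLink x
    split (leaf _)       (refl , _)       = inj₁ (inj₁ refl)
    split (star _)       (refl , _)       = inj₁ (inj₂ refl)
    split (link _ A i b) (refl , sub , _) = inj₂ (A , i , b , sub , refl)
  fibre (inj₂ A) = cover-≤ (s≤s z≤n)
    (centre A ∷ [] , ≤-refl , λ { (centre _) (refl , _) → here refl
                                ; (leaf _) (() , _) ; (star _) (() , _) ; (link _ _ _ _) (() , _) })

  rankOf : V T → ℕ
  rankOf = ownerKey π ∘ owner ∘ at

  over : Over R π T fibreSize
  over = record
    { owner  = owner ∘ at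
    ; links  = λ {x} {y} → incident-link {at x} {at y}
    ; fibres = λ o → cover-mono (λ v e → e , at-valid v)
        (cover-lookup unique (λ x → Data.Sum.Properties.≡-dec _≟ᶠ_ _≟ˢ_ (owner x) o ×-dec valid? x) (fibre o))
    ; σ      = byRank rankOf
    ; σ-key  = byRank-≤ rankOf
    }

  data Route : ℕ → X → X → Set where
    arrive : ∀ {k x} → Valid x → Route k x x
    go     : ∀ {k x w y} → Valid x → incident x w ≡ true → Route k w y → Route (suc k) x y

  route-start : ∀ {k x y} → Route k x y → Valid x
  route-start (arrive v) = v
  route-start (go v _ _) = v

  route⇒within : ∀ {k u v x y} → at u ≡ x → at v ≡ y → Route k x y → Within T (λ _ → Data.Unit.⊤) k u v
  route⇒within {u = u} {v} eu ev (arrive _) =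
    subst (Within T _ _ u) (at-injective (trans eu (sym ev))) (stop _)
  route⇒within {x = x} eu ev (go {w = w} _ e r) =
    move _ (subst₂ (λ a b → incident a b ≡ true) (sym eu) (sym (proj₂ (vertexOf w (route-start r)))) e)
      (route⇒within (proj₂ (vertexOf w (route-start r))) ev r)

  route-weaken : ∀ {k l x y} → k ≤ l → Route k x y → Route l x y
  route-weaken _       (arrive v)   = arrive v
  route-weaken (s≤s l) (go v e r)   = go v e (route-weaken l r)

  route-trans : ∀ {k l x y z} → Route k x y → Route l y z → Route (k + l) x z
  route-trans {k} {l} (arrive _) r = route-weaken (m≤n+m l k) r
  route-trans (go v e p)         r = go v e (route-trans p r)

  route-sym : ∀ {k x y} → Route k x y → Route k y x
  route-sym (arrive v) = arrive v
  route-sym {suc k} (go {x = x} {w} v e r) = route-weaken (≤-reflexive (+-comm k 1))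
    (route-trans (route-sym r)
      (go (route-start r) (trans (∨-comm ⌊ edge? w x ⌋ ⌊ edge? x w ⌋) e) (arrive v)))

  span≤max : ∀ A → span A ≤ maxSpan
  span≤max A = spanOf≤max ∣ A ∣ (label A)

  module _ {t : V G} {A : Subset n} (sub : A ⊆ R t) where

    position : ∀ {j} → j < span A → Fin maxSpan
    position lt = fromℕ< (≤-trans lt (span≤max A))

    toℕ-position : ∀ {j} (lt : j < span A) → toℕ (position lt) ≡ j
    toℕ-position lt = Finₚ.toℕ-fromℕ< (≤-trans lt (span≤max A))

    position-valid : ∀ {j} (lt : j < span A) b → Valid (link t A (position lt) b)
    position-valid lt b = sub , subst (_< span A) (sym (toℕ-position lt)) lt

    descend : ∀ {i b} j → toℕ i ≡ j → toℕ i < span A → Route (suc j) (link t A i b) (star t)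
    descend zero    e lt = go (sub , lt) (backward (first sub e)) (arrive _)
    descend {i} {b} (suc j) e lt = go (sub , lt)
      (backward (next {t} {A} {position lt'} {i} {b} (trans (cong suc (toℕ-position lt')) (sym e))))
      (descend j (toℕ-position lt') (subst (_< span A) (sym (toℕ-position lt')) lt'))
      where
      lt' : j < span A
      lt' = <-trans (≤-reflexive (sym e)) lt

    ascend : ∀ {i b} d → toℕ i + suc d ≡ span A → Route (suc d) (link t A i b) (centre A)
    ascend {i} {b} zero e =
      go (sub , ≤-reflexive e') (forward (last {b = b} sub e')) (arrive (inj₂ (t , sub)))
      where
      e' : suc (toℕ i) ≡ span A
      e' = trans (+-comm 1 (toℕ i)) e
    ascend {i} {b} (suc d) e = go (sub , ≤-trans (n≤1+n _) lt)
      (forward (next {t} {A} {i} {position lt} {b} (sym (toℕ-position lt))))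
      (ascend d (trans (cong (_+ suc d) (toℕ-position lt)) e'))
      where
      e' : suc (toℕ i) + suc d ≡ span A
      e' = trans (sym (+-suc (toℕ i) (suc d))) e
      lt : suc (toℕ i) < span A
      lt = subst (suc (toℕ i) <_) e' (m<m+n (suc (toℕ i)) (s≤s z≤n))

    span-positive : 0 < span A
    span-positive = ≤-trans (≤-trans (s≤s z≤n) (m≤n+m 2 (2 * K))) (base≤spanOf ∣ A ∣ (label A))

    spoke : Route (suc (span A)) (star t) (centre A)
    spoke = go _ (forward (first {b = false} sub (toℕ-position span-positive)))
      (route-weaken (≤-reflexive (suc-pred (span A) {{Data.Nat.>-nonZero span-positive}}))
        (ascend (Data.Nat.pred (span A))
          (trans (cong (_+ suc (Data.Nat.pred (span A))) (toℕ-position span-positive))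
                 (suc-pred (span A) {{Data.Nat.>-nonZero span-positive}}))))

    limb : Route (suc (suc (span A))) (leaf t) (centre A)
    limb = go _ (forward tip) spoke

  ∅⊆ : ∀ {A : Subset n} → ∅ ⊆ A
  ∅⊆ = ⊆-min _

  star-to-hub : ∀ t → Route (suc maxSpan) (star t) (centre ∅)
  star-to-hub t = route-weaken (s≤s (span≤max ∅)) (spoke {t} {∅} ∅⊆)

  to-hub : ∀ x → Valid x → Route reachBound x (centre ∅)
  to-hub (leaf t) _ = route-weaken (s≤s (m≤n+m (suc maxSpan) maxSpan)) (go _ (forward tip) (star-to-hub t))
  to-hub (star t) _ = route-weaken (m≤n+m (suc maxSpan) (suc maxSpan)) (star-to-hub t)
  to-hub (link t A i b) (sub , lt) = route-weaken
    (+-monoˡ-≤ (suc maxSpan) (≤-trans (≤-trans lt (span≤max A)) (n≤1+n maxSpan)))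
    (route-trans (descend sub (toℕ i) refl lt) (star-to-hub t))
  to-hub (centre A) (inj₁ refl)      = arrive (inj₁ refl)
  to-hub (centre A) (inj₂ (t , sub)) = route-trans
    (route-weaken (s≤s (span≤max A)) (route-sym (spoke sub))) (star-to-hub t)

  walk-along : ∀ {k u v x y} → at u ≡ x → at v ≡ y → Route k x y → Σ (Walk T u v) λ p → len p ≤ k
  walk-along eu ev r with within⇒path (route⇒within eu ev r)
  ... | p , _ , l , _ = p , l

  diam : ∀ x y → Σ (Walk T x y) λ p → len p ≤ diameter
  diam x y = walk-along refl refl
    (route-trans (to-hub (at x) (at-valid x)) (route-sym (to-hub (at y) (at-valid y))))

  -- The potential of x is a lower bound for its distance from the leaf of t₀; it is 1-Lipschitz.
  module Potential (t₀ : V G) where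

    shared : V G → Subset n
    shared t = R t₀ ∩ R t

    -- A path of span `s` has `s + 1` edges, so the route through the centre of `shared t` reaches
    -- the star of `t` after `1 + 2 * (s + 1)` steps and the leaf one step later.
    leafPot starPot : V G → ℕ
    leafPot t = if ⌊ t ≟ᶠ t₀ ⌋ then 0 else suc (2 * span (shared t) + 3)
    starPot t = if ⌊ t ≟ᶠ t₀ ⌋ then 1 else 2 * span (shared t) + 3

    centrePot : Subset n → ℕ
    centrePot A = if ⌊ A ⊆? R t₀ ⌋ then span A + 2 else cap

    -- On a path, the two terms continue the values of its two ends; each changes by at most 1 per
    -- step, and so does their minimum.
    pot : X → ℕ
    pot (leaf t)       = leafPot t
    pot (star t)       = starPot t
    pot (link t A i b) = (centrePot A + (span A ∸ toℕ i)) ⊓ (suc (starPot t) + toℕ i)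
    pot (centre A)     = centrePot A

    span-shared≤ : ∀ {t A} → A ⊆ R t₀ → A ⊆ R t → span (shared t) ≤ span A
    span-shared≤ {t} {A} s₀ s = span-mono (λ m → x∈p∩q⁺ (s₀ m , s m))
      (≤-trans (p⊆q⇒∣p∣≤∣q∣ (p∩q⊆p (R t₀) (R t))) (degree≤ t₀))

    -- If `A` lies in both `R t₀` and `R t`, it lies in `shared t`, whose span is no larger, so no
    -- such centre gives a shorter route. If `A` is not inside `R t₀`, its centre has potential
    -- `cap` and `cap-high` applies.
    star≤centre : ∀ {t A} → A ⊆ R t → starPot t ≤ suc (centrePot A + span A)
    star≤centre {t} {A} sub with t ≟ᶠ t₀ | A ⊆? R t₀
    ... | yes _ | _      = s≤s z≤n
    ... | no _  | yes s₀ = ≤-trans (+-monoˡ-≤ 3 (*-monoʳ-≤ 2 (span-shared≤ {t} {A} s₀ sub)))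
                             (≤-reflexive (double (span A)))
    ... | no _  | no _   = cap-high (span≤max (shared t)) (base≤spanOf ∣ A ∣ (label A))

    centre≤star : ∀ {t A} → A ⊆ R t → centrePot A ≤ suc (starPot t + span A)
    centre≤star {t} {A} sub with t ≟ᶠ t₀ | A ⊆? R t₀
    ... | yes refl | yes _  = ≤-reflexive (+-comm (span A) 2)
    ... | yes refl | no s₀  = contradiction (λ {x} → sub {x}) s₀
    ... | no _     | yes _  = ≤-trans (≤-reflexive (+-comm (span A) 2))
      (s≤s (+-monoˡ-≤ (span A) {1} (≤-trans (s≤s z≤n) (m≤n+m 3 (2 * span (shared t))))))
    ... | no _     | no _   = cap-low (base≤spanOf ∣ shared t ∣ (label (shared t))) (base≤spanOf ∣ A ∣ (label A))

    Close : ℕ → ℕ → Set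
    Close a b = a ≤ suc b × b ≤ suc a

    close-⊓ : ∀ {a b c d} → Close a c → Close b d → Close (a ⊓ b) (c ⊓ d)
    close-⊓ (p , q) (p' , q') = ⊓-mono-≤ p p' , ⊓-mono-≤ q q'

    ≤-suc-⊓ : ∀ {a b c} → c ≤ suc a → c ≤ suc b → c ≤ suc (a ⊓ b)
    ≤-suc-⊓ {a} {b} p q = ⊓-glb p q

    edge-close : ∀ {x y} → Edge x y → Close (pot x) (pot y)
    edge-close (tip {t}) with t ≟ᶠ t₀
    ... | yes _ = z≤n , ≤-refl
    ... | no  _ = ≤-refl , ≤-trans (n≤1+n _) (n≤1+n _)
    edge-close (first {t} {A} {i} sub e) =
      ≤-suc-⊓
        (≤-trans (star≤centre {t} {A} sub) (s≤s (+-monoʳ-≤ (centrePot A) (≤-reflexive (cong (span A ∸_) (sym e))))))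
        (≤-trans (n≤1+n _) (≤-trans (n≤1+n _) (s≤s (m≤m+n (suc (starPot t)) (toℕ i))))) ,
      ≤-trans (m⊓n≤n (centrePot A + (span A ∸ toℕ i)) _)
        (≤-reflexive (trans (cong (suc (starPot t) +_) e) (+-identityʳ _)))
    edge-close (next {t} {A} {i} {i'} e) = subst (λ k → Close (pot (link t A i true))
        ((centrePot A + (span A ∸ k)) ⊓ (suc (starPot t) + k))) e
      (close-⊓
        ( ≤-trans (+-monoʳ-≤ (centrePot A) drop) (≤-reflexive (+-suc (centrePot A) _))
        , ≤-trans (+-monoʳ-≤ (centrePot A) (∸-monoʳ-≤ (span A) (n≤1+n (toℕ i)))) (n≤1+n _))
        ( ≤-trans (+-monoʳ-≤ (suc (starPot t)) (n≤1+n (toℕ i))) (n≤1+n _)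
        , ≤-reflexive (+-suc (suc (starPot t)) (toℕ i))))
      where
      drop : span A ∸ toℕ i ≤ suc (span A ∸ suc (toℕ i))
      drop = ≤-trans (m≤n+m∸n (span A ∸ toℕ i) 1)
        (s≤s (≤-reflexive (trans (∸-+-assoc (span A) (toℕ i) 1) (cong (span A ∸_) (+-comm (toℕ i) 1)))))
    edge-close (last {t} {A} {i} sub e) =
      ≤-trans (m⊓n≤m (centrePot A + (span A ∸ toℕ i)) _)
        (≤-reflexive (trans (cong (centrePot A +_) gap) (+-comm (centrePot A) 1))) ,
      ≤-suc-⊓
        (≤-trans (m≤m+n (centrePot A) _) (n≤1+n _))
        (≤-trans (centre≤star {t} {A} sub) (≤-reflexive (cong suc
          (trans (cong (starPot t +_) (sym e)) (+-suc (starPot t) (toℕ i))))))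
      where
      gap : span A ∸ toℕ i ≡ 1
      gap = trans (cong (_∸ toℕ i) (sym e)) (m+n∸n≡m 1 (toℕ i))

    walk-pot : ∀ {x y} (p : Walk T x y) → pot (at y) ≤ len p + pot (at x)
    walk-pot here = ≤-refl
    walk-pot {x} {y} (step {w = w} e p) = begin
      pot (at y)                ≤⟨ walk-pot p ⟩
      len p + pot (at w)        ≤⟨ +-monoʳ-≤ (len p) (close (incident⁻ {at x} {at w} e)) ⟩
      len p + suc (pot (at x))  ≡⟨ +-suc (len p) (pot (at x)) ⟩
      suc (len p) + pot (at x)  ∎
      where
      open ≤-Reasoning
      close : Edge (at x) (at w) ⊎ Edge (at w) (at x) → pot (at w) ≤ suc (pot (at x))
      close (inj₁ e) = proj₂ (edge-close e)
      close (inj₂ e) = proj₁ (edge-close e)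

  embed : V G → V T
  embed t = proj₁ (vertexOf (leaf t) _)

  at-embed : ∀ t → at (embed t) ≡ leaf t
  at-embed t = proj₂ (vertexOf (leaf t) _)

  embed-injective : Injective _≡_ _≡_ embed
  embed-injective {u} {v} e = leaf-injective (trans (sym (at-embed u)) (trans (cong at e) (at-embed v)))
    where
    leaf-injective : ∀ {t t'} → _≡_ {A = X} (leaf t) (leaf t') → t ≡ t'
    leaf-injective refl = refl

  module _ {u v : V G} (u≢v : u ≢ v) where
    open Potential u

    private
      s = span (R u ∩ R v)

    source-pot : pot (at (embed u)) ≡ 0
    source-pot = trans (cong pot (at-embed u))
      (cong (λ b → if b then 0 else suc (2 * span (shared u) + 3)) (⌊⌋⁺ (u ≟ᶠ u) refl))

    target-pot : pot (at (embed v)) ≡ suc (2 * s + 3)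
    target-pot = trans (cong pot (at-embed v))
      (cong (λ b → if b then 0 else suc (2 * s + 3)) (⌊⌋-no (v ≟ᶠ u) (u≢v ∘ sym)))

    far-apart : (p : Walk T (embed u) (embed v)) → 2 * s + 4 ≤ len p
    far-apart p = begin
      2 * s + 4                    ≡⟨ +-suc (2 * s) 3 ⟩
      suc (2 * s + 3)              ≡⟨ sym target-pot ⟩
      pot (at (embed v))           ≤⟨ walk-pot p ⟩
      len p + pot (at (embed u))   ≡⟨ cong (len p +_) source-pot ⟩
      len p + 0                    ≡⟨ +-identityʳ (len p) ⟩
      len p                        ∎
      where open ≤-Reasoning

    joined : Σ (Walk T (embed u) (embed v)) λ p → len p ≤ (2 + s) + (2 + s)
    joined = walk-along (at-embed u) (at-embed v)
      (route-trans (limb {u} (p∩q⊆p (R u) (R v))) (route-sym (limb {v} (p∩q⊆q (R u) (R v)))))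

    distance : ∀ {l} → Dist T (embed u) (embed v) l → l ≡ 2 * s + 4
    distance ((p , e) , shortest) = ≤-antisym
      (≤-trans (shortest (proj₁ joined)) (≤-trans (proj₂ joined) (≤-reflexive (twice s))))
      (≤-trans (far-apart p) (≤-reflexive e))
      where
      twice : ∀ s → (2 + s) + (2 + s) ≡ 2 * s + 4
      twice = solve 1 (λ s → (con 2 :+ s) :+ (con 2 :+ s) := con 2 :* s :+ con 4) refl
        where open Data.Nat.Solver.+-*-Solver

  signature-span : ∀ A → signature (2 * span A + 4) ≡ label A
  signature-span A = signature-spanOf ∣ A ∣ (label A)

  distance-edge : ∀ u v l → Dist T (embed u) (embed v) l → (adj G u v ≡ true ⇔ signature l ≡ true)
  distance-edge u v l d = split (u ≟ᶠ v)
    where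
    split : Dec (u ≡ v) → (adj G u v ≡ true ⇔ signature l ≡ true)
    split (no u≢v) = mk⇔ (trans (sym same)) (trans same)
      where
      same : adj G u v ≡ signature l
      same = trans (edge u v u≢v)
        (trans (sym (signature-span (R u ∩ R v))) (cong signature (sym (distance u≢v d))))
    -- The empty walk forces distance 0, which the signature rejects, in agreement with the absence
    -- of loops.
    split (yes e) = mk⇔
      (λ a → contradiction (trans (sym a) (trans (cong (adj G u) (sym e)) (Graph.irrefl G u))) λ ())
      (λ t → contradiction (trans (sym t) (cong signature (n≤0⇒n≡0 (l≤0 e d)))) λ ())
      where
      l≤0 : ∀ {v} → u ≡ v → Dist T (embed u) (embed v) l → l ≤ 0
      l≤0 refl d = proj₂ d here

  leaf-degree1 : ∀ u → Degree1 T (embed u)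
  leaf-degree1 u = y , adjacent , only
    where
    y = proj₁ (vertexOf (star u) _)
    ey = proj₂ (vertexOf (star u) _)
    adjacent : adj T (embed u) y ≡ true
    adjacent = subst₂ (λ a b → incident a b ≡ true) (sym (at-embed u)) (sym ey) (forward (tip {u}))
    only-star : ∀ {x} → Edge (leaf u) x ⊎ Edge x (leaf u) → x ≡ star u
    only-star (inj₁ tip) = refl
    only : ∀ z → adj T (embed u) z ≡ true → z ≡ y
    only z a = at-injective (trans
      (only-star (incident⁻ {leaf u} {at z} (subst (λ x → incident x (at z) ≡ true) (at-embed u) a))) (sym ey))

  two-neighbours : ∀ {v x y y'} → at v ≡ x → Valid y → Valid y' → incident x y ≡ true → incident x y' ≡ true →
    y ≢ y' → ¬ Degree1 T v
  two-neighbours {v} {x} {y} {y'} refl vy vy' a a' y≢y' (z , _ , only) =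
    y≢y' (trans (sym (proj₂ (vertexOf y vy))) (trans (cong at (trans (is-z vy a) (sym (is-z vy' a'))))
      (proj₂ (vertexOf y' vy'))))
    where
    is-z : ∀ {y} (p : Valid y) → incident x y ≡ true → proj₁ (vertexOf y p) ≡ z
    is-z {y} p a = only _ (subst (λ w → incident x w ≡ true) (sym (proj₂ (vertexOf y p))) a)

  -- Tells the two neighbours of an inner path vertex apart, their heights being `toℕ i` and
  -- `2 + toℕ i`.
  height : X → ℕ
  height (leaf _)       = 0
  height (star _)       = 0
  height (link _ _ i _) = suc (toℕ i)
  height (centre A)     = suc (span A)

  lower-neighbour : ∀ {t A i b} → A ⊆ R t → toℕ i < span A →
    ∃[ y ] Valid y × Edge y (link t A i b) × height y ≡ toℕ i
  lower-neighbour {t} {A} {i} {b} sub lt = below (toℕ i) refl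
    where
    below : ∀ j → toℕ i ≡ j → ∃[ y ] Valid y × Edge y (link t A i b) × height y ≡ toℕ i
    below zero    e = star t , _ , first sub e , sym e
    below (suc j) e = link t A (position sub lt') b , position-valid sub lt' b , next e' , e'
      where
      lt' : j < span A
      lt' = <-trans (≤-reflexive (sym e)) lt
      e' : suc (toℕ (position sub lt')) ≡ toℕ i
      e' = trans (cong suc (toℕ-position sub lt')) (sym e)

  upper-neighbour : ∀ {t A i b} → A ⊆ R t → toℕ i < span A →
    ∃[ y ] Valid y × Edge (link t A i b) y × height y ≡ 2 + toℕ i
  upper-neighbour {t} {A} {i} {b} sub lt = above (suc (toℕ i) ≟ⁿ span A)
    where
    above : Dec (suc (toℕ i) ≡ span A) → ∃[ y ] Valid y × Edge (link t A i b) y × height y ≡ 2 + toℕ i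
    above (yes e) = centre A , inj₂ (t , sub) , last sub e , cong suc (sym e)
    above (no ne) = link t A (position sub lt') b , position-valid sub lt' b ,
                    next (sym (toℕ-position sub lt')) , cong suc (toℕ-position sub lt')
      where lt' = ≤∧≢⇒< lt ne

  degree1-leaf : ∀ v → Degree1 T v → ∃[ u ] embed u ≡ v
  degree1-leaf v d = by-kind (at v) refl (at-valid v)
    where
    by-kind : ∀ x → at v ≡ x → Valid x → ∃[ u ] embed u ≡ v
    by-kind (leaf t) e _ = t , at-injective (trans (at-embed t) (sym e))
    by-kind (star t) e _ = contradiction d
      (two-neighbours {y = leaf t} {y' = link t ∅ (position {t} ∅⊆ pos) false} e _
        (position-valid {t} ∅⊆ pos false) (backward tip)
        (forward (first {b = false} ∅⊆ (toℕ-position {t} ∅⊆ pos))) λ ())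
      where pos = span-positive {t} {∅} ∅⊆
    by-kind (link t A i b) e (sub , lt) =
      let y  , vy  , ey  , hy  = lower-neighbour {b = b} sub lt
          y' , vy' , ey' , hy' = upper-neighbour {b = b} sub lt
      in contradiction d (two-neighbours e vy vy' (backward ey) (forward ey')
           λ y≡y' → m≢1+n+m (toℕ i) {1} (trans (sym hy) (trans (cong height y≡y') hy')))
    -- The degree hypothesis supplies a neighbour, the end of one of two parallel paths; the end of
    -- its twin is a second neighbour. The hub over an empty `G` has no neighbour, so the hypothesis
    -- rules it out.
    by-kind (centre A) e _ = through (proj₁ d) (proj₁ (proj₂ d))
      where
      through : ∀ z → adj T v z ≡ true → ∃[ u ] embed u ≡ v
      through z a = other (at z) (at-valid z) (incident⁻ {centre A} {at z} (subst (λ x → incident x (at z) ≡ true) e a))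
        where
        flip-≢ : ∀ b → b ≢ not b
        flip-≢ true  ()
        flip-≢ false ()
        other : ∀ y → Valid y → Edge (centre A) y ⊎ Edge y (centre A) → ∃[ u ] embed u ≡ v
        other (link t A i b) vy (inj₂ (last sub ei)) = contradiction d
          (two-neighbours {y = link t A i b} {y' = link t A i (not b)} e vy vy
            (backward (last {b = b} sub ei)) (backward (last {b = not b} sub ei)) λ eq → flip-≢ b (bit-eq eq))
          where
          bit-eq : ∀ {t A i b b'} → _≡_ {A = X} (link t A i b) (link t A i b') → b ≡ b'
          bit-eq refl = refl

  shrub : Shrub 1 diameter (λ _ _ → signature) G
  shrub = record
    { F        = T
    ; S-range  = λ _ _ l e → ⌊⌋⁻ (1 ≤? l) (proj₁ (∧-true⁻ e)) ,
                             ⌊⌋⁻ (l ≤? diameter) (proj₁ (∧-true⁻ (proj₂ (∧-true⁻ {⌊ 1 ≤? l ⌋} e))))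
    ; S-sym    = λ _ _ _ → refl
    ; diam     = diam
    ; emb      = embed
    ; emb-inj  = embed-injective
    ; emb-leaf = leaf-degree1
    ; leaf-emb = degree1-leaf
    ; color    = λ _ → fz
    ; edges    = distance-edge
    }

  bounded : ColBounded (overBound F fibreSize) T
  bounded = byRank rankOf , byRank-injective rankOf , over-col system over

cond2⇒cond3 : ∀ 𝒢 → Cond2 𝒢 → Cond3 𝒢
cond2⇒cond3 𝒢 c₂ =
  (λ _ _ → Spans.signature (F 0)) , Spans.diameter (F 0) , ColBounded b , colBounded-expansion b ,
  λ G G∈ → ToShrub.shrub (nf G G∈) , ToShrub.bounded (nf G G∈)
  where
  F  = proj₁ (cond2⇒normalForm 𝒢 c₂)
  nf = proj₂ (cond2⇒normalForm 𝒢 c₂)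
  b  = overBound F (2 + 2 ^ F 0 * (Spans.maxSpan (F 0) * 2))

-- From shrub-decompositions to transductions

-- The syntax has no truth constants, so a variable at hand is compared with itself.
trueF falseF : ∀ {k n} → Fin n → Formula k n
trueF  i = eqF i i
falseF i = negF (eqF i i)

module OneCopy {p : ℕ} {G : Graph} (c : Fin p → V G → Bool) where

  M : Structure (p + 1)
  M = copyStructure p 1 G c

  sole : ∀ (i j : Fin 1) → (i ==ᶠ j) ≡ true
  sole fz fz = refl

  Holds : ∀ {n} → Formula (p + 1) n → (Fin n → V G × Fin 1) → Set
  Holds φ ρ = eval M φ ρ ≡ true

  edge⁻ : ∀ {n} {i j : Fin n} {ρ} → Holds (edgeF i j) ρ → adj G (proj₁ (ρ i)) (proj₁ (ρ j)) ≡ true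
  edge⁻ e = proj₁ (∧-true⁻ e)

  edge⁺ : ∀ {n} {i j : Fin n} {ρ} → adj G (proj₁ (ρ i)) (proj₁ (ρ j)) ≡ true → Holds (edgeF i j) ρ
  edge⁺ {i = i} {j} {ρ} e = ∧-true⁺ e (sole (proj₂ (ρ i)) (proj₂ (ρ j)))

  eq⁻ : ∀ {n} {i j : Fin n} {ρ} → Holds (eqF i j) ρ → proj₁ (ρ i) ≡ proj₁ (ρ j)
  eq⁻ {i = i} {j} {ρ} e = ⌊⌋⁻ (proj₁ (ρ i) ≟ᶠ proj₁ (ρ j)) (proj₁ (∧-true⁻ e))

  eq⁺ : ∀ {n} {i j : Fin n} {ρ} → proj₁ (ρ i) ≡ proj₁ (ρ j) → Holds (eqF i j) ρ
  eq⁺ {i = i} {j} {ρ} e = ∧-true⁺ (⌊⌋⁺ (proj₁ (ρ i) ≟ᶠ proj₁ (ρ j)) e) (sole (proj₂ (ρ i)) (proj₂ (ρ j)))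

  in-dom : ∀ x → x ∈ Structure.dom M
  in-dom (v , i) = ∈-cartesianProduct⁺ (∈-allFin v) (∈-allFin i)

  ex⁻ : ∀ {n} {φ : Formula (p + 1) (suc n)} {ρ} → Holds (exF φ) ρ → ∃[ x ] Holds φ (extend x ρ)
  ex⁻ {φ = φ} {ρ} e = let x , _ , h = any⁻ (λ a → eval M φ (extend a ρ)) (Structure.dom M) e in x , h

  ex⁺ : ∀ {n} {φ : Formula (p + 1) (suc n)} {ρ} x → Holds φ (extend x ρ) → Holds (exF φ) ρ
  ex⁺ x h = any⁺ _ (in-dom x) h

  all⁻ : ∀ {n} {φ : Formula (p + 1) (suc n)} {ρ} → Holds (allF φ) ρ → ∀ x → Holds φ (extend x ρ)
  all⁻ {φ = φ} {ρ} e x with eval M φ (extend x ρ) in h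
  ... | true  = refl
  ... | false = contradiction (any⁺ _ (in-dom x) (cong not h)) (not-true⁻ (trans (sym (all-any _ (Structure.dom M))) e))

  all⁺ : ∀ {n} {φ : Formula (p + 1) (suc n)} {ρ} → (∀ x → Holds φ (extend x ρ)) → Holds (allF φ) ρ
  all⁺ {φ = φ} {ρ} h = trans (all-any _ (Structure.dom M)) (not-true⁺ λ e →
    let x , _ , n = any⁻ (λ a → not (eval M φ (extend a ρ))) (Structure.dom M) e in not-true⁻ n (h x))

  trueF⁺ : ∀ {n} {i : Fin n} {ρ} → Holds (trueF i) ρ
  trueF⁺ {i = i} {ρ} = eq⁺ {i = i} {i} {ρ} refl

  falseF⁻ : ∀ {n} {i : Fin n} {ρ} → ¬ Holds (falseF i) ρ
  falseF⁻ {i = i} {ρ} e = not-true⁻ e (eq⁺ {i = i} {i} {ρ} refl)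

within : ∀ {k n} → ℕ → Fin n → Fin n → Formula k n
within zero    i j = eqF i j
within (suc l) i j = orF (eqF i j) (exF (andF (edgeF (fs i) fz) (within l fz (fs j))))

-- `S` is evaluated while the formula is built, so no predicate has to encode it. Distance 0
-- contributes no disjunct, in accordance with `S-range`.
atDistance : ∀ {k} → (ℕ → Bool) → ℕ → Formula k 2
atDistance S zero    = falseF fz
atDistance S (suc l) =
  orF (if S (suc l) then andF (within (suc l) fz (fs fz)) (negF (within l fz (fs fz))) else falseF fz)
      (atDistance S l)

onlyNeighbour : ∀ {k} → Formula k 2
onlyNeighbour = andF (edgeF (fs fz) fz) (allF (orF (negF (edgeF (fs (fs fz)) fz)) (eqF fz (fs fz))))

hasDegree1 : ∀ {k} → Formula k 1
hasDegree1 = exF onlyNeighbour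

module DistanceFormulas {p : ℕ} {G : Graph} (c : Fin p → V G → Bool) where
  open OneCopy {p} {G} c

  Connected : ℕ → V G → V G → Set
  Connected = Within G (λ _ → Data.Unit.⊤)

  connected? : ∀ l x y → Dec (Connected l x y)
  connected? = within? (λ _ → yes _)

  within⁻ : ∀ {n} l {i j : Fin n} {ρ} → Holds (within l i j) ρ → Connected l (proj₁ (ρ i)) (proj₁ (ρ j))
  within⁻ zero {i} {j} {ρ} h = subst (Connected 0 _) (eq⁻ {i = i} {j} {ρ} h) (stop _)
  within⁻ (suc l) {i} {j} {ρ} h with ∨-true⁻ {eval M (eqF i j) ρ} h
  ... | inj₁ e = subst (Connected (suc l) _) (eq⁻ {i = i} {j} {ρ} e) (stop _)
  ... | inj₂ e with ex⁻ {φ = andF (edgeF (fs i) fz) (within l fz (fs j))} {ρ} e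
  ...   | x , hx = move _ (edge⁻ {i = fs i} {fz} {extend x ρ} (proj₁ (∧-true⁻ hx)))
                     (within⁻ l {fz} {fs j} {extend x ρ} (proj₂ (∧-true⁻ {eval M (edgeF (fs i) fz) (extend x ρ)} hx)))

  within⁺ : ∀ {n} l {i j : Fin n} {ρ} → Connected l (proj₁ (ρ i)) (proj₁ (ρ j)) → Holds (within l i j) ρ
  within⁺ l {i} {j} {ρ} w = go l {i} {j} {ρ} w refl refl
    where
    go : ∀ {n} l {i j : Fin n} {ρ} {x y} → Connected l x y → proj₁ (ρ i) ≡ x → proj₁ (ρ j) ≡ y →
      Holds (within l i j) ρ
    go zero    {i} {j} {ρ} (stop _) ei ej = eq⁺ {i = i} {j} {ρ} (trans ei (sym ej))
    go (suc l) {i} {j} {ρ} (stop _) ei ej = ∨-true⁺ˡ (eq⁺ {i = i} {j} {ρ} (trans ei (sym ej)))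
    go (suc l) {i} {j} {ρ} (move {w = w} _ e p) ei ej = ∨-true⁺ʳ {eval M (eqF i j) ρ}
      (ex⁺ {φ = andF (edgeF (fs i) fz) (within l fz (fs j))} {ρ} (w , fz)
        (∧-true⁺ (edge⁺ {i = fs i} {fz} {extend (w , fz) ρ} (subst (λ x → adj G x w ≡ true) (sym ei) e))
                 (go l {fz} {fs j} {extend (w , fz) ρ} p refl ej)))

  dist⁺ : ∀ {l x y} → Connected (suc l) x y → ¬ Connected l x y → Dist G x y (suc l)
  dist⁺ {l} {x} {y} w nw with within⇒path w
  ... | p , _ , le , _ = (p , ≤-antisym le (shortest p)) , shortest
    where
    shortest : ∀ (q : Walk G x y) → suc l ≤ len q
    shortest q = ≰⇒> λ le → nw (within-weaken le id (walk⇒within q (All.universal (λ _ → _) (verts q))))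

  dist-exists : ∀ l {x y} → Connected l x y → ∃[ k ] k ≤ l × Dist G x y k
  dist-exists zero    (stop _) = 0 , z≤n , (here , refl) , λ _ → z≤n
  dist-exists (suc l) {x} {y} w with connected? l x y
  ... | no nw = suc l , ≤-refl , dist⁺ w nw
  ... | yes w' = let k , le , d = dist-exists l w' in k , m≤n⇒m≤1+n le , d

  dist⁻ : ∀ {l x y} → Dist G x y (suc l) → Connected (suc l) x y × ¬ Connected l x y
  dist⁻ ((p , e) , shortest) =
    within-weaken (≤-reflexive e) id (walk⇒within p (All.universal (λ _ → _) (verts p))) ,
    λ w → let q , _ , le , _ = within⇒path w in contradiction (≤-trans (shortest q) le) (<-irrefl refl)

  atDistance⁻ : ∀ S d {ρ} → Holds (atDistance S d) ρ →
    ∃[ l ] S l ≡ true × Dist G (proj₁ (ρ fz)) (proj₁ (ρ (fs fz))) l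
  atDistance⁻ S zero    {ρ} h = contradiction h (falseF⁻ {i = fz} {ρ})
  atDistance⁻ S (suc d) {ρ} h with S (suc d) in s | ∨-true⁻
    {eval M (if S (suc d) then andF (within (suc d) fz (fs fz)) (negF (within d fz (fs fz))) else falseF fz) ρ} h
  ... | _     | inj₂ h' = atDistance⁻ S d {ρ} h'
  ... | true  | inj₁ h' = suc d , s , dist⁺
    (within⁻ (suc d) {fz} {fs fz} {ρ} (proj₁ (∧-true⁻ h')))
    (λ w → not-true⁻ (proj₂ (∧-true⁻ {eval M (within (suc d) fz (fs fz)) ρ} h'))
             (within⁺ d {fz} {fs fz} {ρ} w))
  ... | false | inj₁ h' = contradiction h' (falseF⁻ {i = fz} {ρ})

  atDistance⁺ : ∀ S d {l ρ} → suc l ≤ d → S (suc l) ≡ true →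
    Dist G (proj₁ (ρ fz)) (proj₁ (ρ (fs fz))) (suc l) → Holds (atDistance S d) ρ
  atDistance⁺ S (suc d) {l} {ρ} (s≤s le) s dist with l ≟ⁿ d
  ... | no ne = ∨-true⁺ʳ
    {eval M (if S (suc d) then andF (within (suc d) fz (fs fz)) (negF (within d fz (fs fz))) else falseF fz) ρ}
    (atDistance⁺ S d {l} {ρ} (≤∧≢⇒< le ne) s dist)
  ... | yes refl rewrite s = ∨-true⁺ˡ (∧-true⁺ (within⁺ (suc l) {fz} {fs fz} {ρ} (proj₁ (dist⁻ dist)))
    (not-true⁺ (proj₂ (dist⁻ dist) ∘ within⁻ l {fz} {fs fz} {ρ})))

  hasDegree1⁻ : ∀ {x} → Holds hasDegree1 (one x) → Degree1 G (proj₁ x)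
  hasDegree1⁻ {x} h with ex⁻ {φ = onlyNeighbour} {one x} h
  ... | y , hy = proj₁ y , edge⁻ {i = fs fz} {fz} {extend y (one x)} (proj₁ (∧-true⁻ hy)) , only
    where
    only : ∀ z → adj G (proj₁ x) z ≡ true → z ≡ proj₁ y
    only z a with ∨-true⁻ {not (eval M (edgeF (fs (fs fz)) fz) (extend (z , fz) (extend y (one x))))}
                   (all⁻ {φ = orF (negF (edgeF (fs (fs fz)) fz)) (eqF fz (fs fz))} {extend y (one x)}
                     (proj₂ (∧-true⁻ {eval M (edgeF (fs fz) fz) (extend y (one x))} hy)) (z , fz))
    ... | inj₁ n = contradiction (edge⁺ {i = fs (fs fz)} {fz} {extend (z , fz) (extend y (one x))} a) (not-true⁻ n)
    ... | inj₂ e = eq⁻ {i = fz} {fs fz} {extend (z , fz) (extend y (one x))} e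

  hasDegree1⁺ : ∀ {x} → Degree1 G (proj₁ x) → Holds hasDegree1 (one x)
  hasDegree1⁺ {x} (y , a , only) = ex⁺ {φ = onlyNeighbour} {one x} (y , fz)
    (∧-true⁺ (edge⁺ {i = fs fz} {fz} {extend (y , fz) (one x)} a)
      (all⁺ {φ = orF (negF (edgeF (fs (fs fz)) fz)) (eqF fz (fs fz))} {extend (y , fz) (one x)} unique))
    where
    unique : ∀ z → Holds (orF (negF (edgeF (fs (fs fz)) fz)) (eqF fz (fs fz))) (extend z (extend (y , fz) (one x)))
    unique z with adj G (proj₁ x) (proj₁ z) ≟ᵇ true
    ... | yes e = ∨-true⁺ʳ {not (eval M (edgeF (fs (fs fz)) fz) (extend z (extend (y , fz) (one x))))}
      (eq⁺ {i = fz} {fs fz} {extend z (extend (y , fz) (one x))} (only _ e))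
    ... | no ne = ∨-true⁺ˡ (not-true⁺ (ne ∘ edge⁻ {i = fs (fs fz)} {fz} {extend z (extend (y , fz) (one x))}))

sole-copy : {A : Set} (x : A × Fin 1) → (proj₁ x , fz) ≡ x
sole-copy (_ , fz) = refl

module FromShrub {d S G} (D : Shrub 1 d S G) where
  open Shrub D
  open DistanceFormulas {0} {F} (λ ()) using (hasDegree1⁺; hasDegree1⁻; atDistance⁺; atDistance⁻; dist-exists)
  open OneCopy {0} {F} (λ ())

  S₁ : ℕ → Bool
  S₁ = S fz fz

  S₁-color : ∀ u v l → S₁ l ≡ S (color u) (color v) l
  S₁-color u v l = cong₂ (λ i j → S i j l) (only (color u)) (only (color v))
    where
    only : ∀ (i : Fin 1) → fz ≡ i
    only fz = refl

  place : V G → V F × Fin 1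
  place u = emb u , fz

  φ : Formula 1 2
  φ = atDistance S₁ d

  φ⁻ : ∀ u v → Holds φ (two (place u) (place v)) → adj G u v ≡ true
  φ⁻ u v h = let l , s , dist = atDistance⁻ S₁ d {two (place u) (place v)} h in
    Equivalence.from (edges u v l dist) (trans (sym (S₁-color u v l)) s)

  φ⁺ : ∀ u v → adj G u v ≡ true → Holds φ (two (place u) (place v))
  φ⁺ u v a = let p , le = diam (emb u) (emb v)
                 l , _ , dist = dist-exists (len p) (walk⇒within p (All.universal (λ _ → _) (verts p)))
             in positive l dist (trans (S₁-color u v l) (Equivalence.to (edges u v l dist) a))
    where
    positive : ∀ l → Dist F (emb u) (emb v) l → S₁ l ≡ true → Holds φ (two (place u) (place v))
    positive zero    dist s = contradiction (proj₁ (S-range fz fz 0 s)) λ ()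
    positive (suc l) dist s =
      atDistance⁺ S₁ d {l} {two (place u) (place v)} (proj₂ (S-range fz fz (suc l) s)) s dist

  output : IsBasicOutput M (allF (eqF fz fz)) hasDegree1 φ G
  output =
    all⁺ {φ = eqF fz fz} {noVars} (λ x → eq⁺ {i = fz} {fz} {extend x noVars} refl) ,
    place ,
    (λ e → emb-inj (cong proj₁ e)) ,
    (λ u → hasDegree1⁺ {place u} (emb-leaf u)) ,
    (λ x h → let u , e = leaf-emb (proj₁ x) (hasDegree1⁻ {x} h) in u , trans (cong (_, fz) e) (sole-copy x)) ,
    λ u v u≢v → bool-ext
      (λ a → ∨-true⁺ˡ (φ⁺ u v a))
      (λ h → [ φ⁻ u v , (λ h' → trans (Graph.sym G u v) (φ⁻ v u h')) ]′ (∨-true⁻ h))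

cond3⇒cond1 : ∀ 𝒢 → Cond3 𝒢 → Cond1 𝒢
cond3⇒cond1 𝒢 (S , d , 𝒢' , be , dec) =
  -- The vertices of the graph are definable as those of degree one, hence no colours.
  𝒢' , be , record { p = 0 ; m = 1 ; chi = allF (eqF fz fz) ; nu = hasDegree1 ; phi = atDistance (S fz fz) d } ,
  λ G G∈ → Shrub.F (proj₁ (dec G G∈)) , proj₂ (dec G G∈) , (λ ()) , FromShrub.output (proj₁ (dec G G∈))

-- From parity-decompositions to transductions

distinctF : ∀ {k n} → Fin n → List (Fin n) → Formula k n
distinctF x []       = trueF x
distinctF x (y ∷ ys) = andF (negF (eqF x y)) (distinctF x ys)

-- `used` lists the neighbours chosen so far, which keeps the quantified ones pairwise distinct; its
-- variables are shifted under each new quantifier.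
atLeast : ∀ {k n} → ℕ → Fin n → Fin n → List (Fin n) → Formula k n
oneMore : ∀ {k n} → ℕ → Fin n → Fin n → List (Fin n) → Formula k (suc n)

atLeast zero    u v used = trueF u
atLeast (suc j) u v used = exF (oneMore j u v used)

oneMore j u v used = andF (edgeF (fs u) fz) (andF (edgeF (fs v) fz)
  (andF (distinctF fz (map fs used)) (atLeast j (fs u) (fs v) (fz ∷ map fs used))))

-- "Exactly `i`" is written as at least `i` and not at least `i + 1`, for each odd `i` up to `d`.
-- This range suffices because a target has degree at most `d`.
oddlyMany : ∀ {k} → ℕ → Formula k 2
oddlyMany zero    = falseF fz
oddlyMany (suc d) =
  orF (if odd (suc d) then andF (atLeast (suc d) fz (fs fz) []) (negF (atLeast (2 + d) fz (fs fz) []))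
                      else falseF fz)
      (oddlyMany d)

module CountingFormulas {p : ℕ} {G : Graph} (c : Fin p → V G → Bool) where
  open OneCopy {p} {G} c

  distinct⁻ : ∀ {n} {x : Fin n} ys {ρ} → Holds (distinctF x ys) ρ → proj₁ (ρ x) ∉ map (proj₁ ∘ ρ) ys
  distinct⁻ {x = x} (y ∷ ys) {ρ} h (here e)  =
    not-true⁻ (proj₁ (∧-true⁻ h)) (eq⁺ {i = x} {y} {ρ} e)
  distinct⁻ {x = x} (y ∷ ys) {ρ} h (there m) =
    distinct⁻ {x = x} ys {ρ} (proj₂ (∧-true⁻ {not (eval M (eqF x y) ρ)} h)) m

  distinct⁺ : ∀ {n} {x : Fin n} ys {ρ} → proj₁ (ρ x) ∉ map (proj₁ ∘ ρ) ys → Holds (distinctF x ys) ρ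
  distinct⁺ {x = x} []       {ρ} _ = trueF⁺ {i = x} {ρ}
  distinct⁺ {x = x} (y ∷ ys) {ρ} h = ∧-true⁺
    (not-true⁺ (h ∘ here ∘ eq⁻ {i = x} {y} {ρ})) (distinct⁺ {x = x} ys {ρ} (h ∘ there))

  Common : V G → V G → V G → Set
  Common x y h = adj G x h ≡ true × adj G y h ≡ true

  Chosen : ℕ → V G → V G → List (V G) → Set
  Chosen j x y used = Σ (List (V G)) λ hs → length hs ≡ j × Unique hs ×
    All (λ h → Common x y h × h ∉ used) hs

  chosen-cons : ∀ {j x y used h} → Common x y h → h ∉ used → Chosen j x y (h ∷ used) → Chosen (suc j) x y used
  chosen-cons cm new (hs , l , u , a) =
    _ ∷ hs , cong suc l , All.map (λ { (_ , n) refl → n (here refl) }) a ∷ u ,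
    (cm , new) ∷ All.map (λ { (cm' , n) → cm' , n ∘ there }) a

  chosen-uncons : ∀ {j x y used} → Chosen (suc j) x y used →
    ∃[ h ] Common x y h × h ∉ used × Chosen j x y (h ∷ used)
  chosen-uncons (h ∷ hs , l , h∉ ∷ u , (cm , new) ∷ a) =
    h , cm , new , hs , suc-injective l , u ,
    All.zipWith (λ { (ne , cm' , n) → cm' , λ { (here e) → ne (sym e) ; (there m) → n m } }) (h∉ , a)

  values : ∀ {n} (z : V G × Fin 1) (ρ : Fin n → V G × Fin 1) used →
    map (proj₁ ∘ extend z ρ) (map fs used) ≡ map (proj₁ ∘ ρ) used
  values z ρ used = sym (Data.List.Properties.map-∘ used)

  atLeast⁻ : ∀ {n} j {u v : Fin n} used {ρ} → Holds (atLeast j u v used) ρ →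
    Chosen j (proj₁ (ρ u)) (proj₁ (ρ v)) (map (proj₁ ∘ ρ) used)
  atLeast⁻ zero    used h = [] , refl , [] , []
  atLeast⁻ (suc j) {u} {v} used {ρ} h with ex⁻ {φ = oneMore j u v used} {ρ} h
  ... | z , hz with ∧-true⁻ {eval M (edgeF (fs u) fz) (extend z ρ)} hz
  ...   | eu , hz' with ∧-true⁻ {eval M (edgeF (fs v) fz) (extend z ρ)} hz'
  ...     | ev , hz'' with ∧-true⁻ {eval M (distinctF fz (map fs used)) (extend z ρ)} hz''
  ...       | ds , rest = chosen-cons
    (edge⁻ {i = fs u} {fz} {extend z ρ} eu , edge⁻ {i = fs v} {fz} {extend z ρ} ev)
    (subst (proj₁ z ∉_) (values z ρ used) (distinct⁻ {x = fz} (map fs used) {extend z ρ} ds))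
    (subst (λ l → Chosen j _ _ (proj₁ z ∷ l)) (values z ρ used)
      (atLeast⁻ j {fs u} {fs v} (fz ∷ map fs used) {extend z ρ} rest))

  atLeast⁺ : ∀ {n} j {u v : Fin n} used {ρ} →
    Chosen j (proj₁ (ρ u)) (proj₁ (ρ v)) (map (proj₁ ∘ ρ) used) → Holds (atLeast j u v used) ρ
  atLeast⁺ zero    {u} used {ρ} _ = trueF⁺ {i = u} {ρ}
  atLeast⁺ (suc j) {u} {v} used {ρ} ch =
    let h , (a , b) , new , rest = chosen-uncons ch
        z = (h , fz)
    in ex⁺ {φ = oneMore j u v used} {ρ} z
        (∧-true⁺ (edge⁺ {i = fs u} {fz} {extend z ρ} a)
        (∧-true⁺ (edge⁺ {i = fs v} {fz} {extend z ρ} b)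
        (∧-true⁺ (distinct⁺ {x = fz} (map fs used) {extend z ρ} (subst (h ∉_) (sym (values z ρ used)) new))
                 (atLeast⁺ j {fs u} {fs v} (fz ∷ map fs used) {extend z ρ}
                   (subst (λ l → Chosen j _ _ (h ∷ l)) (sym (values z ρ used)) rest)))))

  commonSet : V G → V G → Subset (size G)
  commonSet x y = tabulate (λ h → adj G x h ∧ adj G y h)

  ∈-commonSet⁺ : ∀ {x y h} → Common x y h → h ∈ˢ commonSet x y
  ∈-commonSet⁺ {x} {y} {h} (a , b) = lookup⇒[]= h _ (trans (lookup∘tabulate _ h) (∧-true⁺ a b))

  ∈-commonSet⁻ : ∀ {x y h} → h ∈ˢ commonSet x y → Common x y h
  ∈-commonSet⁻ {x} {y} {h} m = ∧-true⁻ (trans (sym (lookup∘tabulate _ h)) ([]=⇒lookup m))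

  chosen⇒≤ : ∀ {j x y} → Chosen j x y [] → j ≤ commonCount G x y
  chosen⇒≤ {j} {x} {y} (hs , refl , u , a) = begin
    length hs                          ≤⟨ unique-⊆⇒length≤ u (λ m →
                                            ∈-elements⁺ (∈-commonSet⁺ (proj₁ (All.lookup a m)))) ⟩
    length (elements (commonSet x y))  ≤⟨ length-elements≤ (commonSet x y) ⟩
    ∣ commonSet x y ∣                  ≡⟨ sym (count≡∣∣ (λ h → adj G x h ∧ adj G y h)) ⟩
    commonCount G x y                  ∎
    where open ≤-Reasoning

  ≤⇒chosen : ∀ {j x y} → j ≤ commonCount G x y → Chosen j x y []
  ≤⇒chosen {j} {x} {y} le =
    Data.List.take j es ,
    trans (Data.List.Properties.length-take j es) (m≤n⇒m⊓n≡m (≤-trans le count≤es)) ,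
    Data.List.Relation.Unary.Unique.Propositional.Properties.take⁺ j (elements-unique (commonSet x y)) ,
    Data.List.Relation.Unary.All.Properties.take⁺ j (All.tabulate (λ m → ∈-commonSet⁻ (∈-elements⁻ m) , λ ()))
    where
    es = elements (commonSet x y)
    count≤es : commonCount G x y ≤ length es
    count≤es = ≤-trans (≤-reflexive (count≡∣∣ (λ h → adj G x h ∧ adj G y h)))
      (∣∣≤length (commonSet x y) es (λ _ → ∈-elements⁺))

  oddlyMany⁻ : ∀ d {ρ} → Holds (oddlyMany d) ρ →
    odd (commonCount G (proj₁ (ρ fz)) (proj₁ (ρ (fs fz)))) ≡ true
  oddlyMany⁻ zero    {ρ} h = contradiction h (falseF⁻ {i = fz} {ρ})
  oddlyMany⁻ (suc d) {ρ} h with odd (suc d) in o | ∨-true⁻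
    {eval M (if odd (suc d) then andF (atLeast (suc d) fz (fs fz) []) (negF (atLeast (2 + d) fz (fs fz) []))
                            else falseF fz) ρ} h
  ... | _     | inj₂ h' = oddlyMany⁻ d {ρ} h'
  ... | false | inj₁ h' = contradiction h' (falseF⁻ {i = fz} {ρ})
  ... | true  | inj₁ h' = subst (λ k → odd k ≡ true) (≤-antisym
    (chosen⇒≤ (atLeast⁻ (suc d) {fz} {fs fz} [] {ρ} (proj₁ (∧-true⁻ h'))))
    (≤-pred (≰⇒> λ le → not-true⁻ (proj₂ (∧-true⁻ {eval M (atLeast (suc d) fz (fs fz) []) ρ} h'))
      (atLeast⁺ (2 + d) {fz} {fs fz} [] {ρ} (≤⇒chosen le))))) o

  oddlyMany⁺ : ∀ d {ρ} → commonCount G (proj₁ (ρ fz)) (proj₁ (ρ (fs fz))) ≤ d →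
    odd (commonCount G (proj₁ (ρ fz)) (proj₁ (ρ (fs fz)))) ≡ true → Holds (oddlyMany d) ρ
  oddlyMany⁺ zero    {ρ} le o = contradiction (trans (sym o) (cong odd (n≤0⇒n≡0 le))) λ ()
  oddlyMany⁺ (suc d) {ρ} le o = split (commonCount G (proj₁ (ρ fz)) (proj₁ (ρ (fs fz))) ≟ⁿ suc d)
    where
    top : Formula (p + 1) 2
    top = andF (atLeast (suc d) fz (fs fz) []) (negF (atLeast (2 + d) fz (fs fz) []))
    split : Dec (commonCount G (proj₁ (ρ fz)) (proj₁ (ρ (fs fz))) ≡ suc d) → Holds (oddlyMany (suc d)) ρ
    split (no ne) = ∨-true⁺ʳ {eval M (if odd (suc d) then top else falseF fz) ρ}
      (oddlyMany⁺ d {ρ} (≤-pred (≤∧≢⇒< le ne)) o)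
    split (yes e) = ∨-true⁺ˡ (subst (λ b → Holds (if b then top else falseF fz) ρ)
      (sym (trans (cong odd (sym e)) o))
      (∧-true⁺ (atLeast⁺ (suc d) {fz} {fs fz} [] {ρ} (≤⇒chosen (≤-reflexive (sym e))))
        (not-true⁺ λ h → contradiction
          (≤-trans (chosen⇒≤ (atLeast⁻ (2 + d) {fz} {fs fz} [] {ρ} h)) (≤-reflexive e)) (<-irrefl refl))))

  common≤degree : ∀ x y → commonCount G x y ≤ degree G x
  common≤degree x y = ≤-trans (≤-reflexive (count≡∣∣ (λ h → adj G x h ∧ adj G y h)))
    (≤-trans (p⊆q⇒∣p∣≤∣q∣ inside) (≤-reflexive (sym (count≡∣∣ (adj G x)))))
    where
    inside : commonSet x y ⊆ tabulate (adj G x)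
    inside {h} m = lookup⇒[]= h _ (trans (lookup∘tabulate _ h) (proj₁ (∈-commonSet⁻ {x} {y} m)))

isTarget : Side → Bool
isTarget tgt = true
isTarget hid = false

isTarget⁻ : ∀ s → isTarget s ≡ true → s ≡ tgt
isTarget⁻ tgt _ = refl

module FromParity {d G} (D : Parity d G) where
  open Parity D
  open TargetEmbedding target

  colour : Fin 1 → V P → Bool
  colour _ x = isTarget (side x)

  open CountingFormulas {1} {P} colour using (oddlyMany⁺; oddlyMany⁻; common≤degree)
  open OneCopy {1} {P} colour

  place : V G → V P × Fin 1
  place u = emb u , fz

  φ⁻ : ∀ u v → u ≢ v → Holds (oddlyMany d) (two (place u) (place v)) → adj G u v ≡ true
  φ⁻ u v u≢v h = Equivalence.from (edges u v u≢v)
    (Equivalence.to (odd⇔%2 (commonCount P (emb u) (emb v))) (oddlyMany⁻ d {two (place u) (place v)} h))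

  φ⁺ : ∀ u v → u ≢ v → adj G u v ≡ true → Holds (oddlyMany d) (two (place u) (place v))
  φ⁺ u v u≢v a = oddlyMany⁺ d {two (place u) (place v)}
    (≤-trans (common≤degree (emb u) (emb v)) (deg (emb u) (emb-tgt u)))
    (Equivalence.from (odd⇔%2 (commonCount P (emb u) (emb v))) (Equivalence.to (edges u v u≢v) a))

  output : IsBasicOutput M (allF (eqF fz fz)) (predF fz fz) (oddlyMany d) G
  output =
    all⁺ {φ = eqF fz fz} {noVars} (λ x → eq⁺ {i = fz} {fz} {extend x noVars} refl) ,
    place ,
    (λ e → emb-inj (cong proj₁ e)) ,
    (λ u → cong isTarget (emb-tgt u)) ,
    (λ x h → let u , e = emb-onto (proj₁ x) (isTarget⁻ _ h) in u , trans (cong (_, fz) e) (sole-copy x)) ,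
    λ u v u≢v → bool-ext
      (λ a → ∨-true⁺ˡ (φ⁺ u v u≢v a))
      (λ h → [ φ⁻ u v u≢v , (λ h' → trans (Graph.sym G u v) (φ⁻ v u (u≢v ∘ sym) h')) ]′ (∨-true⁻ h))

cond4⇒cond1 : ∀ 𝒢 → Cond4 𝒢 → Cond1 𝒢
cond4⇒cond1 𝒢 (d , 𝒢' , be , dec) =
  -- The one colour marks the targets, which need not be definable in the bare graph.
  𝒢' , be , record { p = 1 ; m = 1 ; chi = allF (eqF fz fz) ; nu = predF fz fz ; phi = oddlyMany d } ,
  λ G G∈ → Parity.P (proj₁ (dec G G∈)) , proj₂ (dec G G∈) ,
           FromParity.colour (proj₁ (dec G G∈)) , FromParity.output (proj₁ (dec G G∈))

theorem6 : (𝒢 : Class) →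
    (Cond1 𝒢 ⇔ Cond2 𝒢) × (Cond1 𝒢 ⇔ Cond3 𝒢) × (Cond1 𝒢 ⇔ Cond4 𝒢)
theorem6 𝒢 =
  mk⇔ (cond1⇒cond2 𝒢) (cond3⇒cond1 𝒢 ∘ cond2⇒cond3 𝒢) ,
  mk⇔ (cond2⇒cond3 𝒢 ∘ cond1⇒cond2 𝒢) (cond3⇒cond1 𝒢) ,
  mk⇔ (cond2⇒cond4 𝒢 ∘ cond1⇒cond2 𝒢) (cond4⇒cond1 𝒢)
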